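{- For all $n \geq 0$, $p_{\xi}(96n+76) \equiv 0 \pmod{9}$.
   Context: $(a;q)_n=(1-a)(1-aq)\cdots(1-aq^{n-1})$, $(a;q)_0=1$. The coefficients $p_\xi(n)$ are defined by $\sum_{n\ge0}p_\xi(n)q^n=\xi(q)=1+2\sum_{n\ge1}\frac{q^{6n^2-6n+1}}{(q;q^6)_n(q^5;q^6)_n}$. -}

module Defs where

-- Formal power series over ℤ in q, represented by their coefficient functions.

open import Data.Nat as ℕ using (ℕ; zero; suc; _∸_; _≡ᵇ_)
open import Data.Integer as ℤ using (ℤ; +_; -_; _+_; _*_; 0ℤ; 1ℤ)
open import Data.List using (List; []; _∷_; upTo; map; foldr)
open import Data.Bool using (if_then_else_)

PS : Set
PS = ℕ → ℤ

one : PS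
one i = if i ≡ᵇ 0 then 1ℤ else 0ℤ

qPow : ℕ → PS
qPow m i = if i ≡ᵇ m then 1ℤ else 0ℤ

oneMinusQ : ℕ → PS
oneMinusQ m i = one i + (- qPow m i)

_⊛_ : PS → PS → PS
(f ⊛ g) N = foldr _+_ 0ℤ (map (λ i → f i * g (N ∸ i)) (upTo (suc N)))

sumTo : ℕ → (ℕ → PS) → PS
sumTo zero    F i = 0ℤ
sumTo (suc n) F i = sumTo n F i + F n i

poch6 : ℕ → ℕ → PS
poch6 a zero    = one
poch6 a (suc n) = poch6 a n ⊛ oneMinusQ (a ℕ.+ 6 ℕ.* n)

-- Multiplicative inverse of a power series f with f 0 = 1.
-- invRev f N = [g_N, g_{N-1}, ..., g_0] where g = 1/f, via
-- g_0 = 1, g_N = - Σ_{i=1}^{N} f_i g_{N-i}.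
private
  step : PS → List ℤ → ℤ
  step f rev = - sumIdx 0 rev
    where
    sumIdx : ℕ → List ℤ → ℤ
    sumIdx j []       = 0ℤ
    sumIdx j (g ∷ gs) = f (suc j) * g + sumIdx (suc j) gs

invRev : PS → ℕ → List ℤ
invRev f zero    = 1ℤ ∷ []
invRev f (suc N) = let rev = invRev f N in step f rev ∷ rev

inv : PS → PS
inv f N with invRev f N
... | []    = 0ℤ
... | g ∷ _ = g

xiTerm : ℕ → PS
xiTerm n = qPow (6 ℕ.* n ℕ.* n ∸ 6 ℕ.* n ℕ.+ 1) ⊛ inv (poch6 1 n ⊛ poch6 5 n)

-- p_ξ(N) = coefficient of q^N in ξ(q) = 1 + 2 Σ_{n≥1} xiTerm n.
-- Only n with 6n^2-6n+1 ≤ N contribute to q^N, and 6n^2-6n+1 ≥ n for n ≥ 1,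
-- so summing over 1 ≤ n ≤ N is exact.
pXi : ℕ → ℤ
pXi N = one N + (+ 2) * sumTo N (λ k → xiTerm (suc k)) N

{-# OPTIONS --safe #-}
module Submission where

-- A finite partial fraction expansion of 1/((q;q⁶)ₙ₊₁(q⁵;q⁶)ₙ₊₁), summed over n with Cauchy's identity, turns ξ into
-- 1 + 2q(q⁶;q⁶)_∞⁻¹ times a series of rational functions in q whose terms are easily trisected; the outcome is
-- Σ p_ξ(3n+1)qⁿ = 2C with C = f₃f₆/f₁, where f_k = (q^k;q^k)_∞. Since 96n+76 = 3(32n+25)+1, the coefficients of C at 32n+25
-- have to vanish modulo 9. Write f₁³ = f₃(1 - 3S) and D = φ(-q) = f₁²/f₂; then C ≡ f₂f₆D(1 + 3S) modulo 9. Comparing D³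
-- with D(q³) in the dissection D = φ(q⁴) - 2qψ(q⁸) gives a functional equation modulo 3 with the unique solution
-- S - S(q⁴) ≡ qψ(q²)⁴. Together with the dissections of φ, D and their powers this allows one to bisect C five times
-- (odd, even, even, odd, odd), and the last odd part is a multiple of 9.

open import Defs
open import Algebra.Bundles using (CommutativeRing)
import Algebra.Solver.Ring as RingSolver
open import Algebra.Solver.Ring.AlmostCommutativeRing using (fromCommutativeRing; _-Raw-AlmostCommutative⟶_)
open import Algebra.Structures using (IsCommutativeRing)
open import Data.Bool using (Bool; T)
open import Data.Fin using (zero; suc)
open import Data.Integer as ℤ using (ℤ; +_; 0ℤ; 1ℤ; -1ℤ)
open import Data.Integer.Divisibility using (_∣_)
import Data.Integer.Divisibility.Signed as ∣
open ∣ using () renaming (_∣_ to _∣′_; divides to divides′)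
import Data.Integer.Properties as ℤ
open import Data.Integer.Tactic.RingSolver using (solve-∀)
open import Data.List using (List; []; _∷_; map; foldr; applyUpTo)
open import Data.List.Relation.Unary.All using (All; []; _∷_)
open import Data.Maybe using (Maybe; just; nothing; is-just)
open import Data.Nat as ℕ using (ℕ; zero; suc; _≤_; _<_; z≤n; s≤s; _∸_)
open import Data.Nat.DivMod using (_%_; _/_; m%n<n; m≡m%n+[m/n]*n)
import Data.Nat.Properties as ℕ
import Data.Nat.Tactic.RingSolver as ℕ-Solver
open import Data.Product using (Σ; _×_; _,_; proj₁; proj₂)
open import Data.Sum using (_⊎_; inj₁; inj₂)
open import Data.Unit using (⊤; tt)
open import Data.Vec as Vec using (Vec; []; _∷_)
open import Data.Vec.N-ary using (N-ary; N-ary-level; _$ⁿ_)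
import Data.Vec.Properties as Vec
open import Level using (0ℓ)
open import Relation.Binary.PropositionalEquality as ≡ using (_≡_; cong; cong₂; subst; module ≡-Reasoning)
open import Relation.Nullary using (yes; no)

-- The ring of formal power series and its reductions

-- The bisections work because `η₁` and `η₃`, which are not dissected themselves, always occur in
-- combinations that can be rewritten modulo 9 as a series in q² times powers of D or φ and a factor
-- 1 + 3S. The only ingredient that is not a theta function is S. It enters only as 3S, so it has to
-- be dissected only modulo 3. The equation for S comes from computing D(q³) modulo 9 in two ways.
-- As an eta quotient it is D³ corrected by S and S(q²). As the difference of the values at q³ of
-- φ(q⁴) and 2qψ(q⁸), it is built from the cubes of these two series, corrected by S(q⁴), S(q⁸) and
-- S(q¹⁶). What remains after division by 3 involves S only through T = S - S(q⁴) and expresses T by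
-- T(q²) and T(q⁴), so T is determined by its constant term 0. On the side of ξ, trisection
-- reproduces the sum of the numerators `a k`. The partial fraction expansion evaluates that same
-- sum when n tends to infinity, which is why an eta quotient results.

infix 4 _≐_
_≐_ : PS → PS → Set
f ≐ g = ∀ n → f n ≡ g n

tail : PS → PS
tail f n = f (suc n)

opaque
  infixl 6 _⊕_
  infixl 7 _⊗_
  _⊕_ : PS → PS → PS
  (f ⊕ g) n = f n ℤ.+ g n

  -- The Cauchy product as a recursion that peels off the constant term of the left factor. In this
  -- form the ring laws are inductions on the index.
  _⊗_ : PS → PS → PS
  (f ⊗ g) zero    = f 0 ℤ.* g 0
  (f ⊗ g) (suc n) = f 0 ℤ.* g (suc n) ℤ.+ (tail f ⊗ g) n

  ⊝_ : PS → PS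
  (⊝ f) n = ℤ.- f n

  const : ℤ → PS
  const c zero    = c
  const c (suc _) = 0ℤ

  ⊗-cong≐ : ∀ {f f′ g g′} → f ≐ f′ → g ≐ g′ → f ⊗ g ≐ f′ ⊗ g′
  ⊗-cong≐ p r zero    = cong₂ ℤ._*_ (p 0) (r 0)
  ⊗-cong≐ p r (suc n) = cong₂ ℤ._+_ (cong₂ ℤ._*_ (p 0) (r (suc n))) (⊗-cong≐ (λ i → p (suc i)) r n)

  -- The mirror image of the defining recursion, which is what commutativity needs.
  ⊗-sucʳ : ∀ f g n → (f ⊗ g) (suc n) ≡ f (suc n) ℤ.* g 0 ℤ.+ (f ⊗ tail g) n
  ⊗-sucʳ f g zero    = ℤ.+-comm (f 0 ℤ.* g 1) (f 1 ℤ.* g 0)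
  ⊗-sucʳ f g (suc n) = ≡.trans (cong (λ z → f 0 ℤ.* g (2 ℕ.+ n) ℤ.+ z) (⊗-sucʳ (tail f) g n))
    (lem (f 0 ℤ.* g (2 ℕ.+ n)) (f (2 ℕ.+ n) ℤ.* g 0) ((tail f ⊗ tail g) n))
    where
    lem : ∀ a b c → a ℤ.+ (b ℤ.+ c) ≡ b ℤ.+ (a ℤ.+ c)
    lem = solve-∀

  ⊗-comm≐ : ∀ f g → f ⊗ g ≐ g ⊗ f
  ⊗-comm≐ f g zero    = ℤ.*-comm (f 0) (g 0)
  ⊗-comm≐ f g (suc n) = ≡.trans (cong₂ ℤ._+_ (ℤ.*-comm (f 0) (g (suc n))) (⊗-comm≐ (tail f) g n))
                                (≡.sym (⊗-sucʳ g f n))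

  ⊗-distribʳ≐ : ∀ h f g → (f ⊕ g) ⊗ h ≐ f ⊗ h ⊕ g ⊗ h
  ⊗-distribʳ≐ h f g zero    = ℤ.*-distribʳ-+ (h 0) (f 0) (g 0)
  ⊗-distribʳ≐ h f g (suc n) =
    ≡.trans (cong (λ z → (f 0 ℤ.+ g 0) ℤ.* h (suc n) ℤ.+ z) (⊗-distribʳ≐ h (tail f) (tail g) n))
      (lem (f 0) (g 0) (h (suc n)) ((tail f ⊗ h) n) ((tail g ⊗ h) n))
    where
    lem : ∀ a b c d e → (a ℤ.+ b) ℤ.* c ℤ.+ (d ℤ.+ e) ≡ a ℤ.* c ℤ.+ d ℤ.+ (b ℤ.* c ℤ.+ e)
    lem = solve-∀

  ⊗-scale : ∀ c f g n → ((λ i → c ℤ.* f i) ⊗ g) n ≡ c ℤ.* (f ⊗ g) n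
  ⊗-scale c f g zero    = ℤ.*-assoc c (f 0) (g 0)
  ⊗-scale c f g (suc n) = ≡.trans (cong (λ z → c ℤ.* f 0 ℤ.* g (suc n) ℤ.+ z) (⊗-scale c (tail f) g n))
    (lem c (f 0) (g (suc n)) ((tail f ⊗ g) n))
    where
    lem : ∀ a b c d → a ℤ.* b ℤ.* c ℤ.+ a ℤ.* d ≡ a ℤ.* (b ℤ.* c ℤ.+ d)
    lem = solve-∀

  ⊗-assoc≐ : ∀ f g h → (f ⊗ g) ⊗ h ≐ f ⊗ (g ⊗ h)
  ⊗-assoc≐ f g h zero    = ℤ.*-assoc (f 0) (g 0) (h 0)
  ⊗-assoc≐ f g h (suc n) = begin
      f 0 ℤ.* g 0 ℤ.* h (suc n) ℤ.+ (tail (f ⊗ g) ⊗ h) n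
    ≡⟨ cong (λ z → f 0 ℤ.* g 0 ℤ.* h (suc n) ℤ.+ z) (begin
        (((λ i → f 0 ℤ.* tail g i) ⊕ (tail f ⊗ g)) ⊗ h) n
      ≡⟨ ⊗-distribʳ≐ h (λ i → f 0 ℤ.* tail g i) (tail f ⊗ g) n ⟩
        ((λ i → f 0 ℤ.* tail g i) ⊗ h) n ℤ.+ (tail f ⊗ g ⊗ h) n
      ≡⟨ cong₂ ℤ._+_ (⊗-scale (f 0) (tail g) h n) (⊗-assoc≐ (tail f) g h n) ⟩
        f 0 ℤ.* (tail g ⊗ h) n ℤ.+ (tail f ⊗ (g ⊗ h)) n ∎) ⟩
      f 0 ℤ.* g 0 ℤ.* h (suc n) ℤ.+ (f 0 ℤ.* (tail g ⊗ h) n ℤ.+ (tail f ⊗ (g ⊗ h)) n)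
    ≡⟨ lem (f 0) (g 0) (h (suc n)) ((tail g ⊗ h) n) ((tail f ⊗ (g ⊗ h)) n) ⟩
      f 0 ℤ.* (g 0 ℤ.* h (suc n) ℤ.+ (tail g ⊗ h) n) ℤ.+ (tail f ⊗ (g ⊗ h)) n ∎
    where
    open ≡-Reasoning
    lem : ∀ a b c d e → a ℤ.* b ℤ.* c ℤ.+ (a ℤ.* d ℤ.+ e) ≡ a ℤ.* (b ℤ.* c ℤ.+ d) ℤ.+ e
    lem = solve-∀

  const-⊗ : ∀ c f n → (const c ⊗ f) n ≡ c ℤ.* f n
  const-⊗ c f zero    = ≡.refl
  const-⊗ c f (suc n) = ≡.trans (cong (λ z → c ℤ.* f (suc n) ℤ.+ z) (zeroes n)) (ℤ.+-identityʳ _)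
    where
    zeroes : ∀ n → ((λ _ → 0ℤ) ⊗ f) n ≡ 0ℤ
    zeroes zero    = ℤ.*-zeroˡ (f 0)
    zeroes (suc n) = cong₂ ℤ._+_ (ℤ.*-zeroˡ (f (suc n))) (zeroes n)

  ⊛≐⊗ : ∀ f g → f ⊛ g ≐ f ⊗ g
  ⊛≐⊗ f g N = go f N (λ i → i) (λ _ → ≡.refl)
    where
    -- `f₁` and `n` are the left factor and the degree after some initial terms have been removed,
    -- and `s` lists the original indices that remain.
    go : ∀ f₁ n (s : ℕ → ℕ) → (∀ i → f (s i) ℤ.* g (N ∸ s i) ≡ f₁ i ℤ.* g (n ∸ i)) →
         foldr ℤ._+_ 0ℤ (map (λ i → f i ℤ.* g (N ∸ i)) (applyUpTo s (suc n))) ≡ (f₁ ⊗ g) n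
    go f₁ zero    s eq = ≡.trans (ℤ.+-identityʳ _) (eq 0)
    go f₁ (suc n) s eq = cong₂ ℤ._+_ (eq 0) (go (tail f₁) n (λ i → s (suc i)) (λ i → eq (suc i)))

-- Two power series are compared modulo an integer (0 for equality) and only at the admitted indices.
record Precision : Set₁ where
  field
    modulus : ℕ
    Index   : ℕ → Set
    down    : ∀ {i j} → i ≤ j → Index j → Index i
open Precision

record Eq (p : Precision) (f g : PS) : Set where
  constructor mk
  field at : ∀ n → Index p n → + modulus p ∣′ (f n ℤ.- g n)
open Eq

≡⇒∣ : ∀ {k a b} → a ≡ b → k ∣′ (a ℤ.- b)
≡⇒∣ {k} {a} ≡.refl = subst (k ∣′_) (≡.sym (ℤ.+-inverseʳ a)) (divides′ 0ℤ (≡.sym (ℤ.*-zeroˡ k)))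

module _ {p : Precision} where
  ≐⇒Eq : ∀ {f g} → f ≐ g → Eq p f g
  ≐⇒Eq e = mk λ n _ → ≡⇒∣ (e n)

  Eq-refl : ∀ {f} → Eq p f f
  Eq-refl = ≐⇒Eq λ _ → ≡.refl

  Eq-sym : ∀ {f g} → Eq p f g → Eq p g f
  Eq-sym {f} {g} e = mk λ n i → subst (_ ∣′_) (lem (f n) (g n)) (∣.∣m⇒∣-m (at e n i))
    where
    lem : ∀ a b → ℤ.- (a ℤ.- b) ≡ b ℤ.- a
    lem = solve-∀

  Eq-trans : ∀ {f g h} → Eq p f g → Eq p g h → Eq p f h
  Eq-trans {f} {g} {h} e e′ = mk λ n i → subst (_ ∣′_) (lem (f n) (g n) (h n)) (∣.∣m∣n⇒∣m+n (at e n i) (at e′ n i))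
    where
    lem : ∀ a b c → a ℤ.- b ℤ.+ (b ℤ.- c) ≡ a ℤ.- c
    lem = solve-∀

opaque
  unfolding _⊕_

  ⊗-∣ : ∀ {k} f f′ g g′ n → (∀ i → i ≤ n → k ∣′ (f i ℤ.- f′ i)) → (∀ i → i ≤ n → k ∣′ (g i ℤ.- g′ i)) →
        k ∣′ ((f ⊗ g) n ℤ.- (f′ ⊗ g′) n)
  ⊗-∣ {k} f f′ g g′ n = go f f′ n
    where
    lem : ∀ a a′ b b′ → (a ℤ.- a′) ℤ.* b ℤ.+ a′ ℤ.* (b ℤ.- b′) ≡ a ℤ.* b ℤ.- a′ ℤ.* b′
    lem = solve-∀
    lem₂ : ∀ a b c d → a ℤ.- b ℤ.+ (c ℤ.- d) ≡ a ℤ.+ c ℤ.- (b ℤ.+ d)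
    lem₂ = solve-∀
    prod : ∀ a a′ b b′ → k ∣′ (a ℤ.- a′) → k ∣′ (b ℤ.- b′) → k ∣′ (a ℤ.* b ℤ.- a′ ℤ.* b′)
    prod a a′ b b′ p r = subst (k ∣′_) (lem a a′ b b′) (∣.∣m∣n⇒∣m+n (∣.∣m⇒∣m*n b p) (∣.∣n⇒∣m*n a′ r))
    go : ∀ f f′ n → (∀ i → i ≤ n → k ∣′ (f i ℤ.- f′ i)) → (∀ i → i ≤ n → k ∣′ (g i ℤ.- g′ i)) →
         k ∣′ ((f ⊗ g) n ℤ.- (f′ ⊗ g′) n)
    go f f′ zero    p r = prod (f 0) (f′ 0) (g 0) (g′ 0) (p 0 z≤n) (r 0 z≤n)
    go f f′ (suc n) p r = subst (k ∣′_) (lem₂ (f 0 ℤ.* g (suc n)) (f′ 0 ℤ.* g′ (suc n)) ((tail f ⊗ g) n) ((tail f′ ⊗ g′) n))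
      (∣.∣m∣n⇒∣m+n (prod (f 0) (f′ 0) (g (suc n)) (g′ (suc n)) (p 0 z≤n) (r (suc n) ℕ.≤-refl))
                   (go (tail f) (tail f′) n (λ i i≤n → p (suc i) (s≤s i≤n)) (λ i i≤n → r i (ℕ.m≤n⇒m≤1+n i≤n))))

  isCommutativeRing : ∀ p → IsCommutativeRing (Eq p) _⊕_ _⊗_ ⊝_ (const 0ℤ) (const 1ℤ)
  isCommutativeRing p = record
      { isRing = record
        { +-isAbelianGroup = record
          { isGroup = record
            { isMonoid = record
              { isSemigroup = record
                { isMagma = record
                  { isEquivalence = record { refl = Eq-refl ; sym = Eq-sym ; trans = Eq-trans }
                  ; ∙-cong = λ {f} {f′} {g} {g′} e e′ → mk λ n i →
                      subst (_ ∣′_) (lem (f n) (f′ n) (g n) (g′ n)) (∣.∣m∣n⇒∣m+n (at e n i) (at e′ n i)) }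
                ; assoc = λ f g h → ≐⇒Eq λ n → ℤ.+-assoc (f n) (g n) (h n) }
              ; identity = (λ f → ≐⇒Eq λ { zero → ℤ.+-identityˡ _ ; (suc _) → ℤ.+-identityˡ _ })
                         , (λ f → ≐⇒Eq λ { zero → ℤ.+-identityʳ _ ; (suc _) → ℤ.+-identityʳ _ }) }
            ; inverse = (λ f → ≐⇒Eq λ { zero → ℤ.+-inverseˡ (f 0) ; (suc n) → ℤ.+-inverseˡ (f (suc n)) })
                      , (λ f → ≐⇒Eq λ { zero → ℤ.+-inverseʳ (f 0) ; (suc n) → ℤ.+-inverseʳ (f (suc n)) })
            ; ⁻¹-cong = λ {f} {g} e → mk λ n i →
                subst (_ ∣′_) (ℤ.neg-distrib-+ (f n) (ℤ.- g n)) (∣.∣m⇒∣-m (at e n i)) }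
          ; comm = λ f g → ≐⇒Eq λ n → ℤ.+-comm (f n) (g n) }
        ; *-cong = λ {f} {f′} {g} {g′} e e′ → mk λ n i →
            ⊗-∣ f f′ g g′ n (λ j j≤n → at e j (down p j≤n i)) (λ j j≤n → at e′ j (down p j≤n i))
        ; *-assoc = λ f g h → ≐⇒Eq (⊗-assoc≐ f g h)
        ; *-identity = (λ f → ≐⇒Eq (idˡ f))
                     , (λ f → ≐⇒Eq λ n → ≡.trans (⊗-comm≐ f (const 1ℤ) n) (idˡ f n))
        ; distrib = (λ f g h → ≐⇒Eq λ n → ≡.trans (⊗-comm≐ f (g ⊕ h) n)
                      (≡.trans (⊗-distribʳ≐ f g h n) (cong₂ ℤ._+_ (⊗-comm≐ g f n) (⊗-comm≐ h f n))))
                  , (λ f g h → ≐⇒Eq (⊗-distribʳ≐ f g h)) }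
      ; *-comm = λ f g → ≐⇒Eq (⊗-comm≐ f g) }
    where
    lem : ∀ a b c d → a ℤ.- b ℤ.+ (c ℤ.- d) ≡ a ℤ.+ c ℤ.- (b ℤ.+ d)
    lem = solve-∀
    idˡ : ∀ f → const 1ℤ ⊗ f ≐ f
    idˡ f n = ≡.trans (const-⊗ 1ℤ f n) (ℤ.*-identityˡ (f n))

psRing : Precision → CommutativeRing 0ℓ 0ℓ
psRing p = record { isCommutativeRing = isCommutativeRing p }

opaque
  unfolding _⊕_

  const-+ : ∀ a b → const (a ℤ.+ b) ≐ const a ⊕ const b
  const-+ a b zero    = ≡.refl
  const-+ a b (suc _) = ≡.refl

  const-* : ∀ a b → const (a ℤ.* b) ≐ const a ⊗ const b
  const-* a b n = ≡.sym (≡.trans (const-⊗ a (const b) n) (lem n))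
    where
    lem : ∀ n → a ℤ.* const b n ≡ const (a ℤ.* b) n
    lem zero    = ≡.refl
    lem (suc n) = ℤ.*-zeroʳ a

  const-neg : ∀ a → const (ℤ.- a) ≐ ⊝ const a
  const-neg a zero    = ≡.refl
  const-neg a (suc _) = ≡.refl

const-morphism : ∀ p → CommutativeRing.rawRing ℤ.+-*-commutativeRing -Raw-AlmostCommutative⟶ fromCommutativeRing (psRing p)
const-morphism p = record
  { ⟦_⟧    = const
  ; +-homo = λ a b → ≐⇒Eq (const-+ a b)
  ; *-homo = λ a b → ≐⇒Eq (const-* a b)
  ; -‿homo = λ a → ≐⇒Eq (const-neg a)
  ; 0-homo = Eq-refl
  ; 1-homo = Eq-refl
  }

opaque
  unfolding _⊕_

  const-∣ : ∀ p a b → + modulus p ∣′ (a ℤ.- b) → Eq p (const a) (const b)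
  const-∣ p a b d = mk λ { zero _ → d ; (suc n) _ → ≡⇒∣ {a = 0ℤ} ≡.refl }

-- Coefficients are compared modulo `modulus p`, so the normaliser at `mod 9` drops every multiple
-- of 9. The polynomial identities checked by `linear` need to hold only to that modulus.
coefficient≟ : ∀ p → (a b : ℤ) → Maybe (Eq p (const a) (const b))
coefficient≟ p a b with + modulus p ∣.∣? (a ℤ.- b)
... | yes d = just (const-∣ p a b d)
... | no  _ = nothing

module Modulo (p : Precision) where
  open CommutativeRing (psRing p) public
    using (_≈_; _+_; _*_; -_; _-_; 0#; 1#; refl; sym; trans; setoid; semiring; +-cong; +-congˡ; +-congʳ; *-cong; *-congˡ; *-congʳ; -‿cong;
           +-assoc; *-assoc; +-comm; *-comm; +-identityˡ; +-identityʳ; *-identityˡ; *-identityʳ; zeroˡ; zeroʳ; -‿inverseˡ; -‿inverseʳ; distribˡ; distribʳ)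
  open RingSolver (CommutativeRing.rawRing ℤ.+-*-commutativeRing) (fromCommutativeRing (psRing p))
    (const-morphism p) (coefficient≟ p) public
    using (Polynomial; con; var; _:+_; _:*_; _:-_; :-_; _:^_; ⟦_⟧; normalise; _≈N_; _≟N_; 0N; 0N-homo; ⟦_⟧N-cong; correct; op; [+]; [*])
  open import Algebra.Properties.Semiring.Exp semiring public using (_^_; ^-congˡ; ^-homo-*; ^-assocʳ)
  open import Algebra.Properties.CommutativeSemiring.Exp (CommutativeRing.commutativeSemiring (psRing p)) public using (^-distrib-*)
  open import Relation.Binary.Reasoning.Setoid setoid public

  infix 3 _:=_
  _:=_ : ∀ {n} → Polynomial n → Polynomial n → Polynomial n × Polynomial n
  _:=_ = _,_

  Equation : ℕ → Set
  Equation n = Polynomial n × Polynomial n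

  Holds : ∀ {n} → Vec PS n → Equation n → Set
  Holds ρ (l , r) = ⟦ l ⟧ ρ ≈ ⟦ r ⟧ ρ

  combination : ∀ {n} → List (Polynomial n × Equation n) → Polynomial n
  combination []                  = con 0ℤ
  combination ((c , l , r) ∷ hs) = c :* (l :- r) :+ combination hs

  private
    x-x≈0 : ∀ {x y} → x ≈ y → x - y ≈ 0#
    x-x≈0 {x} {y} e = trans (+-cong e refl) (-‿inverseʳ y)

    vanishes : ∀ {n} (ρ : Vec PS n) hs → All (λ h → Holds ρ (proj₂ h)) hs → ⟦ combination hs ⟧ ρ ≈ 0#
    vanishes ρ []            []       = refl
    vanishes ρ ((c , _) ∷ _) (e ∷ es) =
      trans (+-cong (trans (*-cong refl (x-x≈0 e)) (zeroʳ _)) (vanishes ρ _ es)) (+-identityʳ 0#)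

  isZero : ∀ {n} → Polynomial n → Bool
  isZero e = is-just (normalise e ≟N 0N)

  isZero-sound : ∀ {n} (e : Polynomial n) → T (isZero e) → ∀ ρ → ⟦ e ⟧ ρ ≈ 0#
  isZero-sound e t ρ = sound (normalise e ≟N 0N) t
    where
    sound : (m : Maybe (normalise e ≈N 0N)) → T (is-just m) → ⟦ e ⟧ ρ ≈ 0#
    sound (just z) _ = trans (sym (correct e ρ)) (trans (⟦ z ⟧N-cong ρ) (0N-homo ρ))

  variables : ∀ {n} → Vec (Polynomial n) n
  variables = Vec.tabulate var

  private
    x-y≈0⇒x≈y : ∀ x y → x - y ≈ 0# → x ≈ y
    x-y≈0⇒x≈y x y e = begin
      x              ≈⟨ +-identityʳ x ⟨
      x + 0#         ≈⟨ +-congˡ (-‿inverseˡ y) ⟨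
      x + (- y + y)  ≈⟨ +-assoc x (- y) y ⟨
      x - y + y      ≈⟨ +-congʳ e ⟩
      0# + y         ≈⟨ +-identityˡ y ⟩
      y              ∎

    x-0≈0⇒x≈0 : ∀ x y → y ≈ 0# → x - y ≈ 0# → x ≈ 0#
    x-0≈0⇒x≈0 x y e d = trans (x-y≈0⇒x≈y x y d) e

    linear′ : ∀ {n} (ρ : Vec PS n) l r hs → T (isZero (l :- r :- combination hs)) →
              All (λ h → Holds ρ (proj₂ h)) hs → ⟦ l ⟧ ρ ≈ ⟦ r ⟧ ρ
    linear′ ρ l r hs t es = x-y≈0⇒x≈y (⟦ l ⟧ ρ) (⟦ r ⟧ ρ)
      (x-0≈0⇒x≈0 (⟦ l :- r ⟧ ρ) (⟦ combination hs ⟧ ρ) (vanishes ρ hs es)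
        (isZero-sound (l :- r :- combination hs) t ρ))

    ring′ : ∀ {n} (ρ : Vec PS n) l r → T (isZero (l :- r)) → ⟦ l ⟧ ρ ≈ ⟦ r ⟧ ρ
    ring′ ρ l r t = x-y≈0⇒x≈y (⟦ l ⟧ ρ) (⟦ r ⟧ ρ) (isZero-sound (l :- r) t ρ)

  -- The goal l = r follows from hypotheses lᵢ = rᵢ once l - r = Σ cᵢ (lᵢ - rᵢ) is a polynomial identity.
  linear : ∀ {n} (ρ : Vec PS n) (f : N-ary n (Polynomial n) (Equation n × List (Polynomial n × Equation n))) →
           let e = f $ⁿ variables in
           {t : T (isZero (proj₁ (proj₁ e) :- proj₂ (proj₁ e) :- combination (proj₂ e)))} →
           All (λ h → Holds ρ (proj₂ h)) (proj₂ e) → Holds ρ (proj₁ e)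
  linear ρ f {t} = let e = f $ⁿ variables in linear′ ρ (proj₁ (proj₁ e)) (proj₂ (proj₁ e)) (proj₂ e) t

  ring : ∀ {n} (ρ : Vec PS n) (f : N-ary n (Polynomial n) (Equation n)) →
         let e = f $ⁿ variables in {t : T (isZero (proj₁ e :- proj₂ e))} → Holds ρ e
  ring ρ f {t} = ring′ ρ (proj₁ (f $ⁿ variables)) (proj₂ (f $ⁿ variables)) t

-- Equality, congruence and truncation

exactly : Precision
exactly = record { modulus = 0 ; Index = λ _ → ⊤ ; down = λ _ _ → tt }

mod_ : ℕ → Precision
mod m = record { modulus = m ; Index = λ _ → ⊤ ; down = λ _ _ → tt }

-- Equality modulo `q ^ N`. Every limit is handled through it: two series coincide once they agree
-- below every `N`, which is `below-all`.
below : ℕ → Precision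
below N = record { modulus = 0 ; Index = _< N ; down = ℕ.≤-<-trans }

∣0⇒≡ : ∀ {a b} → + 0 ∣′ (a ℤ.- b) → a ≡ b
∣0⇒≡ {a} {b} d = ℤ.i-j≡0⇒i≡j a b (∣.0∣⇒≡0 d)

coeff : ∀ {f g} → Eq exactly f g → f ≐ g
coeff e n = ∣0⇒≡ (at e n tt)

weaken : ∀ {p f g} → Eq exactly f g → Eq p f g
weaken e = ≐⇒Eq (coeff e)

coeff< : ∀ {N f g} → Eq (below N) f g → ∀ n → n < N → f n ≡ g n
coeff< e n n<N = ∣0⇒≡ (at e n n<N)

agree : ∀ {N f g} → (∀ n → n < N → f n ≡ g n) → Eq (below N) f g
agree e = mk λ n n<N → ≡⇒∣ (e n n<N)

below-all : ∀ {f g} → (∀ N → Eq (below N) f g) → Eq exactly f g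
below-all e = ≐⇒Eq λ n → coeff< (e (suc n)) n ℕ.≤-refl

below-≤ : ∀ {M N f g} → M ≤ N → Eq (below N) f g → Eq (below M) f g
below-≤ M≤N e = mk λ n n<M → at e n (ℕ.≤-trans n<M M≤N)


open Modulo exactly
  using (_≈_; _+_; _*_; -_; _-_; 0#; 1#; _^_; ring; linear; Polynomial; op; [+]; [*])
open module AnyPrecision {p} = Modulo p
  using (refl; sym; trans; +-cong; +-congˡ; +-congʳ; *-cong; *-congˡ; *-congʳ; -‿cong; +-assoc; *-assoc; +-comm; *-comm;
         +-identityˡ; +-identityʳ; *-identityˡ; *-identityʳ; zeroˡ; zeroʳ; -‿inverseˡ; -‿inverseʳ; distribˡ; distribʳ;
         ^-congˡ; ^-homo-*; ^-assocʳ; ^-distrib-*; con; var; _:+_; _:*_; _:-_; :-_; _:^_; _:=_; ⟦_⟧; begin_; step-≈-⟩; step-≈-⟨; _∎)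
open Precision
open Eq

infix 4 _≈[_]_
_≈[_]_ : PS → ℕ → PS → Set
f ≈[ N ] g = Eq (below N) f g

-- The variable `q` and substitution into power series

opaque
  unfolding _⊕_

  q : PS
  q zero          = 0ℤ
  q (suc zero)    = 1ℤ
  q (suc (suc _)) = 0ℤ

  tail-q : tail q ≐ const 1ℤ
  tail-q zero    = ≡.refl
  tail-q (suc _) = ≡.refl

  *-zeroth : ∀ f g → (f * g) 0 ≡ f 0 ℤ.* g 0
  *-zeroth f g = ≡.refl

  +-at : ∀ f g n → (f + g) n ≡ f n ℤ.+ g n
  +-at f g n = ≡.refl

  neg-at : ∀ f n → (- f) n ≡ ℤ.- f n
  neg-at f n = ≡.refl

  const-*-at : ∀ c f n → (const c * f) n ≡ c ℤ.* f n
  const-*-at c f n = const-⊗ c f n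

  const-zeroth : ∀ c → const c 0 ≡ c
  const-zeroth c = ≡.refl

  one≈1 : one ≈ 1#
  one≈1 = ≐⇒Eq λ { zero → ≡.refl ; (suc _) → ≡.refl }

  shift-suc : ∀ u f n → u 0 ≡ 0ℤ → (u * f) (suc n) ≡ (tail u * f) n
  shift-suc u f n u0 = ≡.trans (cong (λ z → z ℤ.* f (suc n) ℤ.+ (tail u * f) n) u0)
    (≡.trans (cong (λ z → z ℤ.+ (tail u * f) n) (ℤ.*-zeroˡ (f (suc n)))) (ℤ.+-identityˡ _))

  shift-zero : ∀ u f → u 0 ≡ 0ℤ → (u * f) 0 ≡ 0ℤ
  shift-zero u f u0 = ≡.trans (cong (ℤ._* f 0) u0) (ℤ.*-zeroˡ (f 0))

  q-zeroth : q 0 ≡ 0ℤ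
  q-zeroth = ≡.refl

  q*-zero : ∀ f → (q * f) 0 ≡ 0ℤ
  q*-zero f = shift-zero q f ≡.refl

  q*-suc : ∀ f n → (q * f) (suc n) ≡ f n
  q*-suc f n = ≡.trans (shift-suc q f n ≡.refl)
    (≡.trans (⊗-cong≐ tail-q (λ _ → ≡.refl) n) (≡.trans (const-⊗ 1ℤ f n) (ℤ.*-identityˡ (f n))))

  uncons : ∀ f → f ≈ const (f 0) + q * tail f
  uncons f = ≐⇒Eq λ where
    zero    → ≡.sym (≡.trans (cong (λ z → f 0 ℤ.+ z) (q*-zero (tail f))) (ℤ.+-identityʳ (f 0)))
    (suc n) → ≡.sym (≡.trans (cong (λ z → 0ℤ ℤ.+ z) (q*-suc (tail f) n)) (ℤ.+-identityˡ (f (suc n))))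

  -- Multiplication by a series without constant term gains one order of accuracy. This drives every
  -- induction on the precision below.
  *-below-suc : ∀ {N a b} u → u 0 ≡ 0ℤ → a ≈[ N ] b → (u * a) ≈[ suc N ] (u * b)
  *-below-suc {N} {a} {b} u u0 e = agree λ where
    zero    _         → ≡.trans (shift-zero u a u0) (≡.sym (shift-zero u b u0))
    (suc n) (s≤s n<N) → ≡.trans (shift-suc u a n u0)
      (≡.trans (∣0⇒≡ (at (*-congˡ {x = tail u} e) n n<N)) (≡.sym (shift-suc u b n u0)))

below-zero : ∀ {f g} → f ≈[ 0 ] g
below-zero = agree λ _ ()

^-below : ∀ u → u 0 ≡ 0ℤ → ∀ m f → (u ^ m * f) ≈[ m ] 0#
^-below u u0 zero    f = below-zero
^-below u u0 (suc m) f = trans (weaken (*-assoc u (u ^ m) f))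
  (trans (*-below-suc u u0 (^-below u u0 m f)) (weaken (zeroʳ u)))

≡⇒≈ : ∀ {f g} → f ≡ g → f ≈ g
≡⇒≈ ≡.refl = refl

-- f(u), provided that u has no constant term.
partialCompose : PS → ℕ → PS → PS
partialCompose u zero    f = 0#
partialCompose u (suc N) f = const (f 0) + u * partialCompose u N (tail f)

infixl 7.5 _∘_
_∘_ : PS → PS → PS
(f ∘ u) n = partialCompose u (suc n) f n

module _ {u : PS} (u0 : u 0 ≡ 0ℤ) where

  partialCompose-stable : ∀ M N f → M ≤ N → partialCompose u N f ≈[ M ] partialCompose u M f
  partialCompose-stable zero    N       f _         = below-zero
  partialCompose-stable (suc M) (suc N) f (s≤s M≤N) =
    +-congˡ (*-below-suc u u0 (partialCompose-stable M N (tail f) M≤N))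

  ∘-below : ∀ N f → (f ∘ u) ≈[ N ] partialCompose u N f
  ∘-below N f = agree λ n n<N → ≡.sym (coeff< (partialCompose-stable (suc n) N f n<N) n ℕ.≤-refl)

  -- Horner's step. With `*-below-suc` it reduces each law of substitution to the same law for tails
  -- at one order less.
  ∘-uncons : ∀ f → f ∘ u ≈ const (f 0) + u * (tail f ∘ u)
  ∘-uncons f = below-all λ where
    zero    → below-zero
    (suc N) → trans (∘-below (suc N) f)
      (+-congˡ (*-below-suc u u0 (sym (∘-below N (tail f)))))

  partialCompose-cong : ∀ N {f g} → f ≐ g → partialCompose u N f ≈ partialCompose u N g
  partialCompose-cong zero    e = refl
  partialCompose-cong (suc N) e = +-cong (≡⇒≈ (cong const (e 0))) (*-congˡ (partialCompose-cong N (λ n → e (suc n))))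

  ∘-cong : ∀ {f g} → f ≈ g → f ∘ u ≈ g ∘ u
  ∘-cong e = ≐⇒Eq λ n → coeff (partialCompose-cong (suc n) (coeff e)) n

  opaque
    unfolding _⊕_

    tail-+ : ∀ f g → tail (f + g) ≈ tail f + tail g
    tail-+ f g = refl

    tail-const : ∀ c → tail (const c) ≈ 0#
    tail-const c = ≐⇒Eq λ { zero → ≡.refl ; (suc _) → ≡.refl }

    tail-* : ∀ f g → tail (f * g) ≈ const (f 0) * tail g + tail f * g
    tail-* f g = ≐⇒Eq λ n → cong (ℤ._+ (tail f * g) n) (≡.sym (const-⊗ (f 0) (tail g) n))


  ∘-const : ∀ c → const c ∘ u ≈ const c
  ∘-const c = trans (∘-uncons (const c)) (trans (+-cong (≡⇒≈ (cong const (const-zeroth c)))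
    (trans (*-congˡ (trans (∘-cong (tail-const c)) zero∘)) (zeroʳ u))) (+-identityʳ _))
    where
    zero∘ : 0# ∘ u ≈ 0#
    zero∘ = below-all go
      where
      go : ∀ N → (0# ∘ u) ≈[ N ] 0#
      go zero    = below-zero
      go (suc N) = trans (weaken (∘-uncons 0#))
        (trans (+-cong (weaken (≡⇒≈ (cong const (const-zeroth 0ℤ))))
          (trans (*-below-suc u u0 (trans (weaken (∘-cong (tail-const 0ℤ))) (go N))) (weaken (zeroʳ u))))
          (weaken (+-identityˡ 0#)))

  ∘-+ : ∀ f g → (f + g) ∘ u ≈ f ∘ u + g ∘ u
  ∘-+ f g = below-all λ N → go N f g
    where
    go : ∀ N f g → ((f + g) ∘ u) ≈[ N ] (f ∘ u + g ∘ u)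
    go zero    f g = below-zero
    go (suc N) f g = begin
      (f + g) ∘ u                                                              ≈⟨ weaken (∘-uncons (f + g)) ⟩
      const ((f + g) 0) + u * (tail (f + g) ∘ u)                                ≈⟨ +-cong
        (weaken (trans (≡⇒≈ (cong const (+-at f g 0))) (≐⇒Eq (const-+ (f 0) (g 0)))))
        (*-below-suc u u0 (trans (weaken (∘-cong (tail-+ f g))) (go N (tail f) (tail g)))) ⟩
      const (f 0) + const (g 0) + u * (tail f ∘ u + tail g ∘ u)                  ≈⟨ weaken (ring (const (f 0) ∷ const (g 0) ∷ u ∷ tail f ∘ u ∷ tail g ∘ u ∷ [])
        (λ a b u x y → a :+ b :+ u :* (x :+ y) := (a :+ u :* x) :+ (b :+ u :* y))) ⟩
      (const (f 0) + u * (tail f ∘ u)) + (const (g 0) + u * (tail g ∘ u))         ≈⟨ weaken (+-cong (∘-uncons f) (∘-uncons g)) ⟨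
      f ∘ u + g ∘ u ∎

  ∘-* : ∀ f g → (f * g) ∘ u ≈ f ∘ u * g ∘ u
  ∘-* f g = below-all λ N → go N f g
    where
    const-∘ : ∀ c f → (const c * f) ∘ u ≈ const c * f ∘ u
    const-∘ c f = below-all λ N → go N f
      where
      go : ∀ N f → ((const c * f) ∘ u) ≈[ N ] (const c * f ∘ u)
      go zero    f = below-zero
      go (suc N) f = begin
        (const c * f) ∘ u                                              ≈⟨ weaken (∘-uncons (const c * f)) ⟩
        const ((const c * f) 0) + u * (tail (const c * f) ∘ u)           ≈⟨ +-cong
          (weaken (trans (≡⇒≈ (cong const (const-*-at c f 0))) (≐⇒Eq (const-* c (f 0)))))
          (*-below-suc u u0 (trans (weaken (∘-cong {g = const c * tail f} (≐⇒Eq λ n → ≡.trans (const-*-at c f (suc n)) (≡.sym (const-*-at c (tail f) n))))) (go N (tail f)))) ⟩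
        const c * const (f 0) + u * (const c * tail f ∘ u)               ≈⟨ weaken (ring (const c ∷ const (f 0) ∷ u ∷ tail f ∘ u ∷ [])
          (λ a b u x → a :* b :+ u :* (a :* x) := a :* (b :+ u :* x))) ⟩
        const c * (const (f 0) + u * (tail f ∘ u))                        ≈⟨ weaken (*-congˡ (∘-uncons f)) ⟨
        const c * f ∘ u ∎
    go : ∀ N f g → ((f * g) ∘ u) ≈[ N ] (f ∘ u * g ∘ u)
    go zero    f g = below-zero
    go (suc N) f g = begin
      (f * g) ∘ u                                                         ≈⟨ weaken (∘-uncons (f * g)) ⟩
      const ((f * g) 0) + u * (tail (f * g) ∘ u)                            ≈⟨ +-cong
        (weaken (trans (≡⇒≈ (cong const (*-zeroth f g))) (≐⇒Eq (const-* (f 0) (g 0)))))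
        (*-below-suc u u0 (trans
          (weaken (trans (∘-cong (tail-* f g)) (trans (∘-+ _ _) (+-congʳ (const-∘ (f 0) (tail g))))))
          (+-congˡ (go N (tail f) g)))) ⟩
      const (f 0) * const (g 0) + u * (const (f 0) * tail g ∘ u + tail f ∘ u * g ∘ u)
        ≈⟨ weaken (linear (const (f 0) ∷ const (g 0) ∷ u ∷ tail f ∘ u ∷ tail g ∘ u ∷ g ∘ u ∷ [])
            (λ a b u x y z → (a :* b :+ u :* (a :* y :+ x :* z) := (a :+ u :* x) :* z) , ((:- a , (z := b :+ u :* y)) ∷ []))
            (∘-uncons g ∷ [])) ⟩
      (const (f 0) + u * (tail f ∘ u)) * g ∘ u                              ≈⟨ weaken (*-congʳ (∘-uncons f)) ⟨
      f ∘ u * g ∘ u ∎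

  ∘-neg : ∀ f → (- f) ∘ u ≈ - (f ∘ u)
  ∘-neg f = begin
    (- f) ∘ u               ≈⟨ ∘-cong (ring (f ∷ []) (λ f → :- f := con -1ℤ :* f)) ⟩
    (const -1ℤ * f) ∘ u     ≈⟨ ∘-* _ _ ⟩
    const -1ℤ ∘ u * f ∘ u   ≈⟨ *-congʳ (∘-const -1ℤ) ⟩
    const -1ℤ * f ∘ u       ≈⟨ ring (f ∘ u ∷ []) (λ f → con -1ℤ :* f := :- f) ⟩
    - (f ∘ u)               ∎

  ∘-^ : ∀ f n → (f ^ n) ∘ u ≈ (f ∘ u) ^ n
  ∘-^ f zero    = ∘-const 1ℤ
  ∘-^ f (suc n) = trans (∘-* f (f ^ n)) (*-congˡ (∘-^ f n))

  -- Substitution is a ring homomorphism, so it passes through any polynomial expression in one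
  -- step.
  ∘-⟦⟧ : ∀ {n} (e : Polynomial n) ρ → ⟦ e ⟧ ρ ∘ u ≈ ⟦ e ⟧ (Vec.map (_∘ u) ρ)
  ∘-⟦⟧ (op [+] a b) ρ = trans (∘-+ _ _) (+-cong (∘-⟦⟧ a ρ) (∘-⟦⟧ b ρ))
  ∘-⟦⟧ (op [*] a b) ρ = trans (∘-* _ _) (*-cong (∘-⟦⟧ a ρ) (∘-⟦⟧ b ρ))
  ∘-⟦⟧ (con c)      ρ = ∘-const c
  ∘-⟦⟧ (var i)      ρ = ≡⇒≈ (≡.sym (Vec.lookup-map i (_∘ u) ρ))
  ∘-⟦⟧ (e :^ n)     ρ = trans (∘-^ _ n) (^-congˡ n (∘-⟦⟧ e ρ))
  ∘-⟦⟧ (:- e)       ρ = trans (∘-neg _) (-‿cong (∘-⟦⟧ e ρ))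

  q∘ : q ∘ u ≈ u
  q∘ = trans (∘-uncons q) (trans (+-cong (≡⇒≈ (cong const q-zeroth)) (*-congˡ (trans (∘-cong (≐⇒Eq tail-q)) (∘-const 1ℤ))))
    (ring (u ∷ []) (λ u → con 0ℤ :+ u :* con 1ℤ := u)))

  ∘-below-cong : ∀ {N f g} → f ≈[ N ] g → (f ∘ u) ≈[ N ] (g ∘ u)
  ∘-below-cong {N} {f} {g} e = trans (∘-below N f) (trans (weaken (go N (coeff< e))) (sym (∘-below N g)))
    where
    go : ∀ N {f g} → (∀ n → n < N → f n ≡ g n) → partialCompose u N f ≈ partialCompose u N g
    go zero    e = refl
    go (suc N) e = +-cong (≡⇒≈ (cong const (e 0 (s≤s z≤n)))) (*-congˡ (go N (λ n n<N → e (suc n) (s≤s n<N))))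

  ∘-zeroth : ∀ f → (f ∘ u) 0 ≡ f 0
  ∘-zeroth f = ≡.trans (coeff (∘-uncons f) 0) (≡.trans (+-at (const (f 0)) _ 0)
    (≡.trans (cong₂ ℤ._+_ (const-zeroth (f 0)) (≡.trans (*-zeroth u _) (cong (ℤ._* (tail f ∘ u) 0) u0)))
      (≡.trans (cong (λ z → f 0 ℤ.+ z) (ℤ.*-zeroˡ ((tail f ∘ u) 0))) (ℤ.+-identityʳ (f 0)))))


∘-congʳ : ∀ {u v} f → u ≈ v → f ∘ u ≈ f ∘ v
∘-congʳ {u} {v} f e = ≐⇒Eq λ n → coeff (go (suc n) f) n
  where
  go : ∀ N f → partialCompose u N f ≈ partialCompose v N f
  go zero    f = refl
  go (suc N) f = +-congˡ (*-cong e (go N (tail f)))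

∘-∘ : ∀ {u v} → u 0 ≡ 0ℤ → v 0 ≡ 0ℤ → ∀ f → f ∘ u ∘ v ≈ f ∘ (u ∘ v)
∘-∘ {u} {v} u0 v0 f = below-all λ N → go N f
  where
  u∘v0 : (u ∘ v) 0 ≡ 0ℤ
  u∘v0 = ≡.trans (∘-zeroth v0 u) u0
  go : ∀ N f → (f ∘ u ∘ v) ≈[ N ] (f ∘ (u ∘ v))
  go zero    f = below-zero
  go (suc N) f = begin
    f ∘ u ∘ v                                             ≈⟨ weaken (∘-cong v0 (∘-uncons u0 f)) ⟩
    (const (f 0) + u * (tail f ∘ u)) ∘ v                   ≈⟨ weaken (trans (∘-+ v0 _ _) (+-cong (∘-const v0 (f 0)) (∘-* v0 _ _))) ⟩
    const (f 0) + u ∘ v * (tail f ∘ u ∘ v)                  ≈⟨ +-congˡ (*-below-suc (u ∘ v) u∘v0 (go N (tail f))) ⟩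
    const (f 0) + u ∘ v * (tail f ∘ (u ∘ v))                ≈⟨ weaken (∘-uncons u∘v0 f) ⟨
    f ∘ (u ∘ v)                                            ∎

-- The local functions behind inv are not exported by Defs; unification recovers them.
mutual
  step′ : PS → List ℤ → ℤ
  step′ = _

  invRev-suc : ∀ f N → invRev f (suc N) ≡ step′ f (invRev f N) ∷ invRev f N
  invRev-suc f N with invRev f N
  ... | rev = ≡.refl

mutual
  sumIdx′ : PS → List ℤ → ℕ → List ℤ → ℤ
  sumIdx′ = _

  step′-∷ : ∀ f g gs → step′ f (g ∷ gs) ≡ ℤ.- (f 1 ℤ.* g ℤ.+ sumIdx′ f (g ∷ gs) 1 gs)
  step′-∷ f g gs with g ∷ gs | 1
  ... | rev | j = ≡.refl

opaque
  unfolding _⊕_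

  -- `g` is `f` shifted by `suc j`: the recursion advances the index `j` and shortens the list, and
  -- the product with `inv f` is peeled in the same way.
  sumIdx′≡* : ∀ f rev g j N → (∀ i → g i ≡ f (suc j ℕ.+ i)) → sumIdx′ f rev j (invRev f N) ≡ (g * inv f) N
  sumIdx′≡* f rev g j zero    e = ≡.trans (ℤ.+-identityʳ _) (cong (ℤ._* 1ℤ) (≡.trans (cong f (≡.sym (ℕ.+-identityʳ (suc j)))) (≡.sym (e 0))))
  sumIdx′≡* f rev g j (suc N) e = cong₂ ℤ._+_
    (cong (ℤ._* inv f (suc N)) (≡.trans (cong f (≡.sym (ℕ.+-identityʳ (suc j)))) (≡.sym (e 0))))
    (sumIdx′≡* f rev (tail g) (suc j) N (λ i → ≡.trans (e (suc i)) (cong f (ℕ.+-suc (suc j) i))))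

  *-inv : ∀ f → f 0 ≡ 1ℤ → f * inv f ≈ 1#
  *-inv f f0 = ≐⇒Eq λ where
    zero    → ≡.trans (ℤ.*-identityʳ (f 0)) f0
    (suc N) → ≡.trans (cong (λ z → z ℤ.* inv f (suc N) ℤ.+ (tail f * inv f) N) f0)
      (≡.trans (cong (λ z → 1ℤ ℤ.* ℤ.- z ℤ.+ (tail f * inv f) N) (sumIdx′≡* f (invRev f N) (tail f) 0 N (λ _ → ≡.refl)))
        (≡.trans (cong (ℤ._+ (tail f * inv f) N) (ℤ.*-identityˡ (ℤ.- (tail f * inv f) N))) (ℤ.+-inverseˡ ((tail f * inv f) N))))

-- A series with constant term 1 is a unit over ℤ, so it may be cancelled at every precision, in
-- particular modulo 9.
*-cancelˡ : ∀ {p} f {g h} → f 0 ≡ 1ℤ → Eq p (f * g) (f * h) → Eq p g h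
*-cancelˡ f {g} {h} f0 e = trans (weaken (lem g)) (trans (*-congˡ e) (weaken (sym (lem h))))
  where
  lem : ∀ g → g ≈ inv f * (f * g)
  lem g = linear (f ∷ inv f ∷ g ∷ []) (λ f i g → (g := i :* (f :* g)) , (:- g , (f :* i := con 1ℤ)) ∷ []) (*-inv f f0 ∷ [])

-- Meaningful only for a sequence that is Convergent in the sense below.
lim : (ℕ → PS) → PS
lim F n = F (suc n) n

Convergent : (ℕ → PS) → Set
Convergent F = ∀ N → F (suc N) ≈[ N ] F N

tail-stable : ∀ {F} → Convergent F → ∀ {N M} → N ≤ M → F M ≈[ N ] F N
tail-stable c {N} {M} N≤M with ℕ.≤⇒≤′ N≤M
... | ℕ.≤′-refl           = refl
... | ℕ.≤′-step {M} N≤′M  = trans (below-≤ (ℕ.≤′⇒≤ N≤′M) (c M)) (tail-stable c (ℕ.≤′⇒≤ N≤′M))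

lim-below : ∀ {F} → Convergent F → ∀ {N M} → N ≤ M → lim F ≈[ N ] F M
lim-below {F} c {N} {M} N≤M = agree λ n n<N →
  ≡.sym (coeff< (tail-stable {F} c {suc n} {M} (ℕ.≤-trans n<N N≤M)) n ℕ.≤-refl)

-- Finite sums and products, q-Pochhammer symbols and their limits

∏ : ℕ → (ℕ → PS) → PS
∏ zero    F = 1#
∏ (suc n) F = ∏ n F * F n

∑ : ℕ → (ℕ → PS) → PS
∑ zero    F = 0#
∑ (suc n) F = ∑ n F + F n

∑-cong : ∀ {p} n {F G} → (∀ i → i < n → Eq p (F i) (G i)) → Eq p (∑ n F) (∑ n G)
∑-cong zero    e = refl
∑-cong (suc n) e = +-cong (∑-cong n (λ i i<n → e i (ℕ.m<n⇒m<1+n i<n))) (e n ℕ.≤-refl)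

∑-distribˡ : ∀ c n F → c * ∑ n F ≈ ∑ n (λ i → c * F i)
∑-distribˡ c zero    F = zeroʳ c
∑-distribˡ c (suc n) F = trans (distribˡ c (∑ n F) (F n)) (+-congʳ (∑-distribˡ c n F))

∏-cong : ∀ {p} n {F G} → (∀ i → Eq p (F i) (G i)) → Eq p (∏ n F) (∏ n G)
∏-cong zero    e = refl
∏-cong (suc n) e = *-cong (∏-cong n e) (e n)

^-zeroth : ∀ u n → u 0 ≡ 0ℤ → (u ^ suc n) 0 ≡ 0ℤ
^-zeroth u n u0 = ≡.trans (*-zeroth u (u ^ n)) (≡.trans (cong (ℤ._* (u ^ n) 0) u0) (ℤ.*-zeroˡ ((u ^ n) 0)))

*-zerothˡ : ∀ u v → u 0 ≡ 0ℤ → (u * v) 0 ≡ 0ℤ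
*-zerothˡ u v u0 = ≡.trans (*-zeroth u v) (≡.trans (cong (ℤ._* v 0) u0) (ℤ.*-zeroˡ (v 0)))

^-vanish : ∀ u → u 0 ≡ 0ℤ → ∀ {m n} → m ≤ n → ∀ f → (u ^ n * f) ≈[ m ] 0#
^-vanish u u0 m≤n f = below-≤ m≤n (^-below u u0 _ f)

poch : PS → PS → ℕ → PS
poch a u n = ∏ n (λ i → 1# - a * u ^ i)

poch∞ : PS → PS → PS
poch∞ a u = lim (poch a u)

module _ {u : PS} (u0 : u 0 ≡ 0ℤ) where

  poch-convergent : ∀ a → Convergent (poch a u)
  poch-convergent a N = begin
    poch a u N * (1# - a * u ^ N)             ≈⟨ weaken (ring (poch a u N ∷ a ∷ u ^ N ∷ [])
                                                   (λ P a v → P :* (con 1ℤ :- a :* v) := P :+ v :* (:- a :* P))) ⟩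
    poch a u N + u ^ N * (- a * poch a u N)   ≈⟨ +-congˡ (^-below u u0 N _) ⟩
    poch a u N + 0#                           ≈⟨ +-identityʳ _ ⟩
    poch a u N                                ∎

  poch∞-below : ∀ a {N M} → N ≤ M → poch∞ a u ≈[ N ] poch a u M
  poch∞-below a = lim-below {poch a u} (poch-convergent a)

∏-∘ : ∀ {u} → u 0 ≡ 0ℤ → ∀ n F → ∏ n F ∘ u ≈ ∏ n (λ i → F i ∘ u)
∏-∘ u0 zero    F = ∘-const u0 1ℤ
∏-∘ u0 (suc n) F = trans (∘-* u0 _ _) (*-congʳ (∏-∘ u0 n F))

∑-∘ : ∀ {u} → u 0 ≡ 0ℤ → ∀ n F → ∑ n F ∘ u ≈ ∑ n (λ i → F i ∘ u)
∑-∘ u0 zero    F = ∘-const u0 0ℤ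
∑-∘ u0 (suc n) F = trans (∘-+ u0 _ _) (+-congʳ (∑-∘ u0 n F))

poch-∘ : ∀ {u} → u 0 ≡ 0ℤ → ∀ a v n → poch a v n ∘ u ≈ poch (a ∘ u) (v ∘ u) n
poch-∘ {u} u0 a v n = trans (∏-∘ u0 n _) (∏-cong n λ i →
  trans (∘-⟦⟧ u0 (con 1ℤ :- var zero :* var (suc zero)) (a ∷ v ^ i ∷ []))
        (+-congˡ (-‿cong (*-congˡ (∘-^ u0 v i)))))

poch∞-∘ : ∀ {u} → u 0 ≡ 0ℤ → ∀ a v → v 0 ≡ 0ℤ → poch∞ a v ∘ u ≈ poch∞ (a ∘ u) (v ∘ u)
poch∞-∘ {u} u0 a v v0 = below-all λ N → begin
  poch∞ a v ∘ u              ≈⟨ ∘-below-cong u0 (poch∞-below v0 a ℕ.≤-refl) ⟩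
  poch a v N ∘ u             ≈⟨ weaken (poch-∘ u0 a v N) ⟩
  poch (a ∘ u) (v ∘ u) N     ≈⟨ poch∞-below (≡.trans (∘-zeroth u0 v) v0) (a ∘ u) ℕ.≤-refl ⟨
  poch∞ (a ∘ u) (v ∘ u)      ∎

poch-cong : ∀ {a b u v} → a ≈ b → u ≈ v → ∀ n → poch a u n ≈ poch b v n
poch-cong e e′ n = ∏-cong n λ i → +-congˡ (-‿cong (*-cong e (^-congˡ i e′)))

poch-shift : ∀ a u n → poch a u (suc n) ≈ (1# - a) * poch (a * u) u n
poch-shift a u zero    = ring (a ∷ []) (λ a → con 1ℤ :* (con 1ℤ :- a :* con 1ℤ) := (con 1ℤ :- a) :* con 1ℤ)
poch-shift a u (suc n) = linear (poch a u (suc n) ∷ poch (a * u) u n ∷ a ∷ u ∷ u ^ n ∷ [])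
  (λ P P′ a u v → (P :* (con 1ℤ :- a :* (u :* v)) := (con 1ℤ :- a) :* (P′ :* (con 1ℤ :- (a :* u) :* v))) ,
    (con 1ℤ :- a :* (u :* v) , (P := (con 1ℤ :- a) :* P′)) ∷ [])
  (poch-shift a u n ∷ [])

opaque
  unfolding _⊕_
  poch-zeroth : ∀ a u n → a 0 ≡ 0ℤ → poch a u n 0 ≡ 1ℤ
  poch-zeroth a u zero    a0 = ≡.refl
  poch-zeroth a u (suc n) a0 = cong₂ ℤ._*_ (poch-zeroth a u n a0)
    (cong (λ z → 1ℤ ℤ.- z) (*-zerothˡ a (u ^ n) a0))

  1-zeroth : ∀ a → a 0 ≡ 0ℤ → (1# - a) 0 ≡ 1ℤ
  1-zeroth a a0 = cong (λ z → 1ℤ ℤ.- z) a0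

pochInv : PS → PS → ℕ → PS
pochInv a u n = inv (poch a u n)

module _ {a : PS} (a0 : a 0 ≡ 0ℤ) (u : PS) where
  poch-*-pochInv : ∀ n → poch a u n * pochInv a u n ≈ 1#
  poch-*-pochInv n = *-inv _ (poch-zeroth a u n a0)

  pochInv-suc : ∀ n → (1# - a * u ^ n) * pochInv a u (suc n) ≈ pochInv a u n
  pochInv-suc n = linear (poch a u n ∷ pochInv a u n ∷ pochInv a u (suc n) ∷ a ∷ u ^ n ∷ [])
    (λ P I I′ a v → ((con 1ℤ :- a :* v) :* I′ := I) ,
      (I , (P :* (con 1ℤ :- a :* v) :* I′ := con 1ℤ)) ∷ (:- ((con 1ℤ :- a :* v) :* I′) , (P :* I := con 1ℤ)) ∷ [])
    (poch-*-pochInv (suc n) ∷ poch-*-pochInv n ∷ [])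

inv-unique : ∀ {p} f g → f 0 ≡ 1ℤ → Eq p (f * g) 1# → Eq p g (inv f)
inv-unique f g f0 e = *-cancelˡ f f0 (trans e (weaken (sym (*-inv f f0))))


-- Theta functions as infinite products

^-swap : ∀ u m n → (u ^ m) ^ n ≈ (u ^ n) ^ m
^-swap u m n = trans (^-assocʳ u m n) (trans (≡⇒≈ (cong (u ^_) (ℕ.*-comm m n))) (sym (^-assocʳ u n m)))

-- Shanks' telescoping argument: S n = (a²p;p)ₙ/(ap;p)ₙ · Σ_{s≤n} (a;p)ₛ/(p;p)ₛ (ap^{n+1})^s is at the same
-- time a partial sum of a theta series and an approximation to (a²p;p)_∞/(ap;p)_∞.
module Shanks (a p : PS) (p0 : p 0 ≡ 0ℤ) where

  z : ℕ → PS
  z n = a * p ^ suc n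

  w : ℕ → PS
  w s = poch a p s * pochInv p p s

  A R S : ℕ → PS
  U : ℕ → ℕ → PS
  A n = poch (a * a * p) p n
  R n = A n * pochInv (a * p) p n
  U n m = ∑ m (λ s → w s * z n ^ s)
  S n = R n * U n (suc n)

  ap0 : (a * p) 0 ≡ 0ℤ
  ap0 = ≡.trans (coeff (*-comm a p) 0) (*-zerothˡ p a p0)

  z0 : ∀ n → z n 0 ≡ 0ℤ
  z0 n = ≡.trans (coeff (*-comm a (p ^ suc n)) 0) (*-zerothˡ (p ^ suc n) a (^-zeroth p n p0))

  w-suc : ∀ s → (1# - p * p ^ s) * w (suc s) ≈ (1# - a * p ^ s) * w s
  w-suc s = linear (poch a p s ∷ pochInv p p s ∷ pochInv p p (suc s) ∷ a ∷ p ∷ p ^ s ∷ [])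
    (λ P J J′ a p v → ((con 1ℤ :- p :* v) :* (P :* (con 1ℤ :- a :* v) :* J′) := (con 1ℤ :- a :* v) :* (P :* J)) ,
      (P :* (con 1ℤ :- a :* v) , ((con 1ℤ :- p :* v) :* J′ := J)) ∷ [])
    (pochInv-suc p0 p s ∷ [])

  z-suc-^ : ∀ n s → z (suc n) ^ s ≈ z n ^ s * p ^ s
  z-suc-^ n s = trans (^-congˡ s (ring (a ∷ p ∷ p ^ n ∷ []) (λ a p v → a :* (p :* (p :* v)) := a :* (p :* v) :* p)))
                      (^-distrib-* (z n) p s)

  -- Adding the summands of index m changes the left side by `w m * z n ^ m` times `p ^ m` (1 - a²
  -- p^(n+1)) - 1 + `z n`. Together with the previous boundary term this gives
  -- `z n * (1 - a * p ^ m)`, which `w-suc` turns into the next boundary term.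
  U-suc : ∀ n m → (1# - a * a * p * p ^ n) * U (suc n) m - (1# - z n) * U n m ≈ w m * z n ^ m * (1# - p ^ m)
  U-suc n zero = ring (1# - a * a * p * p ^ n ∷ 1# - z n ∷ w 0 ∷ [])
    (λ x y w → x :* con 0ℤ :- y :* con 0ℤ := w :* con 1ℤ :* (con 1ℤ :- con 1ℤ))
  U-suc n (suc m) = linear (U (suc n) m ∷ U n m ∷ w m ∷ w (suc m) ∷ z n ^ m ∷ z (suc n) ^ m ∷ a ∷ p ∷ p ^ n ∷ p ^ m ∷ [])
    (λ T₁ T₀ w w′ Z Z′ a p v s →
      let c = con 1ℤ :- a :* a :* p :* v ; z = a :* (p :* v) in
      (c :* (T₁ :+ w :* Z′) :- (con 1ℤ :- z) :* (T₀ :+ w :* Z) := w′ :* (z :* Z) :* (con 1ℤ :- p :* s)) ,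
      (con 1ℤ , (c :* T₁ :- (con 1ℤ :- z) :* T₀ := w :* Z :* (con 1ℤ :- s))) ∷
      (c :* w , (Z′ := Z :* s)) ∷
      (:- (z :* Z) , ((con 1ℤ :- p :* s) :* w′ := (con 1ℤ :- a :* s) :* w)) ∷ [])
    (U-suc n m ∷ z-suc-^ n m ∷ w-suc m ∷ [])

  R-suc : ∀ n → (1# - z n) * R (suc n) ≈ (1# - a * a * p * p ^ n) * R n
  R-suc n = linear (A n ∷ pochInv (a * p) p n ∷ pochInv (a * p) p (suc n) ∷ a ∷ p ∷ p ^ n ∷ [])
    (λ A I I′ a p v → let c = con 1ℤ :- a :* a :* p :* v in
      ((con 1ℤ :- a :* (p :* v)) :* (A :* c :* I′) := c :* (A :* I)) ,
      (A :* c , ((con 1ℤ :- a :* p :* v) :* I′ := I)) ∷ [])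
    (pochInv-suc ap0 p n ∷ [])

  -- `R-suc` and `U-suc` share their two factors, so after multiplication by 1 - `z n` the old sum
  -- reappears. The boundary term of `U-suc` and the new summand add up to a multiple of 1 -
  -- `z n ^ 2`, and its factor 1 - `z n` cancels.
  S-suc′ : ∀ n → S (suc n) ≈ S n + R n * w (suc n) * z n ^ suc n * (1# + z n)
  S-suc′ n = *-cancelˡ (1# - z n) (1-zeroth (z n) (z0 n))
    (linear (R n ∷ R (suc n) ∷ U n (suc n) ∷ U (suc n) (suc n) ∷ w (suc n) ∷ z n ^ suc n ∷ z (suc n) ^ suc n ∷ a ∷ p ∷ p ^ n ∷ [])
      (λ R R′ T₀ T₁ w Z Z′ a p v → let c = con 1ℤ :- a :* a :* p :* v ; z = a :* (p :* v) in
        ((con 1ℤ :- z) :* (R′ :* (T₁ :+ w :* Z′)) := (con 1ℤ :- z) :* (R :* T₀ :+ R :* w :* Z :* (con 1ℤ :+ z))) ,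
        (T₁ :+ w :* Z′ , ((con 1ℤ :- z) :* R′ := c :* R)) ∷
        (R , (c :* T₁ :- (con 1ℤ :- z) :* T₀ := w :* Z :* (con 1ℤ :- p :* v))) ∷
        (c :* R :* w , (Z′ := Z :* (p :* v))) ∷ [])
      (R-suc n ∷ U-suc n (suc n) ∷ z-suc-^ n (suc n) ∷ []))

  -- Without its first factor 1 - a, the product in `w (suc n)` cancels the denominator of `R n`.
  -- The remaining quotient of products is elementary when a² = 1 or a² = p, the two cases of Gauss.
  S-suc : ∀ n → S (suc n) ≈ S n + (1# - a) * (A n * pochInv p p (suc n)) * z n ^ suc n * (1# + z n)
  S-suc n = trans (S-suc′ n) (+-congˡ (linear
    (A n ∷ pochInv (a * p) p n ∷ poch a p (suc n) ∷ poch (a * p) p n ∷ pochInv p p (suc n) ∷ z n ^ suc n ∷ z n ∷ a ∷ [])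
    (λ A I P P′ J Z z a →
      (A :* I :* (P :* J) :* Z :* (con 1ℤ :+ z) := (con 1ℤ :- a) :* (A :* J) :* Z :* (con 1ℤ :+ z)) ,
      (A :* I :* J :* Z :* (con 1ℤ :+ z) , (P := (con 1ℤ :- a) :* P′)) ∷
      ((con 1ℤ :- a) :* A :* J :* Z :* (con 1ℤ :+ z) , (P′ :* I := con 1ℤ)) ∷ [])
    (poch-shift a p n ∷ poch-*-pochInv ap0 p n ∷ [])))

  w-zero : w 0 ≈ 1#
  w-zero = poch-*-pochInv {p} p0 p 0

  z-^-vanish : ∀ n s f → (z n ^ suc s * f) ≈[ n ] 0#
  z-^-vanish n s f = trans
    (weaken (ring (a ∷ p ∷ p ^ n ∷ z n ^ s ∷ f ∷ []) (λ a p v Z f → a :* (p :* v) :* Z :* f := v :* (a :* p :* Z :* f))))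
    (^-below p p0 n _)

  U-below : ∀ n m → U n (suc m) ≈[ n ] 1#
  U-below n zero    = weaken (linear (w 0 ∷ []) (λ w → (con 0ℤ :+ w :* con 1ℤ := con 1ℤ) , (con 1ℤ , (w := con 1ℤ)) ∷ []) (w-zero ∷ []))
  U-below n (suc m) = trans (+-cong (U-below n m) (trans (*-comm (w (suc m)) (z n ^ suc m)) (z-^-vanish n m (w (suc m))))) (+-identityʳ 1#)

  S-convergent : Convergent S
  S-convergent n = begin
    S (suc n)          ≈⟨ weaken (trans (S-suc n) (+-congˡ (ring (1# - a ∷ A n * pochInv p p (suc n) ∷ z n ^ suc n ∷ 1# + z n ∷ [])
                            (λ x y Z t → x :* y :* Z :* t := Z :* (x :* y :* t))))) ⟩
    S n + z n ^ suc n * _  ≈⟨ +-congˡ (z-^-vanish n n _) ⟩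
    S n + 0#           ≈⟨ +-identityʳ _ ⟩
    S n                ∎

  -- `z n` is divisible by `p ^ n`, so at that precision only the summand s = 0 of `U` survives and
  -- `S n` agrees with `R n`.
  S-limit : lim S * poch∞ (a * p) p ≈ poch∞ (a * a * p) p
  S-limit = below-all λ n → begin
    lim S * poch∞ (a * p) p                                     ≈⟨ *-cong (lim-below {S} S-convergent ℕ.≤-refl) (poch∞-below p0 (a * p) ℕ.≤-refl) ⟩
    A n * pochInv (a * p) p n * U n (suc n) * poch (a * p) p n  ≈⟨ *-congʳ (*-congˡ (U-below n n)) ⟩
    A n * pochInv (a * p) p n * 1# * poch (a * p) p n           ≈⟨ weaken (linear (A n ∷ pochInv (a * p) p n ∷ poch (a * p) p n ∷ [])
        (λ A I P → (A :* I :* con 1ℤ :* P := A) , (A , (P :* I := con 1ℤ)) ∷ []) (poch-*-pochInv ap0 p n ∷ [])) ⟩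
    A n                                                         ≈⟨ poch∞-below p0 (a * a * p) ℕ.≤-refl ⟨
    poch∞ (a * a * p) p                                         ∎

  S-zero : S 0 ≈ 1#
  S-zero = linear (pochInv (a * p) p 0 ∷ w 0 ∷ []) (λ I w →
    (con 1ℤ :* I :* (con 0ℤ :+ w :* con 1ℤ) := con 1ℤ) , (I , (w := con 1ℤ)) ∷ (con 1ℤ , (con 1ℤ :* I := con 1ℤ)) ∷ [])
    (w-zero ∷ poch-*-pochInv {a * p} ap0 p 0 ∷ [])


poch∞-cong : ∀ {a b u v} → a ≈ b → u ≈ v → poch∞ a u ≈ poch∞ b v
poch∞-cong e e′ = ≐⇒Eq λ n → coeff (poch-cong e e′ (suc n)) n

poch∞-shift : ∀ a u → u 0 ≡ 0ℤ → poch∞ a u ≈ (1# - a) * poch∞ (a * u) u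
poch∞-shift a u u0 = below-all λ n → begin
  poch∞ a u                        ≈⟨ poch∞-below u0 a (ℕ.n≤1+n n) ⟩
  poch a u (suc n)                 ≈⟨ weaken (poch-shift a u n) ⟩
  (1# - a) * poch (a * u) u n      ≈⟨ *-congˡ (poch∞-below u0 (a * u) ℕ.≤-refl) ⟨
  (1# - a) * poch∞ (a * u) u       ∎

-- Gauss's product formulas for `φ` and `ψ`

q0 : q 0 ≡ 0ℤ
q0 = q-zeroth

q²0 : (q ^ 2) 0 ≡ 0ℤ
q²0 = ^-zeroth q 1 q0

-q0 : (- q) 0 ≡ 0ℤ
-q0 = ≡.trans (neg-at q 0) (cong ℤ.-_ q0)

eta : PS → PS
eta u = poch∞ u u

eta-∘ : ∀ {u v} → u 0 ≡ 0ℤ → v 0 ≡ 0ℤ → eta v ∘ u ≈ eta (v ∘ u)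
eta-∘ {v = v} u0 v0 = poch∞-∘ u0 v v v0

eta-q-∘ : ∀ {u} → u 0 ≡ 0ℤ → eta q ∘ u ≈ eta u
eta-q-∘ u0 = trans (eta-∘ u0 q0) (poch∞-cong (q∘ u0) (q∘ u0))

twice : ℕ → ℕ
twice zero    = zero
twice (suc n) = suc (suc (twice n))

n≤twice : ∀ n → n ≤ twice n
n≤twice zero    = z≤n
n≤twice (suc n) = s≤s (ℕ.m≤n⇒m≤1+n (n≤twice n))

twice≡2* : ∀ n → twice n ≡ 2 ℕ.* n
twice≡2* zero    = ≡.refl
twice≡2* (suc n) = ≡.trans (cong (λ k → suc (suc k)) (twice≡2* n)) (≡.sym (ℕ.*-suc 2 n))

^-twice : ∀ u n → u ^ twice n ≈ (u ^ n) ^ 2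
^-twice u n = trans (≡⇒≈ (cong (u ^_) (≡.trans (twice≡2* n) (ℕ.*-comm 2 n)))) (sym (^-assocʳ u n 2))

poch-conjugate : ∀ n → poch (const -1ℤ * q) q n * poch q q n ≈ poch (q ^ 2) (q ^ 2) n
poch-conjugate zero    = *-identityˡ 1#
poch-conjugate (suc n) = linear
  (poch (const -1ℤ * q) q n ∷ poch q q n ∷ poch (q ^ 2) (q ^ 2) n ∷ q ∷ q ^ n ∷ (q ^ 2) ^ n ∷ [])
  (λ A B C q v s → (A :* (con 1ℤ :- con -1ℤ :* q :* v) :* (B :* (con 1ℤ :- q :* v)) := C :* (con 1ℤ :- q :^ 2 :* s)) ,
    ((con 1ℤ :- q :^ 2 :* v :^ 2) , (A :* B := C)) ∷ (:- (C :* q :^ 2) , (v :^ 2 := s)) ∷ [])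
  (poch-conjugate n ∷ ^-swap q n 2 ∷ [])

poch-odd : ∀ n → poch q (q ^ 2) n * poch (q ^ 2) (q ^ 2) n ≈ poch q q (twice n)
poch-odd zero    = *-identityˡ 1#
poch-odd (suc n) = linear
  (poch q (q ^ 2) n ∷ poch (q ^ 2) (q ^ 2) n ∷ poch q q (twice n) ∷ q ∷ q ^ n ∷ (q ^ 2) ^ n ∷ q ^ twice n ∷ [])
  (λ A B C q v s t →
    (A :* (con 1ℤ :- q :* s) :* (B :* (con 1ℤ :- q :^ 2 :* s)) := C :* (con 1ℤ :- q :* t) :* (con 1ℤ :- q :* (q :* t))) ,
    ((con 1ℤ :- q :* s) :* (con 1ℤ :- q :^ 2 :* s) , (A :* B := C)) ∷
    (:- (C :* (q :+ q :^ 2 :- q :^ 3 :* (s :+ t))) , (s := v :^ 2)) ∷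
    (C :* (q :+ q :^ 2 :- q :^ 3 :* (s :+ t)) , (t := v :^ 2)) ∷ [])
  (poch-odd n ∷ ^-swap q 2 n ∷ ^-twice q n ∷ [])

η₁ η₂ : PS
η₁ = eta q
η₂ = eta (q ^ 2)

phiSum : ℕ → PS
phiSum n = 1# + const (+ 2) * ∑ n (λ s → q ^ (suc s ℕ.* suc s))

φ : PS
φ = lim phiSum

phiSum-convergent : Convergent phiSum
phiSum-convergent n = begin
  1# + const (+ 2) * (∑ n _ + q ^ (suc n ℕ.* suc n))             ≈⟨ weaken (ring (∑ n _ ∷ q ^ (suc n ℕ.* suc n) ∷ [])
      (λ x v → con 1ℤ :+ con (+ 2) :* (x :+ v) := con 1ℤ :+ con (+ 2) :* x :+ v :* con (+ 2))) ⟩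
  phiSum n + q ^ (suc n ℕ.* suc n) * const (+ 2)                 ≈⟨ +-congˡ (^-vanish q q0 (ℕ.≤-trans (ℕ.n≤1+n n) (ℕ.m≤m*n (suc n) (suc n))) _) ⟩
  phiSum n + 0#                                                  ≈⟨ +-identityʳ _ ⟩
  phiSum n                                                       ∎

tri : ℕ → ℕ
tri zero    = zero
tri (suc n) = suc n ℕ.+ tri n

n≤tri : ∀ n → n ≤ tri n
n≤tri zero    = z≤n
n≤tri (suc n) = ℕ.m≤m+n (suc n) (tri n)

psiSum : ℕ → PS
psiSum n = ∑ n (λ s → q ^ tri s)

ψ : PS
ψ = lim psiSum

psiSum-convergent : Convergent psiSum
psiSum-convergent n = trans (+-congˡ (trans (weaken (sym (*-identityʳ _))) (^-vanish q q0 (n≤tri n) 1#))) (+-identityʳ _)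

neg-^ : ∀ m → (∀ x → (- x) ^ m ≈ x ^ m) ⊎ (∀ x → (- x) ^ m ≈ - (x ^ m))
neg-^ zero = inj₁ λ _ → refl
neg-^ (suc m) with neg-^ m
... | inj₁ e = inj₂ λ x → linear (x ∷ x ^ m ∷ (- x) ^ m ∷ []) (λ x y z → (:- x :* z := :- (x :* y)) , (:- x , (z := y)) ∷ []) (e x ∷ [])
... | inj₂ e = inj₁ λ x → linear (x ∷ x ^ m ∷ (- x) ^ m ∷ []) (λ x y z → (:- x :* z := x :* y) , (:- x , (z := :- y)) ∷ []) (e x ∷ [])

-- The integers m² and m have the same parity.
neg-^-square : ∀ x m → (- x) ^ (m ℕ.* m) ≈ (- (x ^ m)) ^ m
neg-^-square x m = trans (sym (^-assocʳ (- x) m m)) (lem (neg-^ m))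
  where
  lem : _ → ((- x) ^ m) ^ m ≈ (- (x ^ m)) ^ m
  lem (inj₁ e) = trans (^-congˡ m (e x)) (sym (e (x ^ m)))
  lem (inj₂ e) = ^-congˡ m (e x)

module Gauss-φ where
  open Shanks (const -1ℤ) q q0

  -- For a = -1 the numerator (a²p;p)ₙ is (q;q)ₙ, so the quotient in `S-suc` is 1/(1 - q^(n+1)), and
  -- this cancels 1 + `z n`. The increment left over is 2(-q^(n+1))^(n+1).
  phiSum≈S : ∀ n → phiSum n ∘ (- q) ≈ S n
  phiSum≈S zero    = trans (∘-⟦⟧ -q0 (con 1ℤ :+ con (+ 2) :* con 0ℤ) []) (trans (ring [] (con 1ℤ :+ con (+ 2) :* con 0ℤ := con 1ℤ)) (sym S-zero))
  phiSum≈S (suc n) = trans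
    (∘-⟦⟧ -q0 (con 1ℤ :+ con (+ 2) :* (var zero :+ var (suc zero))) (∑ n (λ s → q ^ (suc s ℕ.* suc s)) ∷ q ^ (suc n ℕ.* suc n) ∷ []))
    (linear (∑ n (λ s → q ^ (suc s ℕ.* suc s)) ∘ (- q) ∷ (q ^ (suc n ℕ.* suc n)) ∘ (- q) ∷ phiSum n ∘ (- q) ∷ S n ∷ S (suc n) ∷
             A n ∷ poch q q n ∷ pochInv q q n ∷ pochInv q q (suc n) ∷ z n ^ suc n ∷ q ∷ q ^ n ∷ [])
      (λ x v P S S′ A B J J′ Z q w → let z = con -1ℤ :* (q :* w) in
        (con 1ℤ :+ con (+ 2) :* (x :+ v) := S′) ,
        (con 1ℤ , (P := S)) ∷
        (con -1ℤ , (P := con 1ℤ :+ con (+ 2) :* x)) ∷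
        (con (+ 2) , (v := Z)) ∷
        (con -1ℤ , (S′ := S :+ (con 1ℤ :- con -1ℤ) :* (A :* J′) :* Z :* (con 1ℤ :+ z))) ∷
        (:- (con (+ 2) :* J′ :* Z :* (con 1ℤ :+ z)) , (A := B)) ∷
        (:- (con (+ 2) :* B :* Z) , ((con 1ℤ :- q :* w) :* J′ := J)) ∷
        (:- (con (+ 2) :* Z) , (B :* J := con 1ℤ)) ∷ [])
      (phiSum≈S n
       ∷ ∘-⟦⟧ -q0 (con 1ℤ :+ con (+ 2) :* var zero) (∑ n (λ s → q ^ (suc s ℕ.* suc s)) ∷ [])
       ∷ trans (∘-^ -q0 q (suc n ℕ.* suc n)) (trans (^-congˡ (suc n ℕ.* suc n) (q∘ -q0))
           (trans (neg-^-square q (suc n)) (^-congˡ (suc n) (ring (q ^ suc n ∷ []) (λ v → :- v := con -1ℤ :* v)))))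
       ∷ S-suc n
       ∷ poch-cong (ring (q ∷ []) (λ q → con -1ℤ :* con -1ℤ :* q := q)) refl n
       ∷ pochInv-suc q0 q n
       ∷ poch-*-pochInv q0 q n ∷ []))

  gauss : φ ∘ (- q) * η₂ ≈ η₁ * η₁
  gauss = linear (φ ∘ (- q) ∷ lim S ∷ η₁ ∷ η₂ ∷ poch∞ (const -1ℤ * q) q ∷ poch∞ (const -1ℤ * const -1ℤ * q) q ∷ [])
    (λ D L f₁ f₂ M A → (D :* f₂ := f₁ :* f₁) ,
      (f₂ , (D := L)) ∷ (:- L , (M :* f₁ := f₂)) ∷ (f₁ , (L :* M := A)) ∷ (f₁ , (A := f₁)) ∷ [])
    (below-all (λ n → trans (∘-below-cong -q0 (lim-below {phiSum} phiSum-convergent ℕ.≤-refl))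
        (trans (weaken (phiSum≈S n)) (sym (lim-below {S} S-convergent ℕ.≤-refl))))
     ∷ below-all (λ n → trans (*-cong (poch∞-below q0 _ ℕ.≤-refl) (poch∞-below q0 q ℕ.≤-refl))
        (trans (weaken (poch-conjugate n)) (sym (poch∞-below q²0 (q ^ 2) ℕ.≤-refl))))
     ∷ S-limit
     ∷ poch∞-cong (ring (q ∷ []) (λ q → con -1ℤ :* con -1ℤ :* q := q)) refl ∷ [])

tri-twice : ∀ n → tri (twice n) ≡ n ℕ.* suc (2 ℕ.* n)
tri-twice zero    = ≡.refl
tri-twice (suc n) = ≡.trans (cong₂ (λ a b → suc (suc a) ℕ.+ (suc a ℕ.+ b)) (twice≡2* n) (tri-twice n)) (lem n)
  where
  lem : ∀ n → suc (suc (2 ℕ.* n)) ℕ.+ (suc (2 ℕ.* n) ℕ.+ n ℕ.* suc (2 ℕ.* n)) ≡ suc n ℕ.* suc (2 ℕ.* suc n)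
  lem = ℕ-Solver.solve-∀

module Gauss-ψ where
  open Shanks q (q ^ 2) q²0

  z≈q^ : ∀ n → z n ≈ q ^ suc (2 ℕ.* suc n)
  z≈q^ n = *-congˡ (^-assocʳ q 2 (suc n))

  -- One step of `S` yields two triangular exponents: `z n ^ suc n` is the power of q with exponent
  -- tri(2n+2), and the factor 1 + `z n` adds the one with exponent tri(2n+3). The quotient of
  -- products is 1/(1 - q²), so with 1 - q from `S-suc` the factor 1 + q is exactly what is missing.
  psiSum≈S : ∀ n → psiSum (twice (suc n)) ≈ (1# + q) * S n
  psiSum≈S zero    = linear (q ∷ S 0 ∷ []) (λ q S → (con 0ℤ :+ con 1ℤ :+ q :* con 1ℤ := (con 1ℤ :+ q) :* S) ,
    (:- (con 1ℤ :+ q) , (S := con 1ℤ)) ∷ []) (S-zero ∷ [])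
  psiSum≈S (suc n) = linear
    (psiSum (twice (suc n)) ∷ q ^ tri (twice (suc n)) ∷ q ^ suc (twice (suc n)) ∷ q ^ tri (suc (twice (suc n))) ∷ S n ∷ S (suc n) ∷
     A n ∷ poch (q ^ 2 * q ^ 2) (q ^ 2) n ∷ poch (q ^ 2) (q ^ 2) (suc n) ∷ pochInv (q ^ 2) (q ^ 2) (suc n) ∷ z n ∷ z n ^ suc n ∷ q ∷ [])
    (λ P t y t′ S S′ A B C J z Z q → let c = (con 1ℤ :- q :^ 2) :* J :* Z :* (con 1ℤ :+ z) in
      (P :+ t :+ t′ := (con 1ℤ :+ q) :* S′) ,
      (con 1ℤ , (P := (con 1ℤ :+ q) :* S)) ∷
      (con 1ℤ :+ z , (t := Z)) ∷
      (con 1ℤ , (t′ := y :* t)) ∷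
      (t , (y := z)) ∷
      (:- (con 1ℤ :+ q) , (S′ := S :+ (con 1ℤ :- q) :* (A :* J) :* Z :* (con 1ℤ :+ z))) ∷
      (:- c , (A := B)) ∷
      (J :* Z :* (con 1ℤ :+ z) , (C := (con 1ℤ :- q :^ 2) :* B)) ∷
      (:- (Z :* (con 1ℤ :+ z)) , (C :* J := con 1ℤ)) ∷ [])
    (psiSum≈S n
     ∷ trans (≡⇒≈ (cong (q ^_) (≡.trans (tri-twice (suc n)) (ℕ.*-comm (suc n) (suc (2 ℕ.* suc n))))))
         (trans (sym (^-assocʳ q (suc (2 ℕ.* suc n)) (suc n))) (^-congˡ (suc n) (sym (z≈q^ n))))
     ∷ ^-homo-* q (suc (twice (suc n))) (tri (twice (suc n)))
     ∷ trans (≡⇒≈ (cong (λ k → q ^ suc k) (twice≡2* (suc n)))) (sym (z≈q^ n))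
     ∷ S-suc n
     ∷ poch-cong (ring (q ∷ []) (λ q → q :* q :* q :^ 2 := q :^ 2 :* q :^ 2)) refl n
     ∷ poch-shift (q ^ 2) (q ^ 2) n
     ∷ poch-*-pochInv q²0 (q ^ 2) (suc n) ∷ [])

  gauss : ψ * η₁ ≈ η₂ * η₂
  gauss = linear (ψ ∷ lim S ∷ η₁ ∷ η₂ ∷ poch∞ q (q ^ 2) ∷ poch∞ (q * q ^ 2) (q ^ 2) ∷ poch∞ (q * q * q ^ 2) (q ^ 2) ∷ poch∞ (q ^ 2 * q ^ 2) (q ^ 2) ∷ q ∷ [])
    (λ ψ L f₁ f₂ o o′ A B q → (ψ :* f₁ := f₂ :* f₂) ,
      (f₁ , (ψ := (con 1ℤ :+ q) :* L)) ∷
      (:- ((con 1ℤ :+ q) :* L) , (o :* f₂ := f₁)) ∷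
      ((con 1ℤ :+ q) :* L :* f₂ , (o := (con 1ℤ :- q) :* o′)) ∷
      ((con 1ℤ :- q :^ 2) :* f₂ , (L :* o′ := A)) ∷
      ((con 1ℤ :- q :^ 2) :* f₂ , (A := B)) ∷
      (:- f₂ , (f₂ := (con 1ℤ :- q :^ 2) :* B)) ∷ [])
    (below-all (λ n → trans (lim-below {psiSum} psiSum-convergent (ℕ.≤-trans (ℕ.n≤1+n n) (n≤twice (suc n))))
        (trans (weaken (psiSum≈S n)) (*-congˡ (sym (lim-below {S} S-convergent ℕ.≤-refl)))))
     ∷ below-all (λ n → trans (*-cong (poch∞-below q²0 q ℕ.≤-refl) (poch∞-below q²0 (q ^ 2) ℕ.≤-refl))
        (trans (weaken (poch-odd n)) (sym (poch∞-below q0 q (n≤twice n)))))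
     ∷ poch∞-shift q (q ^ 2) q²0
     ∷ S-limit
     ∷ poch∞-cong (ring (q ∷ []) (λ q → q :* q :* q :^ 2 := q :^ 2 :* q :^ 2)) refl
     ∷ poch∞-shift (q ^ 2) (q ^ 2) q²0 ∷ [])


-- Substituting powers of `q`, and bisection

opaque
  unfolding _⊕_

  ^-*-low : ∀ k h {i} → i < k → (q ^ k * h) i ≡ 0ℤ
  ^-*-low k h {i} i<k = ≡.trans (coeff< (^-below q q0 k h) i i<k) (zeros i)
    where
    zeros : ∀ i → 0# i ≡ 0ℤ
    zeros zero    = ≡.refl
    zeros (suc _) = ≡.refl

  ^-*-shift : ∀ k h n → (q ^ k * h) (k ℕ.+ n) ≡ h n
  ^-*-shift zero    h n = coeff (*-identityˡ h) n
  ^-*-shift (suc k) h n = ≡.trans (coeff (*-assoc q (q ^ k) h) (suc (k ℕ.+ n)))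
    (≡.trans (q*-suc (q ^ k * h) (k ℕ.+ n)) (^-*-shift k h n))

  const-+-suc : ∀ c f n → (const c + f) (suc n) ≡ f (suc n)
  const-+-suc c f n = ℤ.+-identityˡ (f (suc n))

^-zeroth′ : ∀ k .{{_ : ℕ.NonZero k}} → (q ^ k) 0 ≡ 0ℤ
^-zeroth′ (suc k) = ^-zeroth q k q0

module _ (k : ℕ) .{{k≢0 : ℕ.NonZero k}} where

  ∘^-multiple : ∀ f n → (f ∘ q ^ k) (n ℕ.* k) ≡ f n
  ∘^-multiple f zero    = ∘-zeroth (^-zeroth′ k) f
  ∘^-multiple f (suc n) = ≡.trans (coeff (∘-uncons (^-zeroth′ k) f) (k ℕ.+ n ℕ.* k)) (≡.trans (drop k k≢0)
    (≡.trans (^-*-shift k (tail f ∘ q ^ k) (n ℕ.* k)) (∘^-multiple (tail f) n)))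
    where
    drop : ∀ k → .(ℕ.NonZero k) → ∀ {g} → (const (f 0) + g) (k ℕ.+ n ℕ.* k) ≡ g (k ℕ.+ n ℕ.* k)
    drop (suc k) _ {g} = const-+-suc (f 0) g (k ℕ.+ n ℕ.* suc k)

  ∘^-gap : ∀ f {r} n → suc r < k → (f ∘ q ^ k) (suc r ℕ.+ n ℕ.* k) ≡ 0ℤ
  ∘^-gap f {r} zero    r<k = ≡.trans (cong (f ∘ q ^ k) (ℕ.+-identityʳ (suc r)))
    (≡.trans (coeff (∘-uncons (^-zeroth′ k) f) (suc r))
    (≡.trans (const-+-suc (f 0) _ r) (^-*-low k _ r<k)))
  ∘^-gap f {r} (suc n) r<k = ≡.trans (coeff (∘-uncons (^-zeroth′ k) f) (suc r ℕ.+ (k ℕ.+ n ℕ.* k)))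
    (≡.trans (const-+-suc (f 0) _ (r ℕ.+ (k ℕ.+ n ℕ.* k)))
    (≡.trans (cong (q ^ k * (tail f ∘ q ^ k)) (swap (suc r) k (n ℕ.* k)))
    (≡.trans (^-*-shift k _ (suc r ℕ.+ n ℕ.* k)) (∘^-gap (tail f) n r<k))))
    where
    swap : ∀ a b c → a ℕ.+ (b ℕ.+ c) ≡ b ℕ.+ (a ℕ.+ c)
    swap = ℕ-Solver.solve-∀

  ∘^-injective : ∀ {f g} → f ∘ q ^ k ≈ g ∘ q ^ k → f ≈ g
  ∘^-injective {f} {g} e = ≐⇒Eq λ n → ≡.trans (≡.sym (∘^-multiple f n)) (≡.trans (coeff e (n ℕ.* k)) (∘^-multiple g n))

even odd : PS → PS
even f n = f (n ℕ.* 2)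
odd  f n = f (1 ℕ.+ n ℕ.* 2)

infix 10 _²
-- A substitution and not a square: squares are written `^ 2`. The same convention applies to `_³`.
_² : PS → PS
f ² = f ∘ q ^ 2

module _ {m : ℕ} where
  private module M = Modulo (mod m)

  even-cong : ∀ {f g} → f M.≈ g → even f M.≈ even g
  even-cong e = mk λ n _ → at e (n ℕ.* 2) tt

  odd-cong : ∀ {f g} → f M.≈ g → odd f M.≈ odd g
  odd-cong e = mk λ n _ → at e (1 ℕ.+ n ℕ.* 2) tt

q*-even : ∀ b n → (q * b ²) (n ℕ.* 2) ≡ 0ℤ
q*-even b zero    = q*-zero (b ²)
q*-even b (suc n) = ≡.trans (q*-suc (b ²) (1 ℕ.+ n ℕ.* 2)) (∘^-gap 2 b n (s≤s (s≤s z≤n)))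

even-dissection : ∀ a b → even (a ² + q * b ²) ≈ a
even-dissection a b = ≐⇒Eq λ n → ≡.trans (+-at (a ²) (q * b ²) (n ℕ.* 2))
  (≡.trans (cong₂ ℤ._+_ (∘^-multiple 2 a n) (q*-even b n)) (ℤ.+-identityʳ (a n)))

odd-dissection : ∀ a b → odd (a ² + q * b ²) ≈ b
odd-dissection a b = ≐⇒Eq λ n → ≡.trans (+-at (a ²) (q * b ²) (1 ℕ.+ n ℕ.* 2))
  (≡.trans (cong₂ ℤ._+_ (∘^-gap 2 a n (s≤s (s≤s z≤n))) (≡.trans (q*-suc (b ²) (n ℕ.* 2)) (∘^-multiple 2 b n)))
    (ℤ.+-identityˡ (b n)))

-- Dissections of theta functions and relations between them

q⁴0 : (q ^ 4) 0 ≡ 0ℤ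
q⁴0 = ^-zeroth q 3 q0

q⁸0 : (q ^ 8) 0 ≡ 0ℤ
q⁸0 = ^-zeroth q 7 q0

η₄ D E X : PS
η₄ = eta (q ^ 4)
D = φ ∘ (- q)
E = φ ∘ q ^ 4
X = const (+ 2) * q * ψ ∘ q ^ 8

q^∘q^ : ∀ m n .{{_ : ℕ.NonZero n}} → q ^ m ∘ q ^ n ≈ q ^ (n ℕ.* m)
q^∘q^ m n = trans (∘-^ (^-zeroth′ n) q m) (trans (^-congˡ m (q∘ (^-zeroth′ n))) (^-assocʳ q n m))

²-² : ∀ f → f ² ² ≈ f ∘ q ^ 4
²-² f = trans (∘-∘ q²0 q²0 f) (∘-congʳ f (q^∘q^ 2 2))

²-²-² : ∀ f → f ² ² ² ≈ f ∘ q ^ 8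
²-²-² f = trans (∘-cong q²0 (²-² f)) (trans (∘-∘ q⁴0 q²0 f) (∘-congʳ f (q^∘q^ 4 2)))

-- Even squares are 4n² and odd squares are 8 `tri n` + 1.
φ-dissection : φ ≈ E + X
φ-dissection = below-all λ N → begin
  φ                                              ≈⟨ lim-below {phiSum} phiSum-convergent (n≤twice N) ⟩
  phiSum (twice N)                               ≈⟨ weaken (finite N) ⟩
  phiSum N ∘ q ^ 4 + const (+ 2) * q * psiSum N ∘ q ^ 8
    ≈⟨ +-cong (∘-below-cong q⁴0 (lim-below {phiSum} phiSum-convergent ℕ.≤-refl))
              (*-congˡ (∘-below-cong q⁸0 (lim-below {psiSum} psiSum-convergent ℕ.≤-refl))) ⟨
  E + X                                          ∎
  where
  even-square : ∀ n → q ^ (suc (suc (twice n)) ℕ.* suc (suc (twice n))) ≈ q ^ (suc n ℕ.* suc n) ∘ q ^ 4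
  even-square n = trans (≡⇒≈ (cong (q ^_) (≡.trans (cong (λ k → suc (suc k) ℕ.* suc (suc k)) (twice≡2* n)) (lem n))))
                        (sym (q^∘q^ (suc n ℕ.* suc n) 4))
    where
    lem : ∀ n → suc (suc (2 ℕ.* n)) ℕ.* suc (suc (2 ℕ.* n)) ≡ 4 ℕ.* (suc n ℕ.* suc n)
    lem = ℕ-Solver.solve-∀
  2*tri : ∀ n → 2 ℕ.* tri n ≡ n ℕ.* suc n
  2*tri zero    = ≡.refl
  2*tri (suc n) = ≡.trans (ℕ.*-distribˡ-+ 2 (suc n) (tri n)) (≡.trans (cong (2 ℕ.* suc n ℕ.+_) (2*tri n)) (lem n))
    where
    lem : ∀ n → 2 ℕ.* suc n ℕ.+ n ℕ.* suc n ≡ suc n ℕ.* suc (suc n)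
    lem = ℕ-Solver.solve-∀
  odd-square : ∀ n → q ^ (suc (twice n) ℕ.* suc (twice n)) ≈ q * q ^ tri n ∘ q ^ 8
  odd-square n = trans (≡⇒≈ (cong (q ^_) (≡.trans (cong (λ k → suc k ℕ.* suc k) (twice≡2* n))
                   (≡.trans (lem n) (cong suc (≡.trans (cong (4 ℕ.*_) (≡.sym (2*tri n))) (≡.sym (ℕ.*-assoc 4 2 (tri n)))))))))
                   (*-congˡ (sym (q^∘q^ (tri n) 8)))
    where
    lem : ∀ n → suc (2 ℕ.* n) ℕ.* suc (2 ℕ.* n) ≡ suc (4 ℕ.* (n ℕ.* suc n))
    lem = ℕ-Solver.solve-∀
  finite : ∀ n → phiSum (twice n) ≈ phiSum n ∘ q ^ 4 + const (+ 2) * q * psiSum n ∘ q ^ 8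
  finite n = linear
    (∑ (twice n) sq ∷ phiSum n ∘ q ^ 4 ∷ psiSum n ∘ q ^ 8 ∷ ∑ n sq ∘ q ^ 4 ∷ q ∷ [])
    (λ x P S y q → (con 1ℤ :+ con (+ 2) :* x := P :+ con (+ 2) :* q :* S) ,
      (con (+ 2) , (x := y :+ q :* S)) ∷ (con -1ℤ , (P := con 1ℤ :+ con (+ 2) :* y)) ∷ [])
    (sums n ∷ ∘-⟦⟧ q⁴0 (con 1ℤ :+ con (+ 2) :* var zero) (∑ n sq ∷ []) ∷ [])
    where
    sq : ℕ → PS
    sq s = q ^ (suc s ℕ.* suc s)
    sums : ∀ n → ∑ (twice n) sq ≈ ∑ n sq ∘ q ^ 4 + q * psiSum n ∘ q ^ 8
    sums zero    = linear (0# ∘ q ^ 4 ∷ 0# ∘ q ^ 8 ∷ q ∷ []) (λ a b q → (con 0ℤ := a :+ q :* b) , (con -1ℤ , (a := con 0ℤ)) ∷ (:- q , (b := con 0ℤ)) ∷ [])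
      (∘-const q⁴0 0ℤ ∷ ∘-const q⁸0 0ℤ ∷ [])
    sums (suc n) = linear
      (∑ (twice n) sq ∷ sq (twice n) ∷ sq (suc (twice n)) ∷ ∑ n sq ∘ q ^ 4 ∷ psiSum n ∘ q ^ 8 ∷ sq n ∘ q ^ 4 ∷ q ^ tri n ∘ q ^ 8 ∷
       ∑ (suc n) sq ∘ q ^ 4 ∷ psiSum (suc n) ∘ q ^ 8 ∷ q ∷ [])
      (λ x o e a b c d a′ b′ q → (x :+ o :+ e := a′ :+ q :* b′) ,
        (con 1ℤ , (x := a :+ q :* b)) ∷ (con 1ℤ , (o := q :* d)) ∷ (con 1ℤ , (e := c)) ∷
        (con -1ℤ , (a′ := a :+ c)) ∷ (:- q , (b′ := b :+ d)) ∷ [])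
      (sums n ∷ odd-square n ∷ even-square n ∷ ∘-+ q⁴0 _ _ ∷ ∘-+ q⁸0 _ _ ∷ [])


∘-identityʳ : ∀ f → f ∘ q ≈ f
∘-identityʳ f = below-all λ N → go N f
  where
  go : ∀ N f → (f ∘ q) ≈[ N ] f
  go zero    f = below-zero
  go (suc N) f = trans (weaken (∘-uncons q0 f)) (trans (+-congˡ (*-below-suc q q0 (go N (tail f)))) (weaken (sym (uncons f))))

∘-q-involutive : ∀ f → f ∘ (- q) ∘ (- q) ≈ f
∘-q-involutive f = trans (∘-∘ -q0 -q0 f) (trans (∘-congʳ f (trans (∘-neg -q0 q) (trans (-‿cong (q∘ -q0))
  (ring (q ∷ []) (λ q → :- (:- q) := q))))) (∘-identityʳ f))

²∘-q : ∀ f → f ² ∘ (- q) ≈ f ²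
²∘-q f = trans (∘-∘ q²0 -q0 f) (∘-congʳ f (trans (∘-^ -q0 q 2) (trans (^-congˡ 2 (q∘ -q0)) (ring (q ∷ []) (λ q → (:- q) :^ 2 := q :^ 2)))))

-- The factor 1 - q^m and its image under q ↦ -q multiply to 1 - q^{2m} for odd m and to (1 - q^m)² for even m.
poch-alternating : ∀ n → poch q q (twice n) * poch (- q) (- q) (twice n) * poch (q ^ 4) (q ^ 4) n
                         ≈ poch (q ^ 2) (q ^ 2) (twice n) * poch (q ^ 2) (q ^ 2) n ^ 2
poch-alternating zero    = ring [] (con 1ℤ :* con 1ℤ :* con 1ℤ := con 1ℤ :* con 1ℤ :^ 2)
poch-alternating (suc n) = linear
  (poch q q (twice n) ∷ poch (- q) (- q) (twice n) ∷ poch (q ^ 4) (q ^ 4) n ∷ poch (q ^ 2) (q ^ 2) (twice n) ∷ poch (q ^ 2) (q ^ 2) n ∷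
   poch q q (twice (suc n)) ∷ poch (- q) (- q) (twice (suc n)) ∷ poch (q ^ 4) (q ^ 4) (suc n) ∷ poch (q ^ 2) (q ^ 2) (twice (suc n)) ∷
   poch (q ^ 2) (q ^ 2) (suc n) ∷ q * (q ^ n) ^ 2 ∷ q ^ 2 * (q ^ n) ^ 2 ∷ [])
  (λ P N Q A B P′ N′ Q′ A′ B′ a b →
    let p = (con 1ℤ :- a) :* (con 1ℤ :- b) ; n = (con 1ℤ :+ a) :* (con 1ℤ :- b) ; c = con 1ℤ :- b :^ 2
        d = (con 1ℤ :- a :^ 2) :* (con 1ℤ :- b :^ 2) ; e = con 1ℤ :- b in
    (P′ :* N′ :* Q′ := A′ :* B′ :^ 2) ,
    (N′ :* Q′ , (P′ := P :* p)) ∷ (P :* p :* Q′ , (N′ := N :* n)) ∷ (P :* p :* N :* n , (Q′ := Q :* c)) ∷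
    (p :* n :* c , (P :* N :* Q := A :* B :^ 2)) ∷
    (:- (B′ :^ 2) , (A′ := A :* d)) ∷ (:- (A :* d) :* (B′ :+ B :* e) , (B′ := B :* e)) ∷ [])
  (linear (poch q q (twice n) ∷ q ∷ q ^ n ∷ q ^ twice n ∷ [])
     (λ P q v t → let a = q :* v :^ 2 ; b = q :^ 2 :* v :^ 2 in
       (P :* (con 1ℤ :- q :* t) :* (con 1ℤ :- q :* (q :* t)) := P :* ((con 1ℤ :- a) :* (con 1ℤ :- b))) ,
       (P :* (:- q :- q :^ 2 :+ q :^ 3 :* (t :+ v :^ 2)) , (t := v :^ 2)) ∷ [])
     (^-twice q n ∷ [])
   ∷ linear (poch (- q) (- q) (twice n) ∷ q ∷ q ^ n ∷ (- q) ^ twice n ∷ [])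
     (λ P q v t → let a = q :* v :^ 2 ; b = q :^ 2 :* v :^ 2 in
       (P :* (con 1ℤ :- :- q :* t) :* (con 1ℤ :- :- q :* (:- q :* t)) := P :* ((con 1ℤ :+ a) :* (con 1ℤ :- b))) ,
       (P :* (q :- q :^ 2 :- q :^ 3 :* (t :+ v :^ 2)) , (t := v :^ 2)) ∷ [])
     (trans (^-twice (- q) n) (trans (^-swap (- q) n 2) (trans (^-congˡ n (ring (q ∷ []) (λ q → (:- q) :^ 2 := q :^ 2))) (^-swap q 2 n))) ∷ [])
   ∷ linear (poch (q ^ 4) (q ^ 4) n ∷ q ∷ q ^ n ∷ (q ^ 4) ^ n ∷ [])
     (λ P q v t → (P :* (con 1ℤ :- q :^ 4 :* t) := P :* (con 1ℤ :- (q :^ 2 :* v :^ 2) :^ 2)) , (:- (P :* q :^ 4) , (t := v :^ 4)) ∷ [])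
     (^-swap q 4 n ∷ [])
   ∷ poch-alternating n
   ∷ linear (poch (q ^ 2) (q ^ 2) (twice n) ∷ q ∷ q ^ n ∷ (q ^ 2) ^ twice n ∷ (q ^ 2) ^ n ∷ [])
     (λ P q v t s → let a = q :* v :^ 2 ; b = q :^ 2 :* v :^ 2 ; c = P :* (:- (q :^ 2) :- q :^ 4 :+ q :^ 6 :* (t :+ v :^ 4)) in
       (P :* (con 1ℤ :- q :^ 2 :* t) :* (con 1ℤ :- q :^ 2 :* (q :^ 2 :* t)) := P :* ((con 1ℤ :- a :^ 2) :* (con 1ℤ :- b :^ 2))) ,
       (c , (t := s :^ 2)) ∷ (c :* (s :+ v :^ 2) , (s := v :^ 2)) ∷ [])
     (^-twice (q ^ 2) n ∷ ^-swap q 2 n ∷ [])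
   ∷ linear (poch (q ^ 2) (q ^ 2) n ∷ q ∷ q ^ n ∷ (q ^ 2) ^ n ∷ [])
     (λ P q v t → (P :* (con 1ℤ :- q :^ 2 :* t) := P :* (con 1ℤ :- q :^ 2 :* v :^ 2)) , (:- (P :* q :^ 2) , (t := v :^ 2)) ∷ [])
     (^-swap q 2 n ∷ []) ∷ [])

η-alternating : η₁ * η₁ ∘ (- q) * η₄ ≈ η₂ * η₂ ^ 2
η-alternating = below-all λ n → begin
  η₁ * η₁ ∘ (- q) * η₄
    ≈⟨ *-cong (*-cong (poch∞-below q0 q (n≤twice n)) (trans (∘-below-cong -q0 (poch∞-below q0 q (n≤twice n)))
         (weaken (trans (poch-∘ -q0 q q (twice n)) (poch-cong (q∘ -q0) (q∘ -q0) (twice n)))))) (poch∞-below q⁴0 (q ^ 4) ℕ.≤-refl) ⟩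
  poch q q (twice n) * poch (- q) (- q) (twice n) * poch (q ^ 4) (q ^ 4) n ≈⟨ weaken (poch-alternating n) ⟩
  poch (q ^ 2) (q ^ 2) (twice n) * poch (q ^ 2) (q ^ 2) n ^ 2
    ≈⟨ *-cong (poch∞-below q²0 (q ^ 2) (n≤twice n)) (*-cong approx (*-congʳ approx)) ⟨
  η₂ * η₂ ^ 2 ∎
  where
  approx : ∀ {n} → η₂ ≈[ n ] poch (q ^ 2) (q ^ 2) n
  approx = poch∞-below q²0 (q ^ 2) ℕ.≤-refl

eta-zeroth : ∀ u → u 0 ≡ 0ℤ → eta u 0 ≡ 1ℤ
eta-zeroth u u0 = poch-zeroth u u 1 u0

η₁-zeroth : η₁ 0 ≡ 1ℤ
η₁-zeroth = eta-zeroth q q0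

η₂-zeroth : η₂ 0 ≡ 1ℤ
η₂-zeroth = eta-zeroth (q ^ 2) q²0

η₄-zeroth : η₄ 0 ≡ 1ℤ
η₄-zeroth = eta-zeroth (q ^ 4) q⁴0

η₁² : η₁ ² ≈ η₂
η₁² = eta-q-∘ q²0

η₂² : η₂ ² ≈ η₄
η₂² = trans (eta-∘ q²0 q²0) (poch∞-cong (q^∘q^ 2 2) (q^∘q^ 2 2))

D²-η₄ : D ² * η₄ ≈ η₂ * η₂
D²-η₄ = begin
  D ² * η₄          ≈⟨ *-congˡ η₂² ⟨
  D ² * η₂ ²        ≈⟨ ∘-* q²0 D η₂ ⟨
  (D * η₂) ²        ≈⟨ ∘-cong q²0 Gauss-φ.gauss ⟩
  (η₁ * η₁) ²       ≈⟨ ∘-* q²0 η₁ η₁ ⟩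
  η₁ ² * η₁ ²       ≈⟨ *-cong η₁² η₁² ⟩
  η₂ * η₂           ∎

ψ²-η₂ : ψ ² * η₂ ≈ η₄ * η₄
ψ²-η₂ = begin
  ψ ² * η₂          ≈⟨ *-congˡ η₁² ⟨
  ψ ² * η₁ ²        ≈⟨ ∘-* q²0 ψ η₁ ⟨
  (ψ * η₁) ²        ≈⟨ ∘-cong q²0 Gauss-ψ.gauss ⟩
  (η₂ * η₂) ²       ≈⟨ ∘-* q²0 η₂ η₂ ⟩
  η₂ ² * η₂ ²       ≈⟨ *-cong η₂² η₂² ⟩
  η₄ * η₄           ∎

-- Replacing q by -q in Gauss's formula gives φ f₂ = f₁(-q)², and `η-alternating` eliminates f₁(-q).
φ-product : φ * η₁ ^ 2 * η₄ ^ 2 ≈ η₂ ^ 5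
φ-product = *-cancelˡ η₂ η₂-zeroth (linear (φ ∷ η₁ ∷ η₂ ∷ η₄ ∷ η₁ ∘ (- q) ∷ [])
  (λ φ f₁ f₂ f₄ n → (f₂ :* (φ :* f₁ :^ 2 :* f₄ :^ 2) := f₂ :* f₂ :^ 5) ,
    (f₁ :^ 2 :* f₄ :^ 2 , (φ :* f₂ := n :* n)) ∷ (f₁ :* n :* f₄ :+ f₂ :^ 3 , (f₁ :* n :* f₄ := f₂ :* f₂ :^ 2)) ∷ [])
  (φ-η₂ ∷ η-alternating ∷ []))
  where
  φ-η₂ : φ * η₂ ≈ η₁ ∘ (- q) * η₁ ∘ (- q)
  φ-η₂ = begin
    φ * η₂                       ≈⟨ *-cong (∘-q-involutive φ) (trans (∘-cong -q0 (sym η₁²)) (trans (²∘-q η₁) η₁²)) ⟨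
    D ∘ (- q) * η₂ ∘ (- q)       ≈⟨ ∘-* -q0 D η₂ ⟨
    (D * η₂) ∘ (- q)             ≈⟨ ∘-cong -q0 Gauss-φ.gauss ⟩
    (η₁ * η₁) ∘ (- q)            ≈⟨ ∘-* -q0 η₁ η₁ ⟩
    η₁ ∘ (- q) * η₁ ∘ (- q)      ∎

-- As eta quotients both sides are f₂⁴/f₄².
φ-D : φ * D ≈ D ² * D ²
φ-D = *-cancelˡ η₂ η₂-zeroth (*-cancelˡ η₄ η₄-zeroth (*-cancelˡ η₄ η₄-zeroth
  (linear (φ ∷ D ∷ D ² ∷ η₁ ∷ η₂ ∷ η₄ ∷ [])
    (λ φ D D₂ f₁ f₂ f₄ → (f₄ :* (f₄ :* (f₂ :* (φ :* D))) := f₄ :* (f₄ :* (f₂ :* (D₂ :* D₂)))) ,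
      (f₄ :^ 2 :* φ , (D :* f₂ := f₁ :* f₁)) ∷ (con 1ℤ , (φ :* f₁ :^ 2 :* f₄ :^ 2 := f₂ :^ 5)) ∷
      (:- f₂ :* (D₂ :* f₄ :+ f₂ :* f₂) , (D₂ :* f₄ := f₂ :* f₂)) ∷ [])
    (Gauss-φ.gauss ∷ φ-product ∷ D²-η₄ ∷ []))))

-- As eta quotients both sides are f₂⁴/f₁².
φ-ψ² : φ * ψ ² ≈ ψ * ψ
φ-ψ² = *-cancelˡ η₂ η₂-zeroth (*-cancelˡ η₁ η₁-zeroth (*-cancelˡ η₁ η₁-zeroth
  (linear (φ ∷ ψ ∷ ψ ² ∷ η₁ ∷ η₂ ∷ η₄ ∷ [])
    (λ φ ψ ψ₂ f₁ f₂ f₄ → (f₁ :* (f₁ :* (f₂ :* (φ :* ψ₂))) := f₁ :* (f₁ :* (f₂ :* (ψ :* ψ)))) ,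
      (f₁ :^ 2 :* φ , (ψ₂ :* f₂ := f₄ :* f₄)) ∷ (con 1ℤ , (φ :* f₁ :^ 2 :* f₄ :^ 2 := f₂ :^ 5)) ∷
      (:- f₂ :* (ψ :* f₁ :+ f₂ :* f₂) , (ψ :* f₁ := f₂ :* f₂)) ∷ [])
    (ψ²-η₂ ∷ φ-product ∷ Gauss-ψ.gauss ∷ []))))

X-² : X ≈ const (+ 2) * q * ψ ² ² ²
X-² = *-congˡ (sym (²-²-² ψ))

D-dissection : D ≈ E - X
D-dissection = begin
  φ ∘ (- q)                             ≈⟨ ∘-cong -q0 φ-dissection ⟩
  (E + X) ∘ (- q)                       ≈⟨ ∘-cong -q0 (+-cong (sym (²-² φ)) X-²) ⟩
  (φ ² ² + const (+ 2) * q * ψ ² ² ²) ∘ (- q)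
    ≈⟨ ∘-⟦⟧ -q0 (var zero :+ con (+ 2) :* var (suc zero) :* var (suc (suc zero))) (φ ² ² ∷ q ∷ ψ ² ² ² ∷ []) ⟩
  φ ² ² ∘ (- q) + const (+ 2) * q ∘ (- q) * ψ ² ² ² ∘ (- q)
    ≈⟨ +-cong (²∘-q (φ ²)) (*-cong (*-congˡ (q∘ -q0)) (²∘-q (ψ ² ²))) ⟩
  φ ² ² + const (+ 2) * (- q) * ψ ² ² ²
    ≈⟨ linear (φ ² ² ∷ E ∷ X ∷ q ∷ ψ ² ² ² ∷ []) (λ P E X q Y → (P :+ con (+ 2) :* (:- q) :* Y := E :- X) ,
         (con 1ℤ , (P := E)) ∷ (con 1ℤ , (X := con (+ 2) :* q :* Y)) ∷ []) (²-² φ ∷ X-² ∷ []) ⟩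
  E - X                                 ∎

E²-X² : E ^ 2 - X ^ 2 ≈ D ² ^ 2
E²-X² = linear (E ∷ X ∷ φ ∷ D ∷ D ² ∷ [])
  (λ E X φ D D₂ → (E :^ 2 :- X :^ 2 := D₂ :^ 2) ,
    (:- D , (φ := E :+ X)) ∷ (:- (E :+ X) , (D := E :- X)) ∷ (con 1ℤ , (φ :* D := D₂ :* D₂)) ∷ [])
  (φ-dissection ∷ D-dissection ∷ φ-D ∷ [])

-- All terms of `E²-X²` are series in q², since X enters squared. Undoing the substitution q ↦ q²
-- gives the dissection of the square of D.
D-squared : φ ² ^ 2 - const (+ 4) * q * ψ ² ² ^ 2 ≈ D ^ 2
D-squared = ∘^-injective 2 (begin
  (φ ² ^ 2 - const (+ 4) * q * ψ ² ² ^ 2) ²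
    ≈⟨ ∘-⟦⟧ q²0 (var zero :^ 2 :- con (+ 4) :* var (suc zero) :* var (suc (suc zero)) :^ 2) (φ ² ∷ q ∷ ψ ² ² ∷ []) ⟩
  φ ² ² ^ 2 - const (+ 4) * q ² * ψ ² ² ² ^ 2
    ≈⟨ linear (φ ² ² ∷ q ² ∷ q ∷ ψ ² ² ² ∷ E ∷ X ∷ D ² ∷ [])
        (λ P q₂ q Y E X D₂ → (P :^ 2 :- con (+ 4) :* q₂ :* Y :^ 2 := D₂ :^ 2) ,
          (con 1ℤ , (E :^ 2 :- X :^ 2 := D₂ :^ 2)) ∷ (P :+ E , (P := E)) ∷ (:- (con (+ 4) :* Y :^ 2) , (q₂ := q :^ 2)) ∷
          (X :+ con (+ 2) :* q :* Y , (X := con (+ 2) :* q :* Y)) ∷ [])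
        (E²-X² ∷ ²-² φ ∷ q∘ q²0 ∷ X-² ∷ []) ⟩
  D ² ^ 2 ≈⟨ ∘-^ q²0 D 2 ⟨
  (D ^ 2) ² ∎)

-- The image of `D-squared` under q ↦ -q.
φ-squared : φ ² ^ 2 + const (+ 4) * q * ψ ² ² ^ 2 ≈ φ ^ 2
φ-squared = begin
  φ ² ^ 2 + const (+ 4) * q * ψ ² ² ^ 2
    ≈⟨ linear (φ ² ∷ φ ² ∘ (- q) ∷ q ∷ q ∘ (- q) ∷ ψ ² ² ∷ ψ ² ² ∘ (- q) ∷ [])
        (λ P P′ q q′ Y Y′ → (P :^ 2 :+ con (+ 4) :* q :* Y :^ 2 := P′ :^ 2 :- con (+ 4) :* q′ :* Y′ :^ 2) ,
          (:- (P :+ P′) , (P′ := P)) ∷ (con (+ 4) :* q′ :* (Y :+ Y′) , (Y′ := Y)) ∷ (con (+ 4) :* Y :^ 2 , (q′ := :- q)) ∷ [])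
        (²∘-q φ ∷ ²∘-q (ψ ²) ∷ q∘ -q0 ∷ []) ⟩
  (φ ² ∘ (- q)) ^ 2 - const (+ 4) * q ∘ (- q) * (ψ ² ² ∘ (- q)) ^ 2
    ≈⟨ ∘-⟦⟧ -q0 (var zero :^ 2 :- con (+ 4) :* var (suc zero) :* var (suc (suc zero)) :^ 2) (φ ² ∷ q ∷ ψ ² ² ∷ []) ⟨
  (φ ² ^ 2 - const (+ 4) * q * ψ ² ² ^ 2) ∘ (- q)  ≈⟨ ∘-cong -q0 D-squared ⟩
  (D ^ 2) ∘ (- q)                                   ≈⟨ trans (∘-^ -q0 D 2) (^-congˡ 2 (∘-q-involutive φ)) ⟩
  φ ^ 2                                             ∎

E²+X² : E ^ 2 + X ^ 2 ≈ φ ² ^ 2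
E²+X² = begin
  E ^ 2 + X ^ 2
    ≈⟨ linear (φ ² ² ∷ q ² ∷ q ∷ ψ ² ² ² ∷ E ∷ X ∷ [])
        (λ P q₂ q Y E X → (E :^ 2 :+ X :^ 2 := P :^ 2 :+ con (+ 4) :* q₂ :* Y :^ 2) ,
          (:- (P :+ E) , (P := E)) ∷ (:- (con (+ 4) :* Y :^ 2) , (q₂ := q :^ 2)) ∷
          (X :+ con (+ 2) :* q :* Y , (X := con (+ 2) :* q :* Y)) ∷ [])
        (²-² φ ∷ q∘ q²0 ∷ X-² ∷ []) ⟩
  φ ² ² ^ 2 + const (+ 4) * q ² * ψ ² ² ² ^ 2
    ≈⟨ ∘-⟦⟧ q²0 (var zero :^ 2 :+ con (+ 4) :* var (suc zero) :* var (suc (suc zero)) :^ 2) (φ ² ∷ q ∷ ψ ² ² ∷ []) ⟨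
  (φ ² ^ 2 + const (+ 4) * q * ψ ² ² ^ 2) ²         ≈⟨ ∘-cong q²0 φ-squared ⟩
  (φ ^ 2) ²                                         ≈⟨ ∘-^ q²0 φ 2 ⟩
  φ ² ^ 2                                           ∎

E-X : E * X ≈ const (+ 2) * q * ψ ² ² ^ 2
E-X = linear (φ ² ² ∷ q ∷ ψ ² ² ∷ ψ ² ² ² ∷ E ∷ X ∷ [])
  (λ P q Y Y₂ E X → (E :* X := con (+ 2) :* q :* Y :^ 2) ,
    (:- X , (P := E)) ∷ (P , (X := con (+ 2) :* q :* Y₂)) ∷ (con (+ 2) :* q , (P :* Y₂ := Y :* Y)) ∷ [])
  (²-² φ ∷ X-²
   ∷ trans (sym (trans (∘-cong q²0 (∘-* q²0 φ (ψ ²))) (∘-* q²0 _ _)))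
       (trans (∘-cong q²0 (∘-cong q²0 φ-ψ²)) (trans (∘-cong q²0 (∘-* q²0 ψ ψ)) (∘-* q²0 _ _))) ∷ [])


-- Congruences modulo 3 and 9

module Mod3 = Modulo (mod 3)
module Mod9 = Modulo (mod 9)

infix 4 _≡₃_ _≡₉_
_≡₃_ _≡₉_ : PS → PS → Set
_≡₃_ = Eq (mod 3)
_≡₉_ = Eq (mod 9)

private
  *-distribˡ-minus : ∀ a b → + 3 ℤ.* (a ℤ.- b) ≡ + 3 ℤ.* a ℤ.- + 3 ℤ.* b
  *-distribˡ-minus = solve-∀

-- This and its converse `untriple` allow S, which always carries a factor 3, to be treated modulo 3
-- inside congruences modulo 9.
triple : ∀ {f g} → f ≡₃ g → const (+ 3) * f ≡₉ const (+ 3) * g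
triple {f} {g} e = mk λ n i → subst (+ 9 ∣′_)
  (≡.trans (*-distribˡ-minus (f n) (g n)) (≡.sym (cong₂ ℤ._-_ (const-*-at (+ 3) f n) (const-*-at (+ 3) g n))))
  (∣.*-monoʳ-∣ (+ 3) (at e n i))

untriple : ∀ {f g} → const (+ 3) * f ≡₉ const (+ 3) * g → f ≡₃ g
untriple {f} {g} e = mk λ n i → ∣.*-cancelˡ-∣ (+ 3) (subst (+ 9 ∣′_)
  (≡.sym (≡.trans (*-distribˡ-minus (f n) (g n)) (≡.sym (cong₂ ℤ._-_ (const-*-at (+ 3) f n) (const-*-at (+ 3) g n))))) (at e n i))

mod-∘-cong : ∀ {m u f g} → u 0 ≡ 0ℤ → Eq (mod m) f g → Eq (mod m) (f ∘ u) (g ∘ u)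
mod-∘-cong {m} {u} u0 e = mk λ n _ → at (go (suc n) e) n tt
  where
  go : ∀ N {f g} → Eq (mod m) f g → Eq (mod m) (partialCompose u N f) (partialCompose u N g)
  go zero    e = refl
  go (suc N) {f} {g} e = +-cong (const-∣ (mod m) (f 0) (g 0) (at e 0 tt)) (*-congˡ (go N (mk λ n _ → at e (suc n) tt)))

q³0 : (q ^ 3) 0 ≡ 0ℤ
q³0 = ^-zeroth q 2 q0

∘^-comm : ∀ m n .{{_ : ℕ.NonZero m}} .{{_ : ℕ.NonZero n}} f → f ∘ q ^ m ∘ q ^ n ≈ f ∘ q ^ n ∘ q ^ m
∘^-comm m n f = trans (∘-∘ (^-zeroth′ m) (^-zeroth′ n) f) (trans (∘-congʳ f (trans (q^∘q^ m n)
  (trans (≡⇒≈ (cong (q ^_) (ℕ.*-comm n m))) (sym (q^∘q^ n m))))) (sym (∘-∘ (^-zeroth′ n) (^-zeroth′ m) f)))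

infix 10 _³
_³ : PS → PS
f ³ = f ∘ q ^ 3

η₃ : PS
η₃ = eta (q ^ 3)

poch-cube : ∀ n → poch q q n ^ 3 ≡₃ poch (q ^ 3) (q ^ 3) n
poch-cube zero    = weaken (ring [] (con 1ℤ :^ 3 := con 1ℤ))
poch-cube (suc n) = Mod3.linear (poch q q n ∷ poch (q ^ 3) (q ^ 3) n ∷ q ∷ q ^ n ∷ (q ^ 3) ^ n ∷ [])
  (λ P Q q v w → ((P :* (con 1ℤ :- q :* v)) :^ 3 := Q :* (con 1ℤ :- q :^ 3 :* w)) ,
    ((con 1ℤ :- q :^ 3 :* v :^ 3) , (P :^ 3 := Q)) ∷
    (Q :* q :^ 3 , (w := v :^ 3)) ∷ [])
  (poch-cube n ∷ weaken (^-swap q 3 n) ∷ [])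

mod-limit : ∀ {m f g} (F G : ℕ → PS) → (∀ N → f ≈[ N ] F N) → (∀ N → g ≈[ N ] G N) →
            (∀ N → Eq (mod m) (F N) (G N)) → Eq (mod m) f g
mod-limit {m} F G f≈F g≈G e = mk λ n i → subst (+ m ∣′_)
  (≡.sym (cong₂ ℤ._-_ (coeff< (f≈F (suc n)) n ℕ.≤-refl) (coeff< (g≈G (suc n)) n ℕ.≤-refl))) (at (e (suc n)) n i)

η₁-cube : η₁ ^ 3 ≡₃ η₃
η₁-cube = mod-limit (λ n → poch q q n ^ 3) (poch (q ^ 3) (q ^ 3))
  (λ n → let e = poch∞-below q0 q ℕ.≤-refl in *-cong e (*-cong e (*-cong e refl)))
  (λ n → poch∞-below q³0 (q ^ 3) ℕ.≤-refl) poch-cube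

mod-difference : ∀ {m f g} → Eq (mod m) f g → Σ PS λ h → f ≈ g + const (+ m) * h
mod-difference {m} {f} {g} e = h , ≐⇒Eq λ n → ≡.sym (≡.trans (+-at g (const (+ m) * h) n)
    (≡.trans (cong (λ z → g n ℤ.+ z) (≡.trans (const-*-at (+ m) h n)
      (≡.trans (ℤ.*-comm (+ m) (h n)) (≡.sym (_∣′_.equality (at e n tt)))))) (lem (f n) (g n))))
  where
  h : PS
  h n = _∣′_.quotient (at e n tt)
  lem : ∀ a b → b ℤ.+ (a ℤ.- b) ≡ a
  lem = solve-∀

η₃-zeroth : η₃ 0 ≡ 1ℤ
η₃-zeroth = eta-zeroth (q ^ 3) q³0

opaque
  -- This is (η₃ - η₁³)/(3η₃), with η₁³ the cube: `mod-difference` supplies the quotient by 3.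
  -- Dividing by η₃ as well makes f₁³/f₃ equal to 1 - 3S.
  S : PS
  S = proj₁ (mod-difference (sym η₁-cube)) * inv η₃

  η₁-cube-S : η₁ ^ 3 ≈ η₃ * (1# - const (+ 3) * S)
  η₁-cube-S = let (g , e) = mod-difference (sym η₁-cube) in
    linear (η₁ ∷ η₃ ∷ g ∷ inv η₃ ∷ []) (λ f₁ f₃ g i → (f₁ :^ 3 := f₃ :* (con 1ℤ :- con (+ 3) :* (g :* i))) ,
      (con -1ℤ , (f₃ := f₁ :^ 3 :+ con (+ 3) :* g)) ∷ (con (+ 3) :* g , (f₃ :* i := con 1ℤ)) ∷ [])
    (e ∷ *-inv η₃ η₃-zeroth ∷ [])

-- In every use B is A(q³), so that s measures the failure of A(q)³ ≡ A(q³) modulo 9.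
Cubes : PS → PS → PS → Set
Cubes A B s = A ^ 3 ≡₉ B * (1# + const (+ 3) * s)

-- The third argument of `Cubes` behaves like a logarithm, because factors 1 + 3s multiply modulo 9
-- by adding their s. Hence a²/b receives 2s - t, and each theta function needed here has the shape
-- a²/b.
Cubes-quotient : ∀ {A A₃ a a₃ b b₃ s t} → b₃ 0 ≡ 1ℤ → A * b ≡₉ a ^ 2 → A₃ * b₃ ≡₉ a₃ ^ 2 →
                 Cubes a a₃ s → Cubes b b₃ t → Cubes A A₃ (const (+ 2) * s - t)
Cubes-quotient {A} {A₃} {a} {a₃} {b} {b₃} {s} {t} b₃0 e e₃ cs ct = *-cancelˡ b₃ b₃0
  (Mod9.linear (A ∷ A₃ ∷ a ∷ a₃ ∷ b ∷ b₃ ∷ s ∷ t ∷ [])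
    (λ A A₃ a a₃ b b₃ s t →
      -- `v⁻¹` inverts `v` modulo 9, where (3t)² vanishes.
      let u = con 1ℤ :+ con (+ 3) :* s ; v = con 1ℤ :+ con (+ 3) :* t ; v⁻¹ = con 1ℤ :- con (+ 3) :* t in
      (b₃ :* A :^ 3 := b₃ :* (A₃ :* (con 1ℤ :+ con (+ 3) :* (con (+ 2) :* s :- t)))) ,
      (:- (v⁻¹ :* A :^ 3) , (b :^ 3 := b₃ :* v)) ∷
      (v⁻¹ :* ((A :* b) :^ 2 :+ A :* b :* a :^ 2 :+ a :^ 4) , (A :* b := a :^ 2)) ∷
      (v⁻¹ :* (a :^ 3 :+ a₃ :* u) , (a :^ 3 := a₃ :* u)) ∷
      (:- (v⁻¹ :* u :^ 2) , (A₃ :* b₃ := a₃ :^ 2)) ∷ [])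
    (ct ∷ e ∷ cs ∷ e₃ ∷ []))

Cubes-∘ : ∀ {u A B s} → u 0 ≡ 0ℤ → Cubes A B s → Cubes (A ∘ u) (B ∘ u) (s ∘ u)
Cubes-∘ {u} {A} {B} {s} u0 c = trans (weaken (sym (∘-^ u0 A 3))) (trans (mod-∘-cong u0 c)
  (weaken (∘-⟦⟧ u0 (var zero :* (con 1ℤ :+ con (+ 3) :* var (suc zero))) (B ∷ s ∷ []))))

Cubes-cong : ∀ {A A′ B B′ s s′} → A ≈ A′ → B ≈ B′ → s ≈ s′ → Cubes A B s → Cubes A′ B′ s′
Cubes-cong a b c e = trans (weaken (sym (^-congˡ 3 a))) (trans e (weaken (*-cong b (+-congˡ (*-congˡ c)))))

³-* : ∀ A b a → A * b ≈ a * a → A ³ * b ³ ≡₉ a ³ ^ 2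
³-* A b a e = weaken (trans (sym (∘-* q³0 A b)) (trans (∘-cong q³0 e) (trans (∘-* q³0 a a) (ring (a ³ ∷ []) (λ a → a :* a := a :^ 2)))))

square : ∀ A b a → A * b ≈ a * a → A * b ≡₉ a ^ 2
square A b a e = weaken (trans e (ring (a ∷ []) (λ a → a :* a := a :^ 2)))

Cubes-η₁ : Cubes η₁ (η₁ ³) (- S)
Cubes-η₁ = trans (weaken η₁-cube-S) (weaken (linear (η₁ ³ ∷ η₃ ∷ S ∷ [])
  (λ f₁ f₃ s → (f₃ :* (con 1ℤ :- con (+ 3) :* s) := f₁ :* (con 1ℤ :+ con (+ 3) :* (:- s))) ,
    (:- (con 1ℤ :- con (+ 3) :* s) , (f₁ := f₃)) ∷ []) (eta-q-∘ q³0 ∷ [])))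

Cubes-² : ∀ {A s} → Cubes A (A ³) s → Cubes (A ²) (A ² ³) (s ²)
Cubes-² {A} c = Cubes-cong refl (∘^-comm 3 2 A) refl (Cubes-∘ q²0 c)

Cubes-η₂ : Cubes η₂ (η₂ ³) (- S ²)
Cubes-η₂ = Cubes-cong η₁² (∘-cong q³0 η₁²) (∘-neg q²0 S) (Cubes-² Cubes-η₁)

³-zeroth : ∀ f → f 0 ≡ 1ℤ → (f ³) 0 ≡ 1ℤ
³-zeroth f f0 = ≡.trans (∘-zeroth q³0 f) f0

Cubes-D : Cubes D (D ³) (S ² - const (+ 2) * S)
Cubes-D = Cubes-cong refl refl (ring (S ∷ S ² ∷ []) (λ s t → con (+ 2) :* (:- s) :- (:- t) := t :- con (+ 2) :* s))
  (Cubes-quotient (³-zeroth η₂ η₂-zeroth) (square D η₂ η₁ Gauss-φ.gauss) (³-* D η₂ η₁ Gauss-φ.gauss) Cubes-η₁ Cubes-η₂)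

Cubes-ψ : Cubes ψ (ψ ³) (S - const (+ 2) * S ²)
Cubes-ψ = Cubes-cong refl refl (ring (S ∷ S ² ∷ []) (λ s t → con (+ 2) :* (:- t) :- (:- s) := s :- con (+ 2) :* t))
  (Cubes-quotient (³-zeroth η₁ η₁-zeroth) (square ψ η₁ η₂ Gauss-ψ.gauss) (³-* ψ η₁ η₂ Gauss-ψ.gauss) Cubes-η₂ Cubes-η₁)

opaque
  unfolding _⊕_
  φ-zeroth : φ 0 ≡ 1ℤ
  φ-zeroth = cong (λ z → 1ℤ ℤ.+ + 2 ℤ.* (0ℤ ℤ.+ z)) (^-zeroth q 0 q0)

D-zeroth : D 0 ≡ 1ℤ
D-zeroth = ≡.trans (∘-zeroth -q0 φ) φ-zeroth

-- By `φ-D`, φ is the square of D(q²) divided by D, so the rule for a²/b applies once more.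
Cubes-φ : Cubes φ (φ ³) (const (+ 2) * S - const (+ 5) * S ² + const (+ 2) * S ² ²)
Cubes-φ = Cubes-cong refl refl
  (linear (S ∷ S ² ∷ S ² ² ∷ (S ² - const (+ 2) * S) ² ∷ [])
    (λ s t u x → (con (+ 2) :* x :- (t :- con (+ 2) :* s) := con (+ 2) :* s :- con (+ 5) :* t :+ con (+ 2) :* u) ,
      (con (+ 2) , (x := u :- con (+ 2) :* t)) ∷ [])
    (∘-⟦⟧ q²0 (var zero :- con (+ 2) :* var (suc zero)) (S ² ∷ S ∷ []) ∷ []))
  (Cubes-quotient (³-zeroth D D-zeroth) (square φ D (D ²) φ-D) (³-* φ D (D ²) φ-D) (Cubes-² Cubes-D) Cubes-D)

S₄ S₈ S₁₆ : PS
S₄  = S ² ²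
S₈  = S ² ² ²
S₁₆ = S ² ² ² ²

Cubes-E : Cubes E (E ³) (const (+ 2) * S₄ - const (+ 5) * S₈ + const (+ 2) * S₁₆)
Cubes-E = Cubes-cong (²-² φ) (∘-cong q³0 (²-² φ))
  (trans (∘-cong q²0 (∘-⟦⟧ q²0 e (S ∷ S ² ∷ S ² ² ∷ []))) (∘-⟦⟧ q²0 e (S ² ∷ S ² ² ∷ S ² ² ² ∷ [])))
  (Cubes-² (Cubes-² Cubes-φ))
  where
  e : Polynomial 3
  e = con (+ 2) :* var zero :- con (+ 5) :* var (suc zero) :+ con (+ 2) :* var (suc (suc zero))

Cubes-ψ₈ : Cubes (ψ ² ² ²) (ψ ² ² ² ³) (S₈ - const (+ 2) * S₁₆)
Cubes-ψ₈ = Cubes-cong refl refl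
  (trans (∘-cong q²0 (trans (∘-cong q²0 (∘-⟦⟧ q²0 e (S ∷ S ² ∷ []))) (∘-⟦⟧ q²0 e (S ² ∷ S ² ² ∷ [])))) (∘-⟦⟧ q²0 e (S ² ² ∷ S ² ² ² ∷ [])))
  (Cubes-² (Cubes-² (Cubes-² Cubes-ψ)))
  where
  e : Polynomial 2
  e = var zero :- con (+ 2) :* var (suc zero)

-- The factor 4 appears because cubing turns the coefficient 2 of X into 8 = 4 · 2, while
-- substituting q³ leaves it at 2.
X-cube : X ^ 3 ≡₉ const (+ 4) * X ³ * (1# + const (+ 3) * (S₈ - const (+ 2) * S₁₆))
X-cube = Mod9.linear (X ∷ X ³ ∷ q ∷ ψ ² ² ² ∷ ψ ² ² ² ³ ∷ S₈ - const (+ 2) * S₁₆ ∷ [])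
  (λ X X₃ q Y Y₃ x → let Z = con (+ 2) :* q :* Y ; u = con 1ℤ :+ con (+ 3) :* x in
    (X :^ 3 := con (+ 4) :* X₃ :* u) ,
    (X :^ 2 :+ X :* Z :+ Z :^ 2 , (X := Z)) ∷
    (con (+ 8) :* q :^ 3 , (Y :^ 3 := Y₃ :* u)) ∷
    (:- (con (+ 4) :* u) , (X₃ := con (+ 2) :* q :^ 3 :* Y₃)) ∷ [])
  (weaken X-²
   ∷ Cubes-ψ₈
   ∷ weaken (trans (∘-cong q³0 X-²) (trans (∘-⟦⟧ q³0 (con (+ 2) :* var zero :* var (suc zero)) (q ∷ ψ ² ² ² ∷ []))
       (*-congʳ (*-congˡ (q∘ q³0))))) ∷ [])

-- Each term of D(q³) = E(q³) - X(q³) is replaced by a cube through `Cubes`. The difference of the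
-- two sides is then 3 times a polynomial, and dividing by 3 leaves this congruence, arranged so
-- that S occurs only in differences of its values at q^j and q^(4j).
S-functional : (E - X) ^ 3 * (S + S ² - S₄ - S₈) ≡₃ (S₄ - S₁₆) * (E ^ 3 + X ^ 3) - X ^ 3 - E * X * (E - X)
S-functional = untriple (Mod9.linear (E ∷ X ∷ E ³ ∷ X ³ ∷ S ∷ S ² ∷ S₄ ∷ S₈ ∷ S₁₆ ∷ [])
  (λ E X E₃ X₃ s s₂ s₄ s₈ s₁₆ →
    let c = con (+ 3)
        t = s₂ :- con (+ 2) :* s
        e = con (+ 2) :* s₄ :- con (+ 5) :* s₈ :+ con (+ 2) :* s₁₆
        x = s₈ :- con (+ 2) :* s₁₆
        u = con 1ℤ :+ c :* t in
    (c :* ((E :- X) :^ 3 :* (s :+ s₂ :- s₄ :- s₈)) := c :* ((s₄ :- s₁₆) :* (E :^ 3 :+ X :^ 3) :- X :^ 3 :- E :* X :* (E :- X))) ,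
    (con -1ℤ , ((E :- X) :^ 3 := (E₃ :- X₃) :* u)) ∷
    (u :* (con 1ℤ :- c :* e) , (E :^ 3 := E₃ :* (con 1ℤ :+ c :* e))) ∷
    -- Since 4 · 7 ≡ 1 modulo 9, this cofactor solves `X-cube` for `X ³`.
    (:- (con (+ 7) :* u :* (con 1ℤ :- c :* x)) , (X :^ 3 := con (+ 4) :* X₃ :* (con 1ℤ :+ c :* x))) ∷ [])
  (Cubes-cong D-dissection (trans (∘-cong q³0 D-dissection) (∘-⟦⟧ q³0 (var zero :- var (suc zero)) (E ∷ X ∷ []))) refl Cubes-D
   ∷ Cubes-E ∷ X-cube ∷ []))


-- Uniqueness for functional equations and the dissection of `S`

modBelow : ℕ → ℕ → Precision
modBelow m N = record { modulus = m ; Index = _< N ; down = ℕ.≤-<-trans }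

restrict : ∀ {m f g} N → Eq (mod m) f g → Eq (modBelow m N) f g
restrict N e = mk λ n _ → at e n tt

opaque
  unfolding _⊕_
  0#-at : ∀ n → 0# n ≡ 0ℤ
  0#-at zero    = ≡.refl
  0#-at (suc n) = ≡.refl

module _ {m : ℕ} {d : PS} (d0 : + m ∣′ d 0) where

  -- Substituting q^k with k ≥ 2 is contracting: the coefficient at jk comes from the index j, which
  -- is smaller than jk unless j = 0, and that case is covered by `d0`.
  ∘^-contracts : ∀ N k → 2 ≤ k → Eq (modBelow m N) d 0# → Eq (modBelow m (suc N)) (d ∘ q ^ k) 0#
  ∘^-contracts N k@(suc k-1) 2≤k e = mk λ i i≤N → subst (+ m ∣′_)
    (≡.sym (≡.trans (cong (λ z → (d ∘ q ^ k) i ℤ.- z) (0#-at i)) (ℤ.+-identityʳ _)))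
    (divisible (i % k) (i / k) (m%n<n i k) (m≡m%n+[m/n]*n i k) i≤N)
    where
    at0 : ∀ j → j < N → + m ∣′ d j
    at0 j j<N = subst (+ m ∣′_) (≡.trans (cong (λ z → d j ℤ.- z) (0#-at j)) (ℤ.+-identityʳ (d j))) (at e j j<N)
    divisible : ∀ r j {i} → r < k → i ≡ r ℕ.+ j ℕ.* k → i < suc N → + m ∣′ (d ∘ q ^ k) i
    divisible zero zero    _ ≡.refl _ = subst (+ m ∣′_) (≡.sym (∘^-multiple k d 0)) d0
    divisible zero (suc j) _ ≡.refl (s≤s i≤N) = subst (+ m ∣′_) (≡.sym (∘^-multiple k d (suc j)))
      (at0 (suc j) (ℕ.<-≤-trans (ℕ.m<m*n (suc j) k 2≤k) i≤N))
    divisible (suc r) j r<k ≡.refl _ = subst (+ m ∣′_) (≡.sym (∘^-gap k d j r<k)) (divides′ 0ℤ (≡.sym (ℤ.*-zeroˡ (+ m))))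

  -- For n > 0 the coefficient of qⁿ on the right of the equation involves only coefficients of d below n.
  functional-zero : ∀ {a b} j k → 2 ≤ j → 2 ≤ k → Eq (mod m) d (a * d ∘ q ^ j + b * d ∘ q ^ k) → Eq (mod m) d 0#
  functional-zero {a} {b} j k 2≤j 2≤k e = mk λ n _ → at (go (suc n)) n ℕ.≤-refl
    where
    go : ∀ N → Eq (modBelow m N) d 0#
    go zero    = mk λ _ ()
    go (suc N) = trans (restrict (suc N) e) (trans
      (+-cong (*-congˡ (∘^-contracts N j 2≤j (go N))) (*-congˡ (∘^-contracts N k 2≤k (go N))))
      (weaken (ring (a ∷ b ∷ []) (λ a b → a :* con 0ℤ :+ b :* con 0ℤ := con 0ℤ))))

-- The candidate for S - S(q⁴) modulo 3. Its values at q, q² and q⁴ are polynomials in E and X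
-- modulo 3.
W : PS
W = q * ψ ² ^ 4

-- Exactly, E X = 2qψ(q⁴)² and E² + X² = φ(q²)² multiply to 2W by `φ-ψ²`, and -2 ≡ 1 modulo 3.
W-E-X : W ≡₃ - (E * X * (E ^ 2 + X ^ 2))
W-E-X = Mod3.linear (E ∷ X ∷ φ ² ∷ ψ ² ∷ ψ ² ² ∷ q ∷ [])
  (λ E X P Y Y₂ q → (q :* Y :^ 4 := :- (E :* X :* (E :^ 2 :+ X :^ 2))) ,
    (E :^ 2 :+ X :^ 2 , (E :* X := con (+ 2) :* q :* Y₂ :^ 2)) ∷
    (con (+ 2) :* q :* Y₂ :^ 2 , (E :^ 2 :+ X :^ 2 := P :^ 2)) ∷
    (con (+ 2) :* q :* (P :* Y₂ :+ Y :* Y) , (P :* Y₂ := Y :* Y)) ∷ [])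
  (weaken E-X ∷ weaken E²+X²
   ∷ weaken (trans (sym (∘-* q²0 φ (ψ ²))) (trans (∘-cong q²0 φ-ψ²) (∘-* q²0 ψ ψ))) ∷ [])

W-∘ : ∀ k .{{_ : ℕ.NonZero k}} → W ∘ q ^ k ≈ q ^ k * (ψ ² ∘ q ^ k) ^ 4
W-∘ k = trans (∘-⟦⟧ (^-zeroth′ k) (var zero :* var (suc zero) :^ 4) (q ∷ ψ ² ∷ [])) (*-congʳ (q∘ (^-zeroth′ k)))

W² : W ² ≡₃ E ^ 2 * X ^ 2
W² = Mod3.linear (E ∷ X ∷ ψ ² ² ∷ q ∷ W ² ∷ [])
  (λ E X Y q w → (w := E :^ 2 :* X :^ 2) ,
    (con 1ℤ , (w := q :^ 2 :* Y :^ 4)) ∷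
    (:- (E :* X :+ con (+ 2) :* q :* Y :^ 2) , (E :* X := con (+ 2) :* q :* Y :^ 2)) ∷ [])
  (weaken (W-∘ 2) ∷ weaken E-X ∷ [])

W₄ : W ² ² ≡₃ X ^ 4
W₄ = Mod3.linear (X ∷ ψ ² ² ² ∷ q ∷ W ² ² ∷ ψ ² ∘ q ^ 4 ∷ [])
  (λ X Y q w Y′ → let Z = con (+ 2) :* q :* Y in
    (w := X :^ 4) ,
    (con 1ℤ , (w := q :^ 4 :* Y′ :^ 4)) ∷
    (q :^ 4 :* (Y′ :^ 2 :+ Y :^ 2) :* (Y′ :+ Y) , (Y′ := Y)) ∷
    (:- ((X :^ 2 :+ Z :^ 2) :* (X :+ Z)) , (X := Z)) ∷ [])
  (weaken (trans (²-² W) (W-∘ 4)) ∷ weaken (sym (²-² (ψ ²))) ∷ weaken X-² ∷ [])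

2≤2 : 2 ≤ 2
2≤2 = s≤s (s≤s z≤n)

2≤4 : 2 ≤ 4
2≤4 = s≤s (s≤s z≤n)

W-zeroth : W 0 ≡ 0ℤ
W-zeroth = *-zerothˡ q _ q0

∣-zero : ∀ {m a} → a ≡ 0ℤ → + m ∣′ a
∣-zero {m} ≡.refl = divides′ 0ℤ (≡.sym (ℤ.*-zeroˡ (+ m)))

opaque
  unfolding _⊕_

  φ⁴+W-1-zeroth : (φ ^ 4 + W - 1#) 0 ≡ 0ℤ
  φ⁴+W-1-zeroth = cong₂ (λ a b → a ℤ.* (a ℤ.* (a ℤ.* (a ℤ.* 1ℤ))) ℤ.+ b ℤ.- 1ℤ) φ-zeroth W-zeroth

  S-S₄-W-zeroth : (S - S₄ - W) 0 ≡ 0ℤ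
  S-S₄-W-zeroth = ≡.trans (cong₂ (λ a b → S 0 ℤ.- a ℤ.- b) (≡.trans (∘-zeroth {q ^ 2} q²0 (S ²)) (∘-zeroth {q ^ 2} q²0 S)) W-zeroth)
    (≡.trans (ℤ.+-identityʳ _) (ℤ.+-inverseʳ (S 0)))

-- Modulo 3 the fourth power of E + X is E⁴ + X⁴ + E X (E² + X²), whose last term W cancels. So φ⁴ +
-- W is congruent to E⁴ + X⁴, its own value at q⁴, and equals its constant term.
φ⁴+W≡₃1 : φ ^ 4 + W - 1# ≡₃ 0#
φ⁴+W≡₃1 = functional-zero (∣-zero φ⁴+W-1-zeroth) 4 4 2≤4 2≤4
  (Mod3.linear (φ ∷ W ∷ E ∷ X ∷ W ² ² ∷ (φ ^ 4 + W - 1#) ∘ q ^ 4 ∷ [])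
    (λ φ W E X W₄ d → (φ :^ 4 :+ W :- con 1ℤ := con 1ℤ :* d :+ con 0ℤ :* d) ,
      ((φ :^ 2 :+ (E :+ X) :^ 2) :* (φ :+ (E :+ X)) , (φ := E :+ X)) ∷
      (con 1ℤ , (W := :- (E :* X :* (E :^ 2 :+ X :^ 2)))) ∷
      (con -1ℤ , (d := E :^ 4 :+ W₄ :- con 1ℤ)) ∷
      (con -1ℤ , (W₄ := X :^ 4)) ∷ [])
    (weaken φ-dissection ∷ W-E-X
     ∷ weaken (trans (∘-⟦⟧ q⁴0 (var zero :^ 4 :+ var (suc zero) :- con 1ℤ) (φ ∷ W ∷ [])) (+-congʳ (+-congˡ (sym (²-² W)))))
     ∷ W₄ ∷ []))

E⁴+X⁴ : E ^ 4 + X ^ 4 ≡₃ 1#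
E⁴+X⁴ = Mod3.linear (φ ∷ W ∷ E ∷ X ∷ [])
  (λ φ W E X → (E :^ 4 :+ X :^ 4 := con 1ℤ) ,
    (:- ((φ :^ 2 :+ (E :+ X) :^ 2) :* (φ :+ (E :+ X))) , (φ := E :+ X)) ∷
    (con -1ℤ , (W := :- (E :* X :* (E :^ 2 :+ X :^ 2)))) ∷
    (con 1ℤ , (φ :^ 4 :+ W :- con 1ℤ := con 0ℤ)) ∷ [])
  (weaken φ-dissection ∷ W-E-X ∷ φ⁴+W≡₃1 ∷ [])

-- In terms of E and X all is homogeneous of degree 7 apart from the last two terms, of degree 3.
-- Multiplying these by E⁴ + X⁴ ≡ 1 makes the congruence an identity of polynomials.
W-functional : (E - X) ^ 3 * (W + W ²) ≡₃ W ² ² * (E ^ 3 + X ^ 3) - X ^ 3 - E * X * (E - X)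
W-functional = Mod3.linear (E ∷ X ∷ W ∷ W ² ∷ W ² ² ∷ [])
  (λ E X W W₂ W₄ →
    ((E :- X) :^ 3 :* (W :+ W₂) := W₄ :* (E :^ 3 :+ X :^ 3) :- X :^ 3 :- E :* X :* (E :- X)) ,
    ((E :- X) :^ 3 , (W := :- (E :* X :* (E :^ 2 :+ X :^ 2)))) ∷
    ((E :- X) :^ 3 , (W₂ := E :^ 2 :* X :^ 2)) ∷
    (:- (E :^ 3 :+ X :^ 3) , (W₄ := X :^ 4)) ∷
    (:- (X :^ 3 :+ E :* X :* (E :- X)) , (E :^ 4 :+ X :^ 4 := con 1ℤ)) ∷ [])
  (W-E-X ∷ W² ∷ W₄ ∷ E⁴+X⁴ ∷ [])

-- S - S(q⁴) and W solve the same inhomogeneous equation. Dividing by the cube of D, their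
-- difference d satisfies d ≡ -d(q²) + ((E³ + X³)/D³) d(q⁴) with exponents denoting powers, so it
-- vanishes by `functional-zero`.
S-dissection : S ≡₃ S ² ² + q * ψ ² ^ 4
S-dissection = Mod3.linear (S ∷ S₄ ∷ W ∷ []) (λ S S₄ W → (S := S₄ :+ W) , (con 1ℤ , (S :- S₄ :- W := con 0ℤ)) ∷ [])
  (functional-zero (∣-zero S-S₄-W-zeroth) { - 1#} {(E ^ 3 + X ^ 3) * inv (D ^ 3)} 2 4 2≤2 2≤4
    (Mod3.linear (E ∷ X ∷ D ∷ S ∷ S ² ∷ S₄ ∷ S₈ ∷ S₁₆ ∷ W ∷ W ² ∷ W ² ² ∷ inv (D ^ 3) ∷ (S - S₄ - W) ² ∷ (S - S₄ - W) ∘ q ^ 4 ∷ [])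
      (λ E X D s s₂ s₄ s₈ s₁₆ w w₂ w₄ J d₂ d₄ →
        (s :- s₄ :- w := (:- con 1ℤ) :* d₂ :+ (E :^ 3 :+ X :^ 3) :* J :* d₄) ,
        (con 1ℤ , (d₂ := s₂ :- s₈ :- w₂)) ∷
        (:- ((E :^ 3 :+ X :^ 3) :* J) , (d₄ := s₄ :- s₁₆ :- w₄)) ∷
        (:- (s :- s₄ :- w :+ (s₂ :- s₈ :- w₂)) , (D :^ 3 :* J := con 1ℤ)) ∷
        (J :* (s :- s₄ :- w :+ (s₂ :- s₈ :- w₂)) , (D :^ 3 := (E :- X) :^ 3)) ∷
        (J , ((E :- X) :^ 3 :* (s :+ s₂ :- s₄ :- s₈) := (s₄ :- s₁₆) :* (E :^ 3 :+ X :^ 3) :- X :^ 3 :- E :* X :* (E :- X))) ∷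
        (:- J , ((E :- X) :^ 3 :* (w :+ w₂) := w₄ :* (E :^ 3 :+ X :^ 3) :- X :^ 3 :- E :* X :* (E :- X))) ∷ [])
      (weaken d∘q²
       ∷ weaken (trans (sym (²-² (S - S₄ - W))) (trans (∘-cong q²0 d∘q²) (∘-⟦⟧ q²0 (var zero :- var (suc zero) :- var (suc (suc zero))) (S ² ∷ S₈ ∷ W ² ∷ []))))
       ∷ weaken (*-inv (D ^ 3) D³-zeroth)
       ∷ weaken (^-congˡ 3 D-dissection)
       ∷ S-functional ∷ W-functional ∷ []))
   ∷ [])
  where
  d∘q² : (S - S₄ - W) ² ≈ S ² - S₈ - W ²
  d∘q² = ∘-⟦⟧ q²0 (var zero :- var (suc zero) :- var (suc (suc zero))) (S ∷ S₄ ∷ W ∷ [])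
  opaque
    unfolding _⊕_
    D³-zeroth : (D ^ 3) 0 ≡ 1ℤ
    D³-zeroth = cong (λ a → a ℤ.* (a ℤ.* (a ℤ.* 1ℤ))) D-zeroth


-- The five bisections of C modulo 9

-- A formula with k slots that can be read at any precision: exactly, to commute with substitution,
-- and modulo 9, inside `Mod9.linear`.
Form : ∀ k → Precision → ℕ → Set (N-ary-level 0ℓ 0ℓ k)
Form k p n = N-ary k (Modulo.Polynomial p n) (Modulo.Polynomial p n)

module _ {n : ℕ} (e₀ e₁ : Form n exactly n) (ρ : Vec PS n) {F : PS}
         (dissection : F ≡₉ ⟦ e₀ $ⁿ Modulo.variables exactly ⟧ (Vec.map _² ρ)
                            + q * ⟦ e₁ $ⁿ Modulo.variables exactly ⟧ (Vec.map _² ρ)) where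
  private
    p₀ p₁ : Polynomial n
    p₀ = e₀ $ⁿ Modulo.variables exactly
    p₁ = e₁ $ⁿ Modulo.variables exactly

    F≡ : F ≡₉ ⟦ p₀ ⟧ ρ ² + q * ⟦ p₁ ⟧ ρ ²
    F≡ = trans dissection (weaken (sym (+-cong (∘-⟦⟧ q²0 p₀ ρ) (*-congˡ (∘-⟦⟧ q²0 p₁ ρ)))))

  -- The entries of ρ enter the hypothesis only at q², so the two polynomial values are the two
  -- halves of a bisection.
  even-part : even F ≡₉ ⟦ p₀ ⟧ ρ
  even-part = trans (even-cong F≡) (weaken (even-dissection (⟦ p₀ ⟧ ρ) (⟦ p₁ ⟧ ρ)))

  odd-part : odd F ≡₉ ⟦ p₁ ⟧ ρ
  odd-part = trans (odd-cong F≡) (weaken (odd-dissection (⟦ p₀ ⟧ ρ) (⟦ p₁ ⟧ ρ)))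

D-η : D * η₁ ² ≈ η₁ * η₁
D-η = trans (*-congˡ η₁²) Gauss-φ.gauss

ψ-η : ψ * η₁ ≈ η₁ ² * η₁ ²
ψ-η = trans Gauss-ψ.gauss (sym (*-cong η₁² η₁²))

φ-η : φ * η₁ ^ 2 ≈ η₁ ² * D ² ^ 2
φ-η = linear (φ ∷ D ∷ D ² ∷ η₁ ∷ η₁ ² ∷ [])
  (λ φ D d f₁ f → (φ :* f₁ :^ 2 := f :* d :^ 2) , (:- φ , (D :* f := f₁ :* f₁)) ∷ (f , (φ :* D := d :* d)) ∷ [])
  (D-η ∷ φ-D ∷ [])

D-split : D ≈ φ ² ² - const (+ 2) * q * ψ ² ² ²
D-split = trans D-dissection (+-cong (sym (²-² φ)) (-‿cong X-²))

φ-split : φ ≈ φ ² ² + const (+ 2) * q * ψ ² ² ²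
φ-split = trans φ-dissection (+-cong (sym (²-² φ)) X-²)

φ²-ψ²² : φ ² * ψ ² ² ≈ ψ ² * ψ ²
φ²-ψ²² = trans (sym (∘-* q²0 φ (ψ ²))) (trans (∘-cong q²0 φ-ψ²) (∘-* q²0 ψ ψ))

3S-split : const (+ 3) * S ≡₉ const (+ 3) * (S ² ² + q * ψ ² ^ 4)
3S-split = triple S-dissection

-- Products of odd parts leave even powers of q behind. They have to be written as `q ²` in order to
-- count as series in q² during the next bisection.
q²-split : q ² ≡₉ q ^ 2
q²-split = weaken (q∘ q²0)

D²-S-split : D ^ 2 * (1# + const (+ 3) * S) ≡₉
             φ ² ^ 2 * (1# + const (+ 3) * S ² ²) - const (+ 12) * q ² * ψ ² ² ^ 2 * ψ ² ^ 4
             + q * (- (const (+ 4) * ψ ² ² ^ 2 * (1# + const (+ 3) * S ² ²)) + const (+ 3) * φ ² ^ 2 * ψ ² ^ 4)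
D²-S-split = Mod9.linear (D ∷ S ∷ S ² ² ∷ φ ² ∷ ψ ² ² ∷ ψ ² ∷ q ² ∷ q ∷ [])
  (λ D s s₄ a b y q₂ q → let c = con (+ 3) ; u = con 1ℤ :+ c :* s₄ ; z = a :^ 2 :- con (+ 4) :* q :* b :^ 2 in
    (D :^ 2 :* (con 1ℤ :+ c :* s) := a :^ 2 :* u :- con (+ 12) :* q₂ :* b :^ 2 :* y :^ 4
                                      :+ q :* ((:- (con (+ 4) :* b :^ 2 :* u)) :+ c :* a :^ 2 :* y :^ 4)) ,
    (:- (con 1ℤ :+ c :* s) , (z := D :^ 2)) ∷
    (z , (c :* s := c :* (s₄ :+ q :* y :^ 4))) ∷
    (con (+ 12) :* b :^ 2 :* y :^ 4 , (q₂ := q :^ 2)) ∷ [])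
  (weaken D-squared ∷ 3S-split ∷ q²-split ∷ [])

module Dissections {C : PS} (C-η : C * η₁ ≈ η₃ * η₃ ²) where

  -- f₃/f₁ = f₁²/(1 - 3S) ≡ f₁²(1 + 3S), and f₁² = f₂D.
  C≡ : C ≡₉ η₁ ² * η₃ ² * (D * (1# + const (+ 3) * S))
  C≡ = *-cancelˡ η₁ η₁-zeroth (Mod9.linear (C ∷ η₁ ∷ η₁ ² ∷ η₃ ∷ η₃ ² ∷ D ∷ S ∷ [])
    (λ C f₁ f f₃ g D s → let u = con 1ℤ :+ con (+ 3) :* s in
      (f₁ :* C := f₁ :* (f :* g :* (D :* u))) ,
      (con 1ℤ , (C :* f₁ := f₃ :* g)) ∷
      (:- (g :* u) , (f₁ :^ 3 := f₃ :* (con 1ℤ :- con (+ 3) :* s))) ∷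
      (:- (f₁ :* g :* u) , (D :* f := f₁ :* f₁)) ∷ [])
    (weaken C-η ∷ weaken η₁-cube-S ∷ weaken D-η ∷ []))

  odd-C : odd C ≡₉ η₁ * η₃ * (const (+ 3) * φ ² * ψ ^ 4 - const (+ 2) * ψ ² ² * (1# + const (+ 3) * S ²))
  odd-C = odd-part e₀ e₁ (η₁ ∷ η₃ ∷ φ ² ∷ ψ ² ² ∷ ψ ∷ S ² ∷ q ∷ [])
    (Mod9.linear (C ∷ η₁ ² ∷ η₃ ² ∷ φ ² ² ∷ ψ ² ² ² ∷ ψ ² ∷ S ² ² ∷ q ² ∷ q ∷ D ∷ S ∷ [])
      (λ C f g P Y y s₄ q₂ q D s →
        (C := e₀ f g P Y y s₄ q₂ :+ q :* e₁ f g P Y y s₄ q₂) ,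
        (con 1ℤ , (C := f :* g :* (D :* (con 1ℤ :+ con (+ 3) :* s)))) ∷
        (f :* g :* (con 1ℤ :+ con (+ 3) :* s) , (D := P :- con (+ 2) :* q :* Y)) ∷
        (f :* g :* (P :- con (+ 2) :* q :* Y) , (con (+ 3) :* s := con (+ 3) :* (s₄ :+ q :* y :^ 4))) ∷
        (con (+ 6) :* f :* g :* Y :* y :^ 4 , (q₂ := q :^ 2)) ∷ [])
      (C≡ ∷ weaken D-split ∷ 3S-split ∷ q²-split ∷ []))
    where
    e₀ e₁ : ∀ {p n} → Form 7 p n
    e₀ f g a b y s q = f :* g :* (a :* (con 1ℤ :+ con (+ 3) :* s) :- con (+ 6) :* q :* b :* y :^ 4)
    e₁ f g a b y s q = f :* g :* (con (+ 3) :* a :* y :^ 4 :- con (+ 2) :* b :* (con 1ℤ :+ con (+ 3) :* s))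

  -- Everything but D²(1 + 3S), with D squared, is moved into series in q²: f₁f₃ ≡ f₁⁴(1 + 3S)
  -- modulo 9, f₁² = f₂D and ψf₁ = f₂². In the term with the factor 3 the correction by S drops out.
  C₁≡ : odd C ≡₉ const (+ 3) * φ ² * η₁ ² ^ 8 - const (+ 2) * ψ ² ² * (1# + const (+ 3) * S ²) * η₁ ² ^ 2 * (D ^ 2 * (1# + const (+ 3) * S))
  C₁≡ = trans odd-C (Mod9.linear (η₁ ∷ η₁ ² ∷ η₃ ∷ D ∷ φ ² ∷ ψ ∷ ψ ² ² ∷ S ∷ S ² ∷ [])
    (λ f₁ f f₃ D a ψ b s s₂ →
      let c = con (+ 3) ; u = con 1ℤ :+ c :* s ; u₂ = con 1ℤ :+ c :* s₂ ; K = c :* a :* ψ :^ 4 :- con (+ 2) :* b :* u₂ in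
      (f₁ :* f₃ :* K := c :* a :* f :^ 8 :- con (+ 2) :* b :* u₂ :* f :^ 2 :* (D :^ 2 :* u)) ,
      (:- (f₁ :* K :* u) , (f₁ :^ 3 := f₃ :* (con 1ℤ :- c :* s))) ∷
      (con (+ 2) :* b :* u₂ :* u :* (D :* f :+ f₁ :^ 2) , (D :* f := f₁ :* f₁)) ∷
      (c :* a :* (ψ :* f₁ :+ f :^ 2) :* (ψ :^ 2 :* f₁ :^ 2 :+ f :^ 4) , (ψ :* f₁ := f :* f)) ∷ [])
    (weaken η₁-cube-S ∷ weaken D-η ∷ weaken ψ-η ∷ []))

  even-C₁ : even (odd C) ≡₉ const (+ 3) * φ * η₁ ^ 8 - const (+ 2) * ψ ² * (1# + const (+ 3) * S) * η₁ ^ 2 *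
                            (φ ^ 2 * (1# + const (+ 3) * S ²) - const (+ 12) * q * ψ ² ^ 2 * ψ ^ 4)
  even-C₁ = even-part e₀ e₁ (η₁ ∷ φ ∷ ψ ² ∷ S ∷ S ² ∷ ψ ∷ q ∷ [])
    (Mod9.linear (odd C ∷ D ∷ S ∷ η₁ ² ∷ φ ² ∷ ψ ² ² ∷ S ² ∷ S ² ² ∷ ψ ² ∷ q ² ∷ q ∷ [])
      (λ F D s f a b s₂ s₄ y q₂ q →
        let c = con (+ 3) ; u₄ = con 1ℤ :+ c :* s₄ ; K = con (+ 2) :* b :* (con 1ℤ :+ c :* s₂) :* f :^ 2 in
        (F := e₀ f a b s₂ s₄ y q₂ :+ q :* e₁ f a b s₂ s₄ y q₂) ,
        (con 1ℤ , (F := c :* a :* f :^ 8 :- K :* (D :^ 2 :* (con 1ℤ :+ c :* s)))) ∷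
        (:- K , (D :^ 2 :* (con 1ℤ :+ c :* s) := a :^ 2 :* u₄ :- con (+ 12) :* q₂ :* b :^ 2 :* y :^ 4
                                      :+ q :* ((:- (con (+ 4) :* b :^ 2 :* u₄)) :+ c :* a :^ 2 :* y :^ 4))) ∷ [])
      (C₁≡ ∷ D²-S-split ∷ []))
    where
    e₀ e₁ : ∀ {p n} → Form 7 p n
    e₀ f a b s₂ s₄ y q = con (+ 3) :* a :* f :^ 8 :- con (+ 2) :* b :* (con 1ℤ :+ con (+ 3) :* s₂) :* f :^ 2 :*
                         (a :^ 2 :* (con 1ℤ :+ con (+ 3) :* s₄) :- con (+ 12) :* q :* b :^ 2 :* y :^ 4)
    e₁ f a b s₂ s₄ y q = :- (con (+ 2) :* b :* (con 1ℤ :+ con (+ 3) :* s₂) :* f :^ 2 :*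
                         ((:- (con (+ 4) :* b :^ 2 :* (con 1ℤ :+ con (+ 3) :* s₄))) :+ con (+ 3) :* a :^ 2 :* y :^ 4))

  -- φf₁² = f₂D(q²)², φD = D(q²)² and ψ² = φψ(q²), with exponents denoting powers, leave only a cube
  -- of D and single factors φ outside the series in q². In the last term 24 · 3S vanishes modulo 9.
  C₂≡ : even (odd C) ≡₉ const (+ 3) * η₁ ² ^ 4 * D ² ^ 2 * D ^ 3
                        - const (+ 2) * ψ ² * η₁ ² * D ² ^ 2 * (1# + const (+ 3) * S ²) * (φ * (1# + const (+ 3) * S))
                        + const (+ 24) * q * ψ ² ^ 5 * η₁ ² * D ² ^ 2 * φ
  C₂≡ = trans even-C₁ (Mod9.linear (η₁ ∷ η₁ ² ∷ D ∷ D ² ∷ φ ∷ ψ ∷ ψ ² ∷ S ∷ S ² ∷ q ∷ [])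
    (λ f₁ f D d φ ψ y s s₂ q →
      let c = con (+ 3) ; u = con 1ℤ :+ c :* s ; u₂ = con 1ℤ :+ c :* s₂ in
      (c :* φ :* f₁ :^ 8 :- con (+ 2) :* y :* u :* f₁ :^ 2 :* (φ :^ 2 :* u₂ :- con (+ 12) :* q :* y :^ 2 :* ψ :^ 4)
        := c :* f :^ 4 :* d :^ 2 :* D :^ 3 :- con (+ 2) :* y :* f :* d :^ 2 :* u₂ :* (φ :* u)
           :+ con (+ 24) :* q :* y :^ 5 :* f :* d :^ 2 :* φ) ,
      (:- (c :* φ :* (D :* f :+ f₁ :^ 2) :* ((D :* f) :^ 2 :+ f₁ :^ 4)) , (D :* f := f₁ :* f₁)) ∷
      (c :* f :^ 4 :* D :^ 3 :* con 1ℤ , (φ :* D := d :* d)) ∷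
      (:- (con (+ 2) :* y :* u :* u₂ :* φ) :+ con (+ 24) :* q :* y :^ 5 :* φ , (φ :* f₁ :^ 2 := f :* d :^ 2)) ∷
      (:- (con (+ 24) :* q :* y :^ 3 :* f₁ :^ 2 :* (φ :* y :+ ψ :^ 2)) , (φ :* y := ψ :* ψ)) ∷ [])
    (weaken D-η ∷ weaken φ-D ∷ weaken φ-η ∷ weaken φ-ψ² ∷ []))

  even-C₂ : even (even (odd C)) ≡₉ const (+ 3) * η₁ ^ 4 * D ^ 2 * φ ² ^ 3
              - const (+ 2) * ψ * η₁ * D ^ 2 * (1# + const (+ 3) * S) * (φ ² * (1# + const (+ 3) * S ²) + const (+ 6) * q * ψ ² ² * ψ ^ 4)
              + const (+ 48) * q * ψ ² ² * ψ ^ 5 * η₁ * D ^ 2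
  even-C₂ = even-part e₀ e₁ (η₁ ∷ D ∷ ψ ∷ φ ² ∷ ψ ² ² ∷ S ∷ S ² ∷ q ∷ [])
    (Mod9.linear (even (odd C) ∷ D ∷ φ ∷ S ∷ η₁ ² ∷ D ² ∷ ψ ² ∷ φ ² ² ∷ ψ ² ² ² ∷ S ² ∷ S ² ² ∷ q ² ∷ q ∷ [])
      (λ F D φ s f d y P Y s₂ s₄ q₂ q →
        let c = con (+ 3) ; u = con 1ℤ :+ c :* s ; Z = P :- con (+ 2) :* q :* Y ; Z⁺ = P :+ con (+ 2) :* q :* Y
            K = con (+ 2) :* y :* f :* d :^ 2 :* (con 1ℤ :+ c :* s₂) ; L = con (+ 24) :* y :^ 5 :* f :* d :^ 2 in
        (F := e₀ f d y P Y s₂ s₄ q₂ :+ q :* e₁ f d y P Y s₂ s₄ q₂) ,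
        (con 1ℤ , (F := c :* f :^ 4 :* d :^ 2 :* D :^ 3 :- K :* (φ :* u) :+ con (+ 24) :* q :* y :^ 5 :* f :* d :^ 2 :* φ)) ∷
        (c :* f :^ 4 :* d :^ 2 :* (D :^ 2 :+ D :* Z :+ Z :^ 2) , (D := Z)) ∷
        (q :* L :- K :* u , (φ := Z⁺)) ∷
        (:- (K :* Z⁺) , (c :* s := c :* (s₄ :+ q :* y :^ 4))) ∷
        (con (+ 24) :* q :* Y :^ 3 :* f :^ 4 :* d :^ 2 :- con (+ 6) :* K :* Y :* y :^ 4 :+ con (+ 2) :* Y :* L , (q₂ := q :^ 2)) ∷ [])
      (C₂≡ ∷ weaken D-split ∷ weaken φ-split ∷ 3S-split ∷ q²-split ∷ []))
    where
    e₀ e₁ : ∀ {p n} → Form 8 p n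
    e₀ f d y P Y s₂ s₄ q = con (+ 3) :* f :^ 4 :* d :^ 2 :* P :^ 3
      :- con (+ 2) :* y :* f :* d :^ 2 :* (con 1ℤ :+ con (+ 3) :* s₂) :* (P :* (con 1ℤ :+ con (+ 3) :* s₄) :+ con (+ 6) :* q :* Y :* y :^ 4)
      :+ con (+ 48) :* q :* Y :* y :^ 5 :* f :* d :^ 2
    e₁ f d y P Y s₂ s₄ q = (:- (con (+ 24) :* q :* f :^ 4 :* d :^ 2 :* Y :^ 3))
      :- con (+ 2) :* y :* f :* d :^ 2 :* (con 1ℤ :+ con (+ 3) :* s₂) :* (con (+ 2) :* Y :* (con 1ℤ :+ con (+ 3) :* s₄) :+ con (+ 3) :* P :* y :^ 4)
      :+ con (+ 24) :* P :* y :^ 5 :* f :* d :^ 2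

  -- The terms with an explicit factor q cancel: their coefficients -12 and 48 add up to 36, and the
  -- corrections by 3S carry the factor 36 or a multiple of it.
  C₃≡ : even (even (odd C)) ≡₉ const (+ 3) * D ^ 4 * η₁ ² ^ 2 * φ ² ^ 3
          - const (+ 2) * η₁ ² ^ 2 * φ ² * (1# + const (+ 3) * S ²) * (D ^ 2 * (1# + const (+ 3) * S))
  C₃≡ = trans even-C₂ (Mod9.linear (η₁ ∷ η₁ ² ∷ D ∷ φ ² ∷ ψ ∷ ψ ² ² ∷ S ∷ S ² ∷ q ∷ [])
    (λ f₁ f D a ψ b s s₂ q →
      let c = con (+ 3) ; u = con 1ℤ :+ c :* s ; u₂ = con 1ℤ :+ c :* s₂ in
      (c :* f₁ :^ 4 :* D :^ 2 :* a :^ 3 :- con (+ 2) :* ψ :* f₁ :* D :^ 2 :* u :* (a :* u₂ :+ con (+ 6) :* q :* b :* ψ :^ 4)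
         :+ con (+ 48) :* q :* b :* ψ :^ 5 :* f₁ :* D :^ 2
       := c :* D :^ 4 :* f :^ 2 :* a :^ 3 :- con (+ 2) :* f :^ 2 :* a :* u₂ :* (D :^ 2 :* u)) ,
      (:- (c :* D :^ 2 :* a :^ 3 :* (D :* f :+ f₁ :^ 2)) , (D :* f := f₁ :* f₁)) ∷
      (:- (con (+ 2) :* D :^ 2 :* u :* a :* u₂) , (ψ :* f₁ := f :* f)) ∷ [])
    (weaken D-η ∷ weaken ψ-η ∷ []))

  odd-C₃ : odd (even (even (odd C))) ≡₉ η₁ ^ 2 * (- (const (+ 24) * φ ^ 5 * ψ ² ^ 2)
             - const (+ 2) * φ * (1# + const (+ 3) * S) * (- (const (+ 4) * ψ ² ^ 2 * (1# + const (+ 3) * S ²)) + const (+ 3) * φ ^ 2 * ψ ^ 4))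
  odd-C₃ = odd-part e₀ e₁ (η₁ ∷ φ ∷ ψ ² ∷ ψ ∷ S ∷ S ² ∷ q ∷ [])
    (Mod9.linear (even (even (odd C)) ∷ D ∷ S ∷ η₁ ² ∷ φ ² ∷ ψ ² ² ∷ ψ ² ∷ S ² ∷ S ² ² ∷ q ² ∷ q ∷ [])
      (λ F D s f a b y s₂ s₄ q₂ q →
        let c = con (+ 3) ; u = con 1ℤ :+ c :* s ; u₄ = con 1ℤ :+ c :* s₄ ; z = a :^ 2 :- con (+ 4) :* q :* b :^ 2
            K = con (+ 2) :* f :^ 2 :* a :* (con 1ℤ :+ c :* s₂) in
        (F := e₀ f a b y s₂ s₄ q₂ :+ q :* e₁ f a b y s₂ s₄ q₂) ,
        (con 1ℤ , (F := c :* D :^ 4 :* f :^ 2 :* a :^ 3 :- K :* (D :^ 2 :* u))) ∷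
        (:- K , (D :^ 2 :* u := a :^ 2 :* u₄ :- con (+ 12) :* q₂ :* b :^ 2 :* y :^ 4
                                 :+ q :* ((:- (con (+ 4) :* b :^ 2 :* u₄)) :+ c :* a :^ 2 :* y :^ 4))) ∷
        (:- (c :* f :^ 2 :* a :^ 3 :* (z :+ D :^ 2)) , (z := D :^ 2)) ∷
        (:- (con (+ 48) :* f :^ 2 :* a :^ 3 :* b :^ 4) , (q₂ := q :^ 2)) ∷ [])
      (C₃≡ ∷ D²-S-split ∷ weaken D-squared ∷ q²-split ∷ []))
    where
    e₀ e₁ : ∀ {p n} → Form 7 p n
    e₀ f a b y s₂ s₄ q = f :^ 2 :* (con (+ 3) :* a :^ 3 :* (a :^ 4 :+ con (+ 16) :* q :* b :^ 4)
      :- con (+ 2) :* a :* (con 1ℤ :+ con (+ 3) :* s₂) :* (a :^ 2 :* (con 1ℤ :+ con (+ 3) :* s₄) :- con (+ 12) :* q :* b :^ 2 :* y :^ 4))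
    e₁ f a b y s₂ s₄ q = f :^ 2 :* ((:- (con (+ 24) :* a :^ 5 :* b :^ 2))
      :- con (+ 2) :* a :* (con 1ℤ :+ con (+ 3) :* s₂) :* ((:- (con (+ 4) :* b :^ 2 :* (con 1ℤ :+ con (+ 3) :* s₄))) :+ con (+ 3) :* a :^ 2 :* y :^ 4))

  -- ψ⁴ = φ²ψ(q²)² merges the coefficients -24 and -6 of φ⁵ into -30, and one factor φ is absorbed
  -- by φf₁² = f₂D(q²)².
  C₄≡ : odd (even (even (odd C))) ≡₉ η₁ ² * D ² ^ 2 * ψ ² ^ 2 *
          (const (+ 8) * (1# + const (+ 3) * S) * (1# + const (+ 3) * S ²) - const (+ 30) * φ ^ 4)
  C₄≡ = trans odd-C₃ (Mod9.linear (η₁ ∷ η₁ ² ∷ D ² ∷ φ ∷ ψ ∷ ψ ² ∷ S ∷ S ² ∷ [])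
    (λ f₁ f d φ ψ y s s₂ →
      let c = con (+ 3) ; u = con 1ℤ :+ c :* s ; u₂ = con 1ℤ :+ c :* s₂ ; K = con (+ 8) :* u :* u₂ :- con (+ 30) :* φ :^ 4 in
      (f₁ :^ 2 :* ((:- (con (+ 24) :* φ :^ 5 :* y :^ 2)) :- con (+ 2) :* φ :* u :* ((:- (con (+ 4) :* y :^ 2 :* u₂)) :+ c :* φ :^ 2 :* ψ :^ 4))
        := f :* d :^ 2 :* y :^ 2 :* K) ,
      (con (+ 6) :* φ :^ 3 :* u :* f₁ :^ 2 :* (φ :* y :+ ψ :^ 2) , (φ :* y := ψ :* ψ)) ∷
      (y :^ 2 :* K , (φ :* f₁ :^ 2 := f :* d :^ 2)) ∷ [])
    (weaken φ-ψ² ∷ weaken φ-η ∷ []))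

  -- Only 3S and φ⁴ contribute odd powers. The first gives 24qψ(q²)⁴; the second gives -30 ·
  -- 8qφ(q²)²ψ(q⁴)² = -240qψ(q²)⁴. The sum has coefficient -216 = -24 · 9.
  odd-C₄ : odd (odd (even (even (odd C)))) ≡₉ 0#
  odd-C₄ = odd-part e₀ e₁ (η₁ ∷ D ∷ ψ ∷ S ∷ S ² ∷ φ ∷ ψ ² ∷ q ∷ [])
    (Mod9.linear (odd (even (even (odd C))) ∷ S ∷ φ ∷ η₁ ² ∷ D ² ∷ ψ ² ∷ S ² ∷ S ² ² ∷ φ ² ∷ ψ ² ² ∷ q ² ∷ q ∷ [])
      (λ F s φ f d y s₂ s₄ a b q₂ q →
        let c = con (+ 3) ; u₂ = con 1ℤ :+ c :* s₂ ; K = f :* d :^ 2 :* y :^ 2 ; Z = a :^ 2 :+ con (+ 4) :* q :* b :^ 2 in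
        (F := e₀ f d y s₂ s₄ a b q₂ :+ q :* e₁ f d y s₂ s₄ a b q₂) ,
        (con 1ℤ , (F := K :* (con (+ 8) :* (con 1ℤ :+ c :* s) :* u₂ :- con (+ 30) :* φ :^ 4))) ∷
        (con (+ 8) :* K :* u₂ , (c :* s := c :* (s₄ :+ q :* y :^ 4))) ∷
        (con (+ 30) :* K :* (Z :+ φ :^ 2) , (Z := φ :^ 2)) ∷
        (con (+ 480) :* K :* b :^ 4 , (q₂ := q :^ 2)) ∷
        (:- (con (+ 240) :* K :* q :* (a :* b :+ y :^ 2)) , (a :* b := y :* y)) ∷ [])
      (C₄≡ ∷ 3S-split ∷ weaken φ-squared ∷ q²-split ∷ weaken φ²-ψ²² ∷ []))
    where
    e₀ e₁ : ∀ {p n} → Form 8 p n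
    e₀ f d y s₂ s₄ a b q = f :* d :^ 2 :* y :^ 2 :*
      (con (+ 8) :* (con 1ℤ :+ con (+ 3) :* s₄) :* (con 1ℤ :+ con (+ 3) :* s₂) :- con (+ 30) :* (a :^ 4 :+ con (+ 16) :* q :* b :^ 4))
    e₁ f d y s₂ s₄ a b q = con 0ℤ


-- Partial fractions and Cauchy's identity

Q : PS
Q = q ^ 6

Q0 : Q 0 ≡ 0ℤ
Q0 = ^-zeroth q 5 q0

-- `g n` is 1/(Q;Q)ₙ, and `h` is the same sequence one place later, with 1/(Q;Q)₋₁ read as 0. `e k`
-- is (-1)ᵏ Q^(k(k+1)/2). The factor 1 - Q^(2k+1) in `b k` is 1 - xy for the two quantities x = qQᵏ
-- and y = q⁵Qᵏ in `c k`, because q · q⁵ = Q.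
g h e b c a : ℕ → PS
g = pochInv Q Q
h zero    = 0#
h (suc j) = g j
e zero    = 1#
e (suc k) = - (Q ^ suc k * e k)
b k = e k * (1# - Q * (Q ^ k) ^ 2)
c k = inv ((1# - q * Q ^ k) * (1# - q ^ 5 * Q ^ k))
a k = b k * c k

g-suc : ∀ n → (1# - Q * Q ^ n) * g (suc n) ≈ g n
g-suc = pochInv-suc Q0 Q

g-zero : g 0 ≈ 1#
g-zero = trans (sym (*-identityˡ (g 0))) (poch-*-pochInv {Q} Q0 Q 0)

h≈ : ∀ j → h j ≈ (1# - Q ^ j) * g j
h≈ zero    = ring (g 0 ∷ []) (λ g → con 0ℤ := (con 1ℤ :- con 1ℤ) :* g)
h≈ (suc j) = sym (g-suc j)

opaque
  unfolding _⊕_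
  c-zeroth : ∀ k → ((1# - q * Q ^ k) * (1# - q ^ 5 * Q ^ k)) 0 ≡ 1ℤ
  c-zeroth k = cong₂ ℤ._*_ (1-zeroth (q * Q ^ k) (*-zerothˡ q (Q ^ k) q0))
    (1-zeroth (q ^ 5 * Q ^ k) (*-zerothˡ (q ^ 5) (Q ^ k) (^-zeroth q 4 q0)))

c-inverse : ∀ k → (1# - q * Q ^ k) * (1# - q ^ 5 * Q ^ k) * c k ≈ 1#
c-inverse k = *-inv _ (c-zeroth k)

-- A closed form for the partial sums, with j standing for n - K. At K = n the factor `h 0` = 0
-- makes the whole sum vanish.
telescope : ∀ n K j → K ℕ.+ j ≡ n →
            (1# - Q ^ n) * ∑ (suc K) (λ k → b k * Q ^ (n ∸ k) * (g (n ∸ k) * g (suc (n ℕ.+ k))))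
            ≈ Q ^ n * e K * (1# - Q ^ suc K) * h j * g (suc (n ℕ.+ K))
telescope n zero j ≡.refl = linear (Q ∷ Q ^ j ∷ g j ∷ h j ∷ g (suc (j ℕ.+ 0)) ∷ [])
  (λ Q t gj hj G → ((con 1ℤ :- t) :* (con 0ℤ :+ con 1ℤ :* (con 1ℤ :- Q :* con 1ℤ :^ 2) :* t :* (gj :* G))
      := t :* con 1ℤ :* (con 1ℤ :- Q :* con 1ℤ) :* hj :* G) ,
    (:- (t :* (con 1ℤ :- Q) :* G) , (hj := (con 1ℤ :- t) :* gj)) ∷ [])
  (h≈ j ∷ [])
telescope n (suc K) j K+j≡n = linear
  (Q ∷ Q ^ n ∷ Q ^ K ∷ Q ^ j ∷ Q ^ (n ∸ suc K) ∷ ∑ (suc K) _ ∷ e K ∷ g j ∷ g (n ∸ suc K) ∷ h j ∷ g (suc (n ℕ.+ K)) ∷ g (suc (n ℕ.+ suc K)) ∷ [])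
  (λ Q N k t t′ Σ e gj gj′ hj G G′ →
    let s = Q :* k ; E = :- (s :* e) ; B = E :* (con 1ℤ :- Q :* s :^ 2) in
    ((con 1ℤ :- N) :* (Σ :+ B :* t′ :* (gj′ :* G′)) := N :* E :* (con 1ℤ :- Q :* s) :* hj :* G′) ,
    (con 1ℤ , ((con 1ℤ :- N) :* Σ := N :* e :* (con 1ℤ :- s) :* gj :* G)) ∷
    ((con 1ℤ :- N) :* B :* gj′ :* G′ , (t′ := t)) ∷
    ((con 1ℤ :- N) :* B :* t :* G′ , (gj′ := gj)) ∷
    (:- (N :* E :* (con 1ℤ :- Q :* s) :* G′) , (hj := (con 1ℤ :- t) :* gj)) ∷
    (:- (N :* e :* (con 1ℤ :- s) :* gj) , ((con 1ℤ :- Q :* N :* s) :* G′ := G)) ∷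
    (gj :* G′ :* (e :* (con 1ℤ :- s) :* (con 1ℤ :- Q :* s :* (N :+ s :* t)) :- B :* t :- E :* (con 1ℤ :- Q :* s) :* (con 1ℤ :- t)) , (N := s :* t)) ∷ [])
  (telescope n K (suc j) (≡.trans (ℕ.+-suc K j) K+j≡n)
   ∷ ≡⇒≈ (cong (Q ^_) n∸K≡j)
   ∷ ≡⇒≈ (cong g n∸K≡j)
   ∷ h≈ j
   ∷ trans (*-cong (+-congˡ (-‿cong (trans (*-assoc Q (Q ^ n) (Q ^ suc K)) (*-congˡ (trans (sym (^-homo-* Q n (suc K))) (≡⇒≈ (cong (Q ^_) (ℕ.+-suc n K))))))))
                     (≡⇒≈ (cong (λ i → g (suc i)) (ℕ.+-suc n K)))) (g-suc (suc (n ℕ.+ K)))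
   ∷ trans (≡⇒≈ (cong (Q ^_) (≡.sym K+j≡n))) (^-homo-* Q (suc K) j) ∷ [])
  where
  n∸K≡j : n ∸ suc K ≡ j
  n∸K≡j = ≡.trans (cong (_∸ suc K) (≡.sym K+j≡n)) (ℕ.m+n∸m≡n (suc K) j)

telescope-zero : ∀ n → ∑ (suc (suc n)) (λ k → b k * Q ^ (suc n ∸ k) * (g (suc n ∸ k) * g (suc (suc n ℕ.+ k)))) ≈ 0#
telescope-zero n = *-cancelˡ (1# - Q ^ suc n) (1-zeroth (Q ^ suc n) (^-zeroth Q n Q0))
  (trans (telescope (suc n) (suc n) 0 (ℕ.+-identityʳ (suc n)))
    (ring (Q ^ suc n ∷ e (suc n) ∷ 1# - Q ^ suc (suc n) ∷ g (suc (suc n ℕ.+ suc n)) ∷ [])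
      (λ x e y G → x :* e :* y :* con 0ℤ :* G := (con 1ℤ :- x) :* con 0ℤ)))

∑-+ : ∀ n F G → ∑ n (λ i → F i + G i) ≈ ∑ n F + ∑ n G
∑-+ zero    F G = sym (+-identityˡ 0#)
∑-+ (suc n) F G = trans (+-congʳ (∑-+ n F G)) (ring (∑ n F ∷ ∑ n G ∷ F n ∷ G n ∷ []) (λ a b c d → a :+ b :+ (c :+ d) := (a :+ c) :+ (b :+ d)))

A : ℕ → PS
A n = ∑ (suc n) (λ k → a k * (g (n ∸ k) * g (suc (n ℕ.+ k))))

-- With n = k + j, the factor (1 - qQⁿ)(1 - q⁵Qⁿ) is (1 - qQᵏ)(1 - q⁵Qᵏ)Qʲ + (1 - Qʲ)(1 - Q^{2k+j+1}).
A-term : ∀ n k → k ≤ n → (1# - q * Q ^ n) * (1# - q ^ 5 * Q ^ n) * (a k * (g (n ∸ k) * g (suc (n ℕ.+ k))))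
         ≈ b k * Q ^ (n ∸ k) * (g (n ∸ k) * g (suc (n ℕ.+ k))) + a k * (h (n ∸ k) * g (n ℕ.+ k))
A-term n k k≤n = linear (q ∷ Q ^ n ∷ Q ^ k ∷ Q ^ (n ∸ k) ∷ b k ∷ c k ∷ g (n ∸ k) ∷ h (n ∸ k) ∷ g (n ℕ.+ k) ∷ g (suc (n ℕ.+ k)) ∷ Q ^ (n ℕ.+ k) ∷ [])
  (λ q N v t b c gj hj G G′ M → let Q = q :^ 6 ; n = v :* t in
    ((con 1ℤ :- q :* N) :* (con 1ℤ :- q :^ 5 :* N) :* (b :* c :* (gj :* G′)) := b :* t :* (gj :* G′) :+ b :* c :* (hj :* G)) ,
    (b :* c :* gj :* G′ :* ((:- q) :- q :^ 5 :+ Q :* (N :+ n)) , (N := n)) ∷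
    (b :* t :* gj :* G′ , ((con 1ℤ :- q :* v) :* (con 1ℤ :- q :^ 5 :* v) :* c := con 1ℤ)) ∷
    (:- (b :* c :* G) , (hj := (con 1ℤ :- t) :* gj)) ∷
    (b :* c :* (con 1ℤ :- t) :* gj , ((con 1ℤ :- Q :* M) :* G′ := G)) ∷
    (b :* c :* (con 1ℤ :- t) :* gj :* G′ :* Q , (M := N :* v)) ∷
    (b :* c :* (con 1ℤ :- t) :* gj :* G′ :* Q :* v , (N := n)) ∷ [])
  (N≈ ∷ c-inverse k ∷ h≈ (n ∸ k) ∷ g-suc (n ℕ.+ k) ∷ ^-homo-* Q n k ∷ N≈ ∷ [])
  where
  N≈ : Q ^ n ≈ Q ^ k * Q ^ (n ∸ k)
  N≈ = trans (≡⇒≈ (cong (Q ^_) (≡.sym (ℕ.m+[n∸m]≡n k≤n)))) (^-homo-* Q k (n ∸ k))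

-- `A-term` splits the sum in two. The part with `b k` vanishes by `telescope-zero`; in the other,
-- `h` lowers the index from n + 1 to n and kills the extra summand k = n + 1.
A-suc : ∀ n → (1# - q * Q ^ suc n) * (1# - q ^ 5 * Q ^ suc n) * A (suc n) ≈ A n
A-suc n = begin
  (1# - q * Q ^ suc n) * (1# - q ^ 5 * Q ^ suc n) * A (suc n)
    ≈⟨ ∑-distribˡ ((1# - q * Q ^ suc n) * (1# - q ^ 5 * Q ^ suc n)) (suc (suc n)) _ ⟩
  ∑ (suc (suc n)) (λ k → (1# - q * Q ^ suc n) * (1# - q ^ 5 * Q ^ suc n) * (a k * (g (suc n ∸ k) * g (suc (suc n ℕ.+ k)))))
    ≈⟨ ∑-cong (suc (suc n)) (λ { k (s≤s k≤n) → A-term (suc n) k k≤n }) ⟩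
  ∑ (suc (suc n)) (λ k → b k * Q ^ (suc n ∸ k) * (g (suc n ∸ k) * g (suc (suc n ℕ.+ k))) + a k * (h (suc n ∸ k) * g (suc n ℕ.+ k)))
    ≈⟨ ∑-+ (suc (suc n)) _ _ ⟩
  ∑ (suc (suc n)) (λ k → b k * Q ^ (suc n ∸ k) * (g (suc n ∸ k) * g (suc (suc n ℕ.+ k)))) + ∑ (suc (suc n)) (λ k → a k * (h (suc n ∸ k) * g (suc n ℕ.+ k)))
    ≈⟨ +-cong (telescope-zero n) (+-cong
         (∑-cong (suc n) (λ { k (s≤s k≤n) → *-congˡ (*-congʳ (≡⇒≈ (cong h (ℕ.+-∸-assoc 1 k≤n)))) }))
         (*-congˡ (*-congʳ (≡⇒≈ (cong h (ℕ.n∸n≡0 n)))))) ⟩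
  0# + (A n + a (suc n) * (0# * g (suc n ℕ.+ suc n)))
    ≈⟨ ring (A n ∷ a (suc n) ∷ g (suc n ℕ.+ suc n) ∷ []) (λ A a g → con 0ℤ :+ (A :+ a :* (con 0ℤ :* g)) := A) ⟩
  A n ∎

partial-fractions : ∀ n → poch q Q (suc n) * poch (q ^ 5) Q (suc n) * A n ≈ 1#
partial-fractions zero = linear (q ∷ c 0 ∷ g 0 ∷ g 1 ∷ [])
  (λ q c g₀ g₁ → let Q = q :^ 6 ; α = (con 1ℤ :- q :* con 1ℤ) :* (con 1ℤ :- q :^ 5 :* con 1ℤ) in
    (con 1ℤ :* (con 1ℤ :- q :* con 1ℤ) :* (con 1ℤ :* (con 1ℤ :- q :^ 5 :* con 1ℤ)) :*
      (con 0ℤ :+ con 1ℤ :* (con 1ℤ :- Q :* con 1ℤ :^ 2) :* c :* (g₀ :* g₁)) := con 1ℤ) ,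
    ((con 1ℤ :- Q) :* g₀ :* g₁ , (α :* c := con 1ℤ)) ∷
    (g₀ , ((con 1ℤ :- Q :* con 1ℤ) :* g₁ := g₀)) ∷
    (g₀ :+ con 1ℤ , (g₀ := con 1ℤ)) ∷ [])
  (c-inverse 0 ∷ g-suc 0 ∷ g-zero ∷ [])
partial-fractions (suc n) = linear
  (poch q Q (suc n) ∷ poch (q ^ 5) Q (suc n) ∷ 1# - q * Q ^ suc n ∷ 1# - q ^ 5 * Q ^ suc n ∷ A n ∷ A (suc n) ∷ [])
  (λ P R x y A A′ → (P :* x :* (R :* y) :* A′ := con 1ℤ) ,
    (P :* R , (x :* y :* A′ := A)) ∷ (con 1ℤ , (P :* R :* A := con 1ℤ)) ∷ [])
  (A-suc n ∷ partial-fractions n ∷ [])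


^-below-cong : ∀ {u} → u 0 ≡ 0ℤ → ∀ n {M f f′} → f ≈[ M ] f′ → (u ^ n * f) ≈[ n ℕ.+ M ] (u ^ n * f′)
^-below-cong {u} u0 zero    {M} {f} {f′} e = *-congˡ e
^-below-cong {u} u0 (suc n) {M} {f} {f′} e = trans (weaken (*-assoc u (u ^ n) f))
  (trans (*-below-suc u u0 (^-below-cong u0 n e)) (weaken (sym (*-assoc u (u ^ n) f′))))

g∞ : PS
g∞ = inv (eta Q)

g-below : ∀ {N M} → N ≤ M → g M ≈[ N ] g∞
g-below {N} {M} N≤M = inv-unique (eta Q) (g M) (eta-zeroth Q Q0)
  (trans (*-congʳ (poch∞-below Q0 Q N≤M)) (weaken (poch-*-pochInv Q0 Q M)))

cauchySum : ℕ → ℕ → PS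
cauchySum m J = ∑ J (λ j → Q ^ (j ℕ.* (j ℕ.+ m)) * (g j * g (j ℕ.+ m)))

-- Successive sums differ by a single boundary term, so in the limit the sum does not depend on m; let m → ∞.
cauchySum-suc : ∀ m J → cauchySum m J + Q ^ (J ℕ.* (J ℕ.+ m)) * (h J * g (J ℕ.+ m)) ≈ cauchySum (suc m) J
cauchySum-suc m zero    = ring (Q ^ 0 ∷ g m ∷ []) (λ x y → con 0ℤ :+ x :* (con 0ℤ :* y) := con 0ℤ)
cauchySum-suc m (suc J) = linear
  (cauchySum m J ∷ cauchySum (suc m) J ∷ Q ∷ Q ^ J ∷ Q ^ (J ℕ.+ m) ∷ Q ^ (J ℕ.* (J ℕ.+ m)) ∷ Q ^ (J ℕ.* (J ℕ.+ suc m)) ∷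
   Q ^ (suc J ℕ.* (suc J ℕ.+ m)) ∷ h J ∷ g J ∷ g (J ℕ.+ m) ∷ g (suc (J ℕ.+ m)) ∷ g (J ℕ.+ suc m) ∷ [])
  (λ C C′ Q v w u u′ u″ hj gj G G′ G″ →
    (C :+ u :* (gj :* G) :+ u″ :* (gj :* G′) := C′ :+ u′ :* (gj :* G″)) ,
    (con 1ℤ , (C :+ u :* (hj :* G) := C′)) ∷
    (:- (u :* G) , (hj := (con 1ℤ :- v) :* gj)) ∷
    (:- (u :* v :* gj) , ((con 1ℤ :- Q :* w) :* G′ := G)) ∷
    (:- (u′ :* gj) , (G″ := G′)) ∷
    (:- (gj :* G′) , (u′ := u :* v)) ∷
    (gj :* G′ , (u″ := Q :* w :* v :* u)) ∷ [])
  (cauchySum-suc m J ∷ h≈ J ∷ g-suc (J ℕ.+ m) ∷ ≡⇒≈ (cong g (ℕ.+-suc J m))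
   ∷ trans (≡⇒≈ (cong (Q ^_) (lem₁ J m))) (^-homo-* Q (J ℕ.* (J ℕ.+ m)) J)
   ∷ trans (≡⇒≈ (cong (Q ^_) (lem₂ J m))) (trans (^-homo-* Q (suc (J ℕ.+ m) ℕ.+ J) (J ℕ.* (J ℕ.+ m))) (*-congʳ (^-homo-* Q (suc (J ℕ.+ m)) J))) ∷ [])
  where
  lem₁ : ∀ J m → J ℕ.* (J ℕ.+ suc m) ≡ J ℕ.* (J ℕ.+ m) ℕ.+ J
  lem₁ = ℕ-Solver.solve-∀
  lem₂ : ∀ J m → suc J ℕ.* (suc J ℕ.+ m) ≡ (suc (J ℕ.+ m) ℕ.+ J) ℕ.+ J ℕ.* (J ℕ.+ m)
  lem₂ = ℕ-Solver.solve-∀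

cauchySum-shift : ∀ m J i → cauchySum m J ≈[ J ] cauchySum (i ℕ.+ m) J
cauchySum-shift m J zero    = refl
cauchySum-shift m J (suc i) = trans (cauchySum-shift m J i) (trans (sym (trans (+-congˡ (vanish J)) (+-identityʳ _))) (weaken (cauchySum-suc (i ℕ.+ m) J)))
  where
  vanish : ∀ J → (Q ^ (J ℕ.* (J ℕ.+ (i ℕ.+ m))) * (h J * g (J ℕ.+ (i ℕ.+ m)))) ≈[ J ] 0#
  vanish zero    = below-zero
  vanish (suc J) = ^-vanish Q Q0 (ℕ.m≤m*n (suc J) (suc J ℕ.+ (i ℕ.+ m))) _

-- For j ≥ 1 the exponent j(j + M) is at least M, so only the summand j = 0 is visible.
cauchySum-far : ∀ M J → cauchySum M (suc J) ≈[ M ] g M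
cauchySum-far M zero    = weaken (linear (g 0 ∷ g M ∷ []) (λ g₀ g → (con 0ℤ :+ con 1ℤ :* (g₀ :* g) := g) , (g , (g₀ := con 1ℤ)) ∷ []) (g-zero ∷ []))
cauchySum-far M (suc J) = trans (+-cong (cauchySum-far M J)
  (^-vanish Q Q0 (ℕ.≤-trans (ℕ.m≤n+m M (suc J)) (ℕ.m≤n*m (suc J ℕ.+ M) (suc J))) _)) (+-identityʳ _)

cauchySum-below : ∀ m J → cauchySum m J ≈[ J ] g∞
cauchySum-below m zero    = below-zero
cauchySum-below m (suc J) = trans (cauchySum-shift m (suc J) (suc J))
  (trans (below-≤ (ℕ.m≤m+n (suc J) m) (cauchySum-far (suc J ℕ.+ m) J)) (g-below (ℕ.m≤m+n (suc J) m)))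

∑-triangle : ∀ N (F : ℕ → ℕ → PS) → ∑ N (λ n → ∑ (suc n) (λ k → F k (n ∸ k))) ≈ ∑ N (λ k → ∑ (N ∸ k) (F k))
∑-triangle zero    F = refl
∑-triangle (suc N) F = begin
  ∑ N (λ n → ∑ (suc n) (λ k → F k (n ∸ k))) + (∑ N (λ k → F k (N ∸ k)) + F N (N ∸ N))
    ≈⟨ +-cong (∑-triangle N F) (+-congˡ (≡⇒≈ (cong (F N) (ℕ.n∸n≡0 N)))) ⟩
  ∑ N (λ k → ∑ (N ∸ k) (F k)) + (∑ N (λ k → F k (N ∸ k)) + F N 0)
    ≈⟨ trans (sym (+-assoc _ _ _)) (+-cong (sym (∑-+ N _ _)) (sym (+-identityˡ (F N 0)))) ⟩
  ∑ N (λ k → ∑ (suc (N ∸ k)) (F k)) + ∑ 1 (F N)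
    ≈⟨ +-cong (∑-cong N (λ k k<N → ≡⇒≈ (cong (λ i → ∑ i (F k)) (≡.sym (ℕ.+-∸-assoc 1 (ℕ.<⇒≤ k<N))))))
              (≡⇒≈ (cong (λ i → ∑ i (F N)) (≡.sym (≡.trans (ℕ.+-∸-assoc 1 (ℕ.≤-refl {N})) (cong suc (ℕ.n∸n≡0 N)))))) ⟩
  ∑ (suc N) (λ k → ∑ (suc N ∸ k) (F k)) ∎

ξSum : ℕ → PS
ξSum N = ∑ N (λ n → Q ^ (n ℕ.* suc n) * A n)

-- With n = k + j, n(n+1) = k(k+1) + j(j+2k+1), so after exchanging the sums the inner one is
-- Cauchy's with m = 2k + 1.
ξSum-below : ∀ N → ξSum N ≈[ N ] (g∞ * ∑ N (λ k → a k * Q ^ (k ℕ.* suc k)))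
ξSum-below N = begin
  ξSum N
    ≈⟨ weaken (∑-cong N (λ n _ → trans (∑-distribˡ (Q ^ (n ℕ.* suc n)) (suc n) _) (∑-cong (suc n) (λ { k (s≤s k≤n) → term n k k≤n })))) ⟩
  ∑ N (λ n → ∑ (suc n) (λ k → F k (n ∸ k)))                                        ≈⟨ weaken (∑-triangle N F) ⟩
  ∑ N (λ k → ∑ (N ∸ k) (F k))
    ≈⟨ ∑-cong N (λ k k<N → trans (weaken (sym (∑-distribˡ (a k * Q ^ (k ℕ.* suc k)) (N ∸ k) _))) (inner k (ℕ.<⇒≤ k<N))) ⟩
  ∑ N (λ k → g∞ * (a k * Q ^ (k ℕ.* suc k)))                                        ≈⟨ weaken (∑-distribˡ g∞ N _) ⟨
  g∞ * ∑ N (λ k → a k * Q ^ (k ℕ.* suc k)) ∎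
  where
  F : ℕ → ℕ → PS
  F k j = a k * Q ^ (k ℕ.* suc k) * (Q ^ (j ℕ.* (j ℕ.+ suc (k ℕ.+ k))) * (g j * g (j ℕ.+ suc (k ℕ.+ k))))
  term′ : ∀ k j → Q ^ ((k ℕ.+ j) ℕ.* suc (k ℕ.+ j)) * (a k * (g j * g (suc ((k ℕ.+ j) ℕ.+ k)))) ≈ F k j
  term′ k j = linear (Q ^ ((k ℕ.+ j) ℕ.* suc (k ℕ.+ j)) ∷ Q ^ (k ℕ.* suc k) ∷ Q ^ (j ℕ.* (j ℕ.+ suc (k ℕ.+ k))) ∷ a k ∷ g j ∷
                      g (suc ((k ℕ.+ j) ℕ.+ k)) ∷ g (j ℕ.+ suc (k ℕ.+ k)) ∷ [])
    (λ x y z a gj G G′ → (x :* (a :* (gj :* G)) := a :* y :* (z :* (gj :* G′))) ,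
      (a :* gj :* G , (x := y :* z)) ∷ (a :* gj :* y :* z , (G := G′)) ∷ [])
    (trans (≡⇒≈ (cong (Q ^_) (lem₁ k j))) (^-homo-* Q (k ℕ.* suc k) _) ∷ ≡⇒≈ (cong g (lem₂ k j)) ∷ [])
    where
    lem₁ : ∀ k j → (k ℕ.+ j) ℕ.* suc (k ℕ.+ j) ≡ k ℕ.* suc k ℕ.+ j ℕ.* (j ℕ.+ suc (k ℕ.+ k))
    lem₁ = ℕ-Solver.solve-∀
    lem₂ : ∀ k j → suc ((k ℕ.+ j) ℕ.+ k) ≡ j ℕ.+ suc (k ℕ.+ k)
    lem₂ = ℕ-Solver.solve-∀
  term : ∀ n k → k ≤ n → Q ^ (n ℕ.* suc n) * (a k * (g (n ∸ k) * g (suc (n ℕ.+ k)))) ≈ F k (n ∸ k)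
  term n k k≤n = trans (≡⇒≈ (cong (λ i → Q ^ (i ℕ.* suc i) * (a k * (g (n ∸ k) * g (suc (i ℕ.+ k))))) (≡.sym (ℕ.m+[n∸m]≡n k≤n)))) (term′ k (n ∸ k))
  -- The inner sum has N - k terms and is accurate only to that order; the factor Q^(k(k+1))
  -- supplies the missing k.
  bound : ∀ k → k ≤ N → N ≤ k ℕ.* suc k ℕ.+ (N ∸ k)
  bound k k≤N = ℕ.≤-trans (ℕ.≤-reflexive (≡.sym (ℕ.m+[n∸m]≡n k≤N))) (ℕ.+-monoˡ-≤ (N ∸ k) (ℕ.m≤m*n k (suc k)))
  inner : ∀ k → k ≤ N → (a k * Q ^ (k ℕ.* suc k) * cauchySum (suc (k ℕ.+ k)) (N ∸ k)) ≈[ N ] (g∞ * (a k * Q ^ (k ℕ.* suc k)))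
  inner k k≤N = trans (weaken (*-assoc (a k) _ _)) (trans
    (*-congˡ (below-≤ (bound k k≤N) (^-below-cong Q0 (k ℕ.* suc k) (cauchySum-below (suc (k ℕ.+ k)) (N ∸ k)))))
    (weaken (ring (a k ∷ Q ^ (k ℕ.* suc k) ∷ g∞ ∷ []) (λ a x g → a :* (x :* g) := g :* (a :* x)))))

e-vanish : ∀ k → e k ≈[ k ] 0#
e-vanish zero    = below-zero
e-vanish (suc k) = trans (-‿cong (^-below Q Q0 (suc k) (e k))) (weaken (ring [] (:- con 0ℤ := con 0ℤ)))

a-vanish : ∀ k f → (a k * f) ≈[ k ] 0#
a-vanish k f = trans (weaken (*-assoc _ (c k) f)) (trans (weaken (*-assoc (e k) _ (c k * f))) (trans (*-congʳ (e-vanish k)) (weaken (zeroˡ _))))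

a∞ : PS
a∞ = lim (λ n → ∑ n a)

a-convergent : Convergent (λ n → ∑ n a)
a-convergent n = trans (+-congˡ (trans (weaken (sym (*-identityʳ (a n)))) (a-vanish n 1#))) (+-identityʳ _)

-- At the doubled index n = 2N, all k ≤ N leave n - k ≥ N, so both factors `g` may be replaced by
-- `g∞`. For k ≥ N the numerator `a k` vanishes below N.
A-below : ∀ N → A (N ℕ.+ N) ≈[ N ] (a∞ * (g∞ * g∞))
A-below N = begin
  A (N ℕ.+ N)                                          ≈⟨ ∑-cong (suc (N ℕ.+ N)) (λ k _ → term k) ⟩
  ∑ (suc (N ℕ.+ N)) (λ k → (g∞ * g∞) * a k)             ≈⟨ weaken (∑-distribˡ (g∞ * g∞) (suc (N ℕ.+ N)) a) ⟨
  (g∞ * g∞) * ∑ (suc (N ℕ.+ N)) a                       ≈⟨ *-congˡ (lim-below {λ n → ∑ n a} a-convergent (ℕ.m≤n⇒m≤1+n (ℕ.m≤m+n N N))) ⟨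
  (g∞ * g∞) * a∞                                        ≈⟨ *-comm (g∞ * g∞) a∞ ⟩
  a∞ * (g∞ * g∞)                                        ∎
  where
  term : ∀ k → (a k * (g (N ℕ.+ N ∸ k) * g (suc (N ℕ.+ N ℕ.+ k)))) ≈[ N ] (g∞ * g∞ * a k)
  term k with ℕ.≤-total k N
  ... | inj₁ k≤N = trans (*-congˡ (*-cong (g-below (ℕ.≤-trans (ℕ.m≤m+n N (N ∸ k)) (ℕ.≤-reflexive (≡.sym (ℕ.+-∸-assoc N k≤N)))))
                                         (g-below (ℕ.m≤n⇒m≤1+n (ℕ.≤-trans (ℕ.m≤m+n N N) (ℕ.m≤m+n (N ℕ.+ N) k))))))
                          (*-comm (a k) (g∞ * g∞))
  ... | inj₂ N≤k = trans (below-≤ N≤k (a-vanish k _)) (sym (trans (*-comm (g∞ * g∞) (a k)) (below-≤ N≤k (a-vanish k _))))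

-- The limit of the partial fraction expansion evaluates `a∞`, the sum of the `a k`, as an infinite
-- product.
partial-fractions-limit : poch∞ q Q * poch∞ (q ^ 5) Q * (a∞ * (g∞ * g∞)) ≈ 1#
partial-fractions-limit = below-all λ N → trans
  (*-cong (*-cong (poch∞-below Q0 q (ℕ.m≤n⇒m≤1+n (ℕ.m≤m+n N N))) (poch∞-below Q0 (q ^ 5) (ℕ.m≤n⇒m≤1+n (ℕ.m≤m+n N N)))) (sym (A-below N)))
  (weaken (partial-fractions (N ℕ.+ N)))

-- The factors of (q;q)₆ₙ are sorted by exponent modulo 6: residues 1 and 5, the even residues, and
-- the multiples of 3. The residue 0 is counted twice, hence the extra factor on the right.
poch-mod-6 : ∀ n → poch q Q n * poch (q ^ 5) Q n * poch (q ^ 2) (q ^ 2) (n ℕ.* 3) * poch (q ^ 3) (q ^ 3) (n ℕ.* 2)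
             ≈ poch q q (n ℕ.* 6) * poch Q Q n
poch-mod-6 zero    = ring [] (con 1ℤ :* con 1ℤ :* con 1ℤ :* con 1ℤ := con 1ℤ :* con 1ℤ)
poch-mod-6 (suc n) = linear
  (poch q Q n ∷ poch (q ^ 5) Q n ∷ poch (q ^ 2) (q ^ 2) (n ℕ.* 3) ∷ poch (q ^ 3) (q ^ 3) (n ℕ.* 2) ∷ poch q q (n ℕ.* 6) ∷ poch Q Q n ∷
   poch (q ^ 2) (q ^ 2) (suc n ℕ.* 3) ∷ poch (q ^ 3) (q ^ 3) (suc n ℕ.* 2) ∷ poch q q (suc n ℕ.* 6) ∷
   1# - q * Q ^ n ∷ 1# - q ^ 2 * Q ^ n ∷ 1# - q ^ 3 * Q ^ n ∷ 1# - q ^ 4 * Q ^ n ∷ 1# - q ^ 5 * Q ^ n ∷ 1# - Q * Q ^ n ∷ [])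
  (λ A B P₂ P₃ P P₆ P₂′ P₃′ P′ y₁ y₂ y₃ y₄ y₅ y₆ →
    (A :* y₁ :* (B :* y₅) :* P₂′ :* P₃′ := P′ :* (P₆ :* y₆)) ,
    (A :* y₁ :* (B :* y₅) :* P₃′ , (P₂′ := P₂ :* (y₂ :* y₄ :* y₆))) ∷
    (A :* y₁ :* (B :* y₅) :* P₂ :* (y₂ :* y₄ :* y₆) , (P₃′ := P₃ :* (y₃ :* y₆))) ∷
    (y₁ :* y₂ :* y₃ :* y₄ :* y₅ :* y₆ :* y₆ , (A :* B :* P₂ :* P₃ := P :* P₆)) ∷
    (:- (P₆ :* y₆) , (P′ := P :* (y₁ :* y₂ :* y₃ :* y₄ :* y₅ :* y₆))) ∷ [])
  (linear (poch (q ^ 2) (q ^ 2) (n ℕ.* 3) ∷ q ∷ (q ^ 2) ^ (n ℕ.* 3) ∷ Q ^ n ∷ [])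
     (λ P q t v →
       (P :* (con 1ℤ :- q :^ 2 :* t) :* (con 1ℤ :- q :^ 2 :* (q :^ 2 :* t)) :* (con 1ℤ :- q :^ 2 :* (q :^ 2 :* (q :^ 2 :* t)))
         := P :* ((con 1ℤ :- q :^ 2 :* v) :* (con 1ℤ :- q :^ 4 :* v) :* (con 1ℤ :- q :^ 6 :* v))) ,
       (P :* (:- (q :^ 2) :- q :^ 4 :- q :^ 6 :+ (q :^ 6 :+ q :^ 8 :+ q :^ 10) :* (t :+ v) :- q :^ 12 :* (t :^ 2 :+ t :* v :+ v :^ 2)) , (t := v)) ∷ [])
     (pow 2 3 {≡.refl} ∷ [])
   ∷ linear (poch (q ^ 3) (q ^ 3) (n ℕ.* 2) ∷ q ∷ (q ^ 3) ^ (n ℕ.* 2) ∷ Q ^ n ∷ [])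
     (λ P q t v →
       (P :* (con 1ℤ :- q :^ 3 :* t) :* (con 1ℤ :- q :^ 3 :* (q :^ 3 :* t)) := P :* ((con 1ℤ :- q :^ 3 :* v) :* (con 1ℤ :- q :^ 6 :* v))) ,
       (P :* (:- (q :^ 3) :- q :^ 6 :+ q :^ 9 :* (t :+ v)) , (t := v)) ∷ [])
     (pow 3 2 {≡.refl} ∷ [])
   ∷ poch-mod-6 n
   ∷ trans (product (poch q q (n ℕ.* 6)) (q ^ (n ℕ.* 6)))
       (*-congˡ (*-cong (*-cong (*-cong (*-cong (*-cong (replace q) (replace (q ^ 2))) (replace (q ^ 3))) (replace (q ^ 4))) (replace (q ^ 5))) (replace Q)))
   ∷ [])
  where
  pow : ∀ i j {ij : i ℕ.* j ≡ 6} → (q ^ i) ^ (n ℕ.* j) ≈ Q ^ n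
  pow i j {ij} = trans (^-assocʳ q i (n ℕ.* j)) (trans (≡⇒≈ (cong (q ^_) (≡.trans (lem i n j) (cong (ℕ._* n) ij)))) (sym (^-assocʳ q 6 n)))
    where
    lem : ∀ i n j → i ℕ.* (n ℕ.* j) ≡ i ℕ.* j ℕ.* n
    lem = ℕ-Solver.solve-∀
  replace : ∀ x → 1# - x * q ^ (n ℕ.* 6) ≈ 1# - x * Q ^ n
  replace x = +-congˡ (-‿cong (*-congˡ (trans (≡⇒≈ (cong (q ^_) (ℕ.*-comm n 6))) (sym (^-assocʳ q 6 n)))))
  product : ∀ P t → P * (1# - q * t) * (1# - q * (q * t)) * (1# - q * (q * (q * t))) * (1# - q * (q * (q * (q * t)))) *
                    (1# - q * (q * (q * (q * (q * t))))) * (1# - q * (q * (q * (q * (q * (q * t))))))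
                    ≈ P * ((1# - q * t) * (1# - q ^ 2 * t) * (1# - q ^ 3 * t) * (1# - q ^ 4 * t) * (1# - q ^ 5 * t) * (1# - Q * t))
  product P t = trans (*-cong (*-cong (*-cong (*-cong (*-congˡ (lower 2)) (lower 3)) (lower 4)) (lower 5)) (lower 6))
    (ring (P ∷ 1# - q * t ∷ 1# - q ^ 2 * t ∷ 1# - q ^ 3 * t ∷ 1# - q ^ 4 * t ∷ 1# - q ^ 5 * t ∷ 1# - Q * t ∷ [])
      (λ P a b c d e f → P :* a :* b :* c :* d :* e :* f := P :* (a :* b :* c :* d :* e :* f)))
    where
    iterate : ℕ → PS
    iterate zero    = t
    iterate (suc i) = q * iterate i
    iterate≈ : ∀ i → iterate i ≈ q ^ i * t
    iterate≈ zero    = sym (*-identityˡ t)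
    iterate≈ (suc i) = trans (*-congˡ (iterate≈ i)) (sym (*-assoc q (q ^ i) t))
    lower : ∀ i → 1# - iterate i ≈ 1# - q ^ i * t
    lower i = +-congˡ (-‿cong (iterate≈ i))


η₃² : η₃ ² ≈ eta Q
η₃² = trans (eta-∘ q²0 q³0) (poch∞-cong (q^∘q^ 3 2) (q^∘q^ 3 2))

poch∞-mod-6 : poch∞ q Q * poch∞ (q ^ 5) Q * η₂ * η₃ ≈ η₁ * eta Q
poch∞-mod-6 = below-all λ n → trans
  (*-cong (*-cong (*-cong (poch∞-below Q0 q ℕ.≤-refl) (poch∞-below Q0 (q ^ 5) ℕ.≤-refl)) (poch∞-below q²0 (q ^ 2) (ℕ.m≤m*n n 3)))
    (poch∞-below q³0 (q ^ 3) (ℕ.m≤m*n n 2)))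
  (trans (weaken (poch-mod-6 n)) (sym (*-cong (poch∞-below q0 q (ℕ.m≤m*n n 6)) (poch∞-below Q0 Q ℕ.≤-refl))))

-- Half of the part of ξ at exponents 3n + 1, after the shift by q: `g∞` is the value at q³ of 1/f₂,
-- and `a k * Q ^ (k * suc k)` trisects to `a k`.
C : PS
C = inv η₂ * a∞

C-η : C * η₁ ≈ η₃ * η₃ ²
C-η = *-cancelˡ η₂ η₂-zeroth (*-cancelˡ (eta Q) (eta-zeroth Q Q0) (linear
  (a∞ ∷ inv η₂ ∷ η₁ ∷ η₂ ∷ η₃ ∷ η₃ ² ∷ eta Q ∷ g∞ ∷ poch∞ q Q * poch∞ (q ^ 5) Q ∷ [])
  (λ a i f₁ f₂ f₃ G′ G g o →
    (G :* (f₂ :* (i :* a :* f₁)) := G :* (f₂ :* (f₃ :* G′))) ,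
    (G :* a :* f₁ , (f₂ :* i := con 1ℤ)) ∷
    (:- a , (o :* f₂ :* f₃ := f₁ :* G)) ∷
    (:- (a :* o :* f₂ :* f₃ :* (g :* G :+ con 1ℤ)) , (G :* g := con 1ℤ)) ∷
    (G :^ 2 :* f₂ :* f₃ , (o :* (a :* (g :* g)) := con 1ℤ)) ∷
    (:- (G :* f₂ :* f₃) , (G′ := G)) ∷ [])
  (*-inv η₂ η₂-zeroth ∷ poch∞-mod-6 ∷ *-inv (eta Q) (eta-zeroth Q Q0) ∷ partial-fractions-limit ∷ η₃² ∷ [])))

-- Trisection

-- α collects the coefficients of F at the multiples of 3.
Trisected : PS → PS → Set
Trisected F α = Σ PS λ β → Σ PS λ γ → F ≈ α ³ + q * β ³ + q ^ 2 * γ ³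

Trisected-at : ∀ {F α} → Trisected F α → ∀ n → F (n ℕ.* 3) ≡ α n
Trisected-at {F} {α} (β , γ , F≈) n = ≡.trans (coeff F≈ (n ℕ.* 3))
  (≡.trans (+-at (α ³ + q * β ³) (q ^ 2 * γ ³) (n ℕ.* 3)) (≡.trans (cong₂ ℤ._+_ (+-at (α ³) (q * β ³) (n ℕ.* 3)) (second n))
  (≡.trans (ℤ.+-identityʳ _) (≡.trans (cong₂ ℤ._+_ (∘^-multiple 3 α n) (first n)) (ℤ.+-identityʳ (α n))))))
  where
  first : ∀ n → (q * β ³) (n ℕ.* 3) ≡ 0ℤ
  first zero    = q*-zero (β ³)
  first (suc n) = ≡.trans (q*-suc (β ³) (2 ℕ.+ n ℕ.* 3)) (∘^-gap 3 β n (s≤s (s≤s (s≤s z≤n))))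
  second : ∀ n → (q ^ 2 * γ ³) (n ℕ.* 3) ≡ 0ℤ
  second zero    = ^-*-low 2 (γ ³) (s≤s z≤n)
  second (suc n) = ≡.trans (^-*-shift 2 (γ ³) (1 ℕ.+ n ℕ.* 3)) (∘^-gap 3 γ n (s≤s (s≤s z≤n)))

Trisected-* : ∀ {F α} f → Trisected F α → Trisected (f ³ * F) (f * α)
Trisected-* {F} {α} f (β , γ , F≈) = f * β , f * γ , linear
  (F ∷ f ³ ∷ α ³ ∷ β ³ ∷ γ ³ ∷ (f * α) ³ ∷ (f * β) ³ ∷ (f * γ) ³ ∷ q ∷ [])
  (λ F f α β γ α′ β′ γ′ q → (f :* F := α′ :+ q :* β′ :+ q :^ 2 :* γ′) ,
    (f , (F := α :+ q :* β :+ q :^ 2 :* γ)) ∷ (con -1ℤ , (α′ := f :* α)) ∷ (:- q , (β′ := f :* β)) ∷ (:- (q :^ 2) , (γ′ := f :* γ)) ∷ [])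
  (F≈ ∷ ∘-* q³0 f α ∷ ∘-* q³0 f β ∷ ∘-* q³0 f γ ∷ [])

Trisected-∑ : ∀ {F α} n → (∀ k → Trisected (F k) (α k)) → Trisected (∑ n F) (∑ n α)
Trisected-∑ zero    t = 0# , 0# , linear (0# ³ ∷ q ∷ []) (λ z q → (con 0ℤ := z :+ q :* z :+ q :^ 2 :* z) , (:- (con 1ℤ :+ q :+ q :^ 2) , (z := con 0ℤ)) ∷ [])
  (∘-const q³0 0ℤ ∷ [])
Trisected-∑ {F} {α} (suc n) t with Trisected-∑ n t | t n
... | β , γ , F≈ | β′ , γ′ , F′≈ = β + β′ , γ + γ′ , linear
  (∑ n F ∷ F n ∷ ∑ n α ³ ∷ β ³ ∷ γ ³ ∷ α n ³ ∷ β′ ³ ∷ γ′ ³ ∷ (∑ n α + α n) ³ ∷ (β + β′) ³ ∷ (γ + γ′) ³ ∷ q ∷ [])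
  (λ F F′ α β γ α′ β′ γ′ α″ β″ γ″ q → (F :+ F′ := α″ :+ q :* β″ :+ q :^ 2 :* γ″) ,
    (con 1ℤ , (F := α :+ q :* β :+ q :^ 2 :* γ)) ∷ (con 1ℤ , (F′ := α′ :+ q :* β′ :+ q :^ 2 :* γ′)) ∷
    (con -1ℤ , (α″ := α :+ α′)) ∷ (:- q , (β″ := β :+ β′)) ∷ (:- (q :^ 2) , (γ″ := γ :+ γ′)) ∷ [])
  (F≈ ∷ F′≈ ∷ ∘-+ q³0 _ _ ∷ ∘-+ q³0 _ _ ∷ ∘-+ q³0 _ _ ∷ [])

Q^-³ : ∀ k → (Q ^ k) ³ ≈ (Q ^ k) ^ 3
Q^-³ k = trans (∘-^ q³0 Q k) (trans (^-congˡ k (trans (q^∘q^ 6 3) (sym (^-assocʳ q 6 3)))) (^-swap Q 3 k))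

-- k(k+1)/2 + k(k+1) is three times k(k+1)/2, and the sign is unaffected.
e-³ : ∀ k → e k * Q ^ (k ℕ.* suc k) ≈ e k ³
e-³ zero    = trans (*-identityˡ 1#) (sym (∘-const q³0 1ℤ))
e-³ (suc k) = linear (e k ∷ Q ^ suc k ∷ Q ^ (k ℕ.* suc k) ∷ Q ^ (suc k ℕ.* suc (suc k)) ∷ e k ³ ∷ (Q ^ suc k) ³ ∷ e (suc k) ³ ∷ [])
  (λ e s x x′ E S E′ → ((:- (s :* e)) :* x′ := E′) ,
    (:- (s :* e) , (x′ := x :* (s :* s))) ∷ (:- (s :^ 3) , (e :* x := E)) ∷ (E , (S := s :^ 3)) ∷ (con -1ℤ , (E′ := :- (S :* E))) ∷ [])
  (trans (≡⇒≈ (cong (Q ^_) (lem k))) (trans (^-homo-* Q (k ℕ.* suc k) _) (*-congˡ (^-homo-* Q (suc k) (suc k))))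
   ∷ e-³ k ∷ Q^-³ (suc k) ∷ ∘-⟦⟧ q³0 (:- (var zero :* var (suc zero))) (Q ^ suc k ∷ e k ∷ []) ∷ [])
  where
  lem : ∀ k → suc k ℕ.* suc (suc k) ≡ k ℕ.* suc k ℕ.+ (suc k ℕ.+ suc k)
  lem = ℕ-Solver.solve-∀

-- (1 - xy)/((1 - x)(1 - y)) is the sum of all xⁱ and all yʲ⁺¹; for x = qQᵏ and y = q⁵Qᵏ the exponents divisible by 3
-- are those with 3 ∣ i and 3 ∣ j + 1, which gives the same expression in q³.
a-trisected : ∀ k → Trisected (a k * Q ^ (k ℕ.* suc k)) (a k)
-- With R = Qᵏ, the exponents 1 modulo 3 start with x = qR and y² = q · q⁹R², and the exponents 2
-- modulo 3 start with x² = q²R² and y = q² · q³R. The witnesses are these terms over 1 - x³ and 1 -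
-- y³, read before the substitution of q³.
a-trisected k = e k * (r * (1# - y) + q ^ 3 * r ^ 2 * (1# - x)) * c k , e k * (r ^ 2 * (1# - y) + q * r * (1# - x)) * c k , linear
  (q ∷ e k ∷ Q ^ (k ℕ.* suc k) ∷ c k ∷ Q ^ k ∷ r ³ ∷ e k ³ ∷ c k ³ ∷ x ³ ∷ y ³ ∷ q ³ ∷ a k ³ ∷
   (e k * (r * (1# - y) + q ^ 3 * r ^ 2 * (1# - x)) * c k) ³ ∷ (e k * (r ^ 2 * (1# - y) + q * r * (1# - x)) * c k) ³ ∷ [])
  (λ q e z c v R E Ĉ U₁ U₅ q₃ α β γ →
    let X = q :* R ; Y = q :^ 5 :* R ; XY = con 1ℤ :- q :^ 6 :* R :^ 2 in
    (e :* (con 1ℤ :- q :^ 6 :* v :^ 2) :* c :* z := α :+ q :* β :+ q :^ 2 :* γ) ,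
    (:- (e :* c :* z :* q :^ 6 :* (v :+ R)) , (v := R)) ∷
    (XY :* c , (e :* z := E)) ∷
    (:- (E :* XY :* c) , ((con 1ℤ :- U₁) :* (con 1ℤ :- U₅) :* Ĉ := con 1ℤ)) ∷
    (E :* Ĉ :* XY :* (con 1ℤ :+ X :+ X :^ 2) :* (con 1ℤ :+ Y :+ Y :^ 2) , ((con 1ℤ :- X) :* (con 1ℤ :- Y) :* c := con 1ℤ)) ∷
    (E :* Ĉ :* (U₅ :+ Y :+ Y :^ 2 :- XY :* c :* (con 1ℤ :- U₅)) , (U₁ := X :^ 3)) ∷
    (E :* Ĉ :* (X :+ X :^ 2 :+ X :^ 3 :- XY :* c :* (con 1ℤ :- X :^ 3)) , (U₅ := Y :^ 3)) ∷
    (:- (E :* Ĉ :* (con 1ℤ :- U₁) :* (q :* R :^ 2 :* (q₃ :^ 2 :+ q₃ :* q :^ 3 :+ q :^ 6) :+ q :^ 2 :* R)) , (q₃ := q :^ 3)) ∷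
    (con -1ℤ , (α := E :* (con 1ℤ :- U₁ :* U₅) :* Ĉ)) ∷
    (:- q , (β := E :* (R :* (con 1ℤ :- U₅) :+ q₃ :^ 3 :* R :^ 2 :* (con 1ℤ :- U₁)) :* Ĉ)) ∷
    (:- (q :^ 2) , (γ := E :* (R :^ 2 :* (con 1ℤ :- U₅) :+ q₃ :* R :* (con 1ℤ :- U₁)) :* Ĉ)) ∷ [])
  (sym r³
   ∷ e-³ k
   ∷ trans (sym (∘-⟦⟧ q³0 ((con 1ℤ :- var zero) :* (con 1ℤ :- var (suc zero)) :* var (suc (suc zero))) (x ∷ y ∷ c k ∷ [])))
       (trans (∘-cong q³0 (c-inverse k)) (∘-const q³0 1ℤ))
   ∷ trans (*-congʳ (*-cong (+-congˡ (-‿cong (*-congˡ r³))) (+-congˡ (-‿cong (*-congˡ r³))))) (c-inverse k)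
   ∷ cube q (q∘ q³0)
   ∷ cube (q ^ 5) (trans (q^∘q^ 5 3) (sym (trans (^-swap q 5 3) (^-assocʳ q 3 5))))
   ∷ q∘ q³0
   ∷ trans (∘-cong q³0 (ring (e k ∷ q ∷ Q ^ k ∷ c k ∷ []) (λ e q v c → e :* (con 1ℤ :- q :^ 6 :* v :^ 2) :* c := e :* (con 1ℤ :- q :* v :* (q :^ 5 :* v)) :* c)))
       (∘-⟦⟧ q³0 (var zero :* (con 1ℤ :- var (suc zero) :* var (suc (suc zero))) :* var (suc (suc (suc zero)))) (e k ∷ x ∷ y ∷ c k ∷ []))
   ∷ ∘-⟦⟧ q³0 (polynomial (λ e r x y q c → e :* (r :* (con 1ℤ :- y) :+ q :^ 3 :* r :^ 2 :* (con 1ℤ :- x)) :* c)) (e k ∷ r ∷ x ∷ y ∷ q ∷ c k ∷ [])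
   ∷ ∘-⟦⟧ q³0 (polynomial (λ e r x y q c → e :* (r :^ 2 :* (con 1ℤ :- y) :+ q :* r :* (con 1ℤ :- x)) :* c)) (e k ∷ r ∷ x ∷ y ∷ q ∷ c k ∷ [])
   ∷ [])
  where
  r x y : PS
  r = (q ^ 2) ^ k
  x = q * Q ^ k
  y = q ^ 5 * Q ^ k
  r³ : r ³ ≈ Q ^ k
  r³ = trans (∘-^ q³0 (q ^ 2) k) (^-congˡ k (q^∘q^ 2 3))
  polynomial : Form 6 exactly 6 → Polynomial 6
  polynomial f = f $ⁿ Modulo.variables exactly
  cube : ∀ u → u ³ ≈ u ^ 3 → (u * Q ^ k) ³ ≈ (u * r ³) ^ 3
  cube u u³ = trans (∘-* q³0 u (Q ^ k)) (trans (*-cong u³ (Q^-³ k)) (trans (sym (^-distrib-* u (Q ^ k) 3)) (^-congˡ 3 (*-congˡ (sym r³)))))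

-- Passage from the definition of `pXi` to these series

qPow≈ : ∀ m → qPow m ≈ q ^ m
qPow≈ m = ≐⇒Eq (go m)
  where
  go : ∀ m → qPow m ≐ q ^ m
  go zero    = coeff one≈1
  go (suc m) zero    = ≡.sym (q*-zero (q ^ m))
  go (suc m) (suc i) = ≡.trans (go m i) (≡.sym (q*-suc (q ^ m) i))

⊛≈* : ∀ f f′ → f ⊛ f′ ≈ f * f′
⊛≈* f f′ = ≐⇒Eq (⊛≐⊗ f f′)

oneMinusQ≈ : ∀ m → oneMinusQ m ≈ 1# - q ^ m
oneMinusQ≈ m = ≐⇒Eq λ n → ≡.trans (cong₂ (λ x y → x ℤ.+ ℤ.- y) (coeff one≈1 n) (coeff (qPow≈ m) n))
  (≡.sym (≡.trans (+-at 1# (- (q ^ m)) n) (cong (λ z → 1# n ℤ.+ z) (neg-at (q ^ m) n))))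

poch6≈ : ∀ i n → poch6 i n ≈ poch (q ^ i) Q n
poch6≈ i zero    = one≈1
poch6≈ i (suc n) = trans (⊛≈* _ _) (*-cong (poch6≈ i n) (trans (oneMinusQ≈ (i ℕ.+ 6 ℕ.* n))
  (+-congˡ (-‿cong (trans (^-homo-* q i (6 ℕ.* n)) (*-congˡ (sym (^-assocʳ q 6 n))))))))

xiTerm≈ : ∀ n → xiTerm (suc n) ≈ q * (Q ^ (n ℕ.* suc n) * A n)
xiTerm≈ n = trans (⊛≈* (qPow exp) (inv F)) (trans
  (*-cong (trans (qPow≈ exp) (trans (≡⇒≈ (cong (q ^_) exponent)) (*-congˡ (sym (^-assocʳ q 6 (n ℕ.* suc n))))))
          (sym (inv-unique F (A n) F0 (trans (*-congʳ F≈) (partial-fractions n)))))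
  (*-assoc q _ (A n)))
  where
  exp : ℕ
  exp = 6 ℕ.* suc n ℕ.* suc n ∸ 6 ℕ.* suc n ℕ.+ 1
  F : PS
  F = poch6 1 (suc n) ⊛ poch6 5 (suc n)
  F≈ : F ≈ poch q Q (suc n) * poch (q ^ 5) Q (suc n)
  F≈ = trans (⊛≈* _ _) (*-cong (trans (poch6≈ 1 (suc n)) (poch-cong (ring (q ∷ []) (λ q → q :^ 1 := q)) refl (suc n))) (poch6≈ 5 (suc n)))
  F0 : F 0 ≡ 1ℤ
  F0 = ≡.trans (coeff F≈ 0) (≡.trans (*-zeroth (poch q Q (suc n)) (poch (q ^ 5) Q (suc n)))
    (cong₂ ℤ._*_ (poch-zeroth q Q (suc n) q0) (poch-zeroth (q ^ 5) Q (suc n) (^-zeroth q 4 q0))))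
  exponent : 6 ℕ.* suc n ℕ.* suc n ∸ 6 ℕ.* suc n ℕ.+ 1 ≡ suc (6 ℕ.* (n ℕ.* suc n))
  exponent = ≡.trans (ℕ.+-comm _ 1) (cong suc (≡.trans (cong (_∸ 6 ℕ.* suc n) (lem n)) (ℕ.m+n∸n≡m (6 ℕ.* (n ℕ.* suc n)) (6 ℕ.* suc n))))
    where
    lem : ∀ n → 6 ℕ.* suc n ℕ.* suc n ≡ 6 ℕ.* (n ℕ.* suc n) ℕ.+ 6 ℕ.* suc n
    lem = ℕ-Solver.solve-∀

sumTo≡∑ : ∀ n F i → sumTo n F i ≡ ∑ n F i
sumTo≡∑ zero    F i = ≡.sym (0#-at i)
sumTo≡∑ (suc n) F i = ≡.trans (cong (ℤ._+ F n i) (sumTo≡∑ n F i)) (≡.sym (+-at (∑ n F) (F n) i))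

pXi-suc : ∀ m → pXi (suc m) ≡ + 2 ℤ.* ξSum (suc m) m
pXi-suc m = ≡.trans (ℤ.+-identityˡ _) (cong (+ 2 ℤ.*_) (≡.trans (sumTo≡∑ (suc m) (λ k → xiTerm (suc k)) (suc m))
  (≡.trans (coeff (trans (∑-cong (suc m) (λ k _ → xiTerm≈ k)) (sym (∑-distribˡ q (suc m) _))) (suc m)) (q*-suc (ξSum (suc m)) m))))

-- The truncation at 3m + 1 terms determines the coefficient at 3m and, after trisection, also the
-- coefficient of `C` at m.
ξSum-multiple : ∀ m → ξSum (suc (m ℕ.* 3)) (m ℕ.* 3) ≡ C m
ξSum-multiple m = ≡.trans (coeff< (ξSum-below N) (m ℕ.* 3) ℕ.≤-refl)
  (≡.trans (coeff (*-congʳ {x = ∑ N (λ k → a k * Q ^ (k ℕ.* suc k))} g∞≈) (m ℕ.* 3)) (≡.trans (Trisected-at {α = inv η₂ * ∑ N a} (Trisected-* (inv η₂) (Trisected-∑ {α = a} N a-trisected)) m)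
  (≡.sym (coeff< (*-congˡ {x = inv η₂} (lim-below {λ n → ∑ n a} a-convergent (ℕ.≤-refl {N}))) m (s≤s (ℕ.m≤m*n m 3))))))
  where
  N : ℕ
  N = suc (m ℕ.* 3)
  g∞≈ : g∞ ≈ inv η₂ ³
  g∞≈ = sym (inv-unique (eta Q) (inv η₂ ³) (eta-zeroth Q Q0)
    (trans (*-congʳ (sym (trans (eta-∘ q³0 q²0) (poch∞-cong (q^∘q^ 2 3) (q^∘q^ 2 3)))))
      (trans (sym (∘-* q³0 η₂ (inv η₂))) (trans (∘-cong q³0 (*-inv η₂ η₂-zeroth)) (∘-const q³0 1ℤ)))))

-- 25 is 11001 in binary; read from the last digit, this is the order odd, even, even, odd, odd of
-- the bisections.
C-divisible : ∀ n → + 9 ∣′ C (32 ℕ.* n ℕ.+ 25)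
C-divisible n = subst (λ i → + 9 ∣′ C i) (lem n) (subst (+ 9 ∣′_)
  (≡.trans (cong (λ z → odd (odd (even (even (odd C)))) n ℤ.- z) (0#-at n)) (ℤ.+-identityʳ _))
  (at (Dissections.odd-C₄ C-η) n tt))
  where
  lem : ∀ n → 1 ℕ.+ (1 ℕ.+ (1 ℕ.+ n ℕ.* 2) ℕ.* 2) ℕ.* 2 ℕ.* 2 ℕ.* 2 ≡ 32 ℕ.* n ℕ.+ 25
  lem = ℕ-Solver.solve-∀

theorem5p5 : (n : ℕ) → (+ 9) ∣ pXi (96 ℕ.* n ℕ.+ 76)
theorem5p5 n = ∣.∣⇒∣ᵤ (subst (λ i → + 9 ∣′ pXi i) (≡.sym (lem n)) (subst (+ 9 ∣′_)
  (≡.sym (≡.trans (pXi-suc ((32 ℕ.* n ℕ.+ 25) ℕ.* 3)) (cong (+ 2 ℤ.*_) (ξSum-multiple (32 ℕ.* n ℕ.+ 25)))))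
  (∣.∣n⇒∣m*n (+ 2) (C-divisible n))))
  where
  lem : ∀ n → 96 ℕ.* n ℕ.+ 76 ≡ suc ((32 ℕ.* n ℕ.+ 25) ℕ.* 3)
  lem = ℕ-Solver.solve-∀
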